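{- For any $\gamma>0$ there exists $\delta>0$ such that the following holds for all $n$. Let $G$ be an $n$-vertex graph containing no copy of $K_8$ with $\alpha(G)\le \delta\sqrt{n\log n}$. Then $e(G)\le \frac{n^2}{4}+\gamma n^2$.
   Context: $\alpha(G)$ is the independence number of $G$, $e(G)$ its number of edges, and $K_8$ the complete graph on 8 vertices. -}

module Defs where

open import Data.Nat as ℕ using (ℕ; zero; suc; _<ᵇ_)
open import Data.Bool using (Bool; true; false; if_then_else_; _∧_)
open import Data.Fin using (Fin; toℕ)
open import Data.Fin.Subset using (Subset; _∈_; ∣_∣)
open import Data.List using (allFin; map)
open import Data.Nat.ListAction using (sum)
open import Data.Integer using (+_)
open import Data.Rational using (ℚ; 0ℚ; 1ℚ; _+_; _*_; _/_; _≤_; 1/_; Positive)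
open import Data.Rational.Properties using (pos⇒nonZero)
open import Data.Product using (Σ; _×_)
open import Data.Unit using (⊤)
open import Data.Empty using (⊥)
open import Relation.Binary.PropositionalEquality using (_≡_; _≢_)
open import Relation.Nullary using (¬_)
open import Function.Definitions using (Injective)

record Graph (n : ℕ) : Set where
  field
    adj    : Fin n → Fin n → Bool
    sym    : ∀ i j → adj i j ≡ adj j i
    irrefl : ∀ i → adj i i ≡ false
open Graph public

e : ∀ {n} → Graph n → ℕ
e {n} G = sum (map (λ i → sum (map (λ j → if (toℕ j <ᵇ toℕ i) ∧ adj G i j then 1 else 0)
                                   (allFin n)))
                   (allFin n))

Independent : ∀ {n} → Graph n → Subset n → Set
Independent G S = ∀ i j → i ∈ S → j ∈ S → adj G i j ≡ false

ContainsK8 : ∀ {n} → Graph n → Set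
ContainsK8 {n} G = Σ (Fin 8 → Fin n) λ f →
  Injective _≡_ _≡_ f × (∀ i j → i ≢ j → adj G (f i) (f j) ≡ true)

expTerm : ℚ → ℕ → ℚ
expTerm q zero    = 1ℚ
expTerm q (suc j) = expTerm q j * q * (+ 1 / suc j)

expPartial : ℚ → ℕ → ℚ
expPartial q zero    = 1ℚ
expPartial q (suc k) = expPartial q k + expTerm q (suc k)

-- For q ≥ 0 and n ≥ 1:  q ≤ ln n  ⇔  exp q ≤ n  ⇔  every partial sum of the
-- exponential series at q is ≤ n (the partial sums increase to exp q).
LeLn : ℚ → ℕ → Set
LeLn q n = ∀ k → expPartial q k ≤ (+ n / 1)

-- a ≤ δ √(n ln n)  (natural logarithm), for δ > 0.
-- For n = suc m this is equivalent to  (a/δ)² / n ≤ ln n.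
-- For n = 0, ln 0 is undefined; we impose no condition (the conclusion is trivial there).
LeDeltaSqrtNLogN : (δ : ℚ) → .{{Positive δ}} → ℕ → ℕ → Set
LeDeltaSqrtNLogN δ zero    a = ⊤
LeDeltaSqrtNLogN δ (suc m) a =
  LeLn ((+ a / 1) * (1/ δ) {{pos⇒nonZero δ}} * (+ a / 1) * (1/ δ) {{pos⇒nonZero δ}}
          * (+ 1 / suc m))
       (suc m)

AlphaLeDeltaSqrtNLogN : ∀ {n} → Graph n → (δ : ℚ) → .{{Positive δ}} → Set
AlphaLeDeltaSqrtNLogN {n} G δ = ∀ S → Independent G S → LeDeltaSqrtNLogN δ n ∣ S ∣

{-# OPTIONS --safe #-}
module Submission where

-- Let m be a probability weight on the vertices whose edge density Σ m(u) m(v) A(u,v) is, up to a tiny error,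
-- the largest possible among weights spread over linearly many vertices, and suppose this density exceeds 1/2.
-- Comparing m with m (1 ± g/2) shows that A is almost negative semidefinite on perturbations g of mean zero.
-- Consequently a sparse vertex set looks the same as each of its large subsets from every other large set, so
-- sparse sets automatically form regular pairs and no regularity lemma is needed.  A K₈-free graph is covered,
-- up to small measure, by the vertices nearly non-adjacent to one of at most four sparse centres that are
-- pairwise dense.  Sets of linear size contain triangles, because a triangle-free graph on N vertices has an
-- independent set of order √(N log N) (Ajtai, Komlós and Szemerédi, in the form of a proof by Alon), and dense
-- pairs contain a K₅ with three vertices on one side (dependent random choice).  These two facts turn too large
-- densities between the centres into a K₈; the remaining density patterns on two, three or four centres all have
-- Lagrangian at most 1/2.  Hence the largest density decreases by a fixed amount at each step until it is
-- at most 1/2 + o(1).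

open import Defs using (Graph; adj; Independent; ContainsK8; expTerm; expPartial; LeLn; LeDeltaSqrtNLogN; AlphaLeDeltaSqrtNLogN)
open import Algebra.Bundles using (CommutativeRing)
open import Data.Bool using (Bool; true; false; _∧_; _∨_; not; if_then_else_)
import Data.Bool.Properties as Bool
open import Data.Empty using (⊥; ⊥-elim)
open import Data.Fin using (Fin; zero; suc; toℕ)
import Data.Fin.Properties as Fin
open import Data.Integer using (+_)
import Data.Integer as ℤ
import Data.Integer.Properties as ℤ
open import Data.List using (List; []; _∷_; _++_; length; allFin; tabulate; map; lookup)
open import Data.List.Membership.Propositional using (_∈_)
open import Data.List.Membership.Propositional.Properties using (∈-∃++; ∈-allFin; ∈-lookup)
open import Data.List.Properties using (length-++)
open import Data.List.Relation.Binary.Permutation.Propositional using (_↭_; prep; ↭-sym; ↭-trans; ↭-prep; ↭-refl)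
import Data.List.Relation.Binary.Permutation.Propositional as ↭
import Data.List.Relation.Binary.Permutation.Propositional.Properties as ↭
open import Data.List.Relation.Unary.All as All using (All; []; _∷_)
import Data.List.Relation.Unary.All.Properties as All
open import Data.List.Relation.Unary.AllPairs as AllPairs using (AllPairs; []; _∷_)
import Data.List.Relation.Unary.AllPairs.Properties as AllPairs
open import Data.List.Relation.Unary.Any using (here; there)
import Data.List.Relation.Unary.Unique.Propositional.Properties as Unique
open import Data.Maybe using (Maybe; just; nothing)
open import Data.Nat as ℕ using (ℕ; zero; suc)
open import Data.Nat.ListAction using (sum)
import Data.Nat.Properties as ℕ
open import Data.Product using (Σ; _×_; _,_; proj₁; proj₂)
open import Data.Rational hiding (∣_∣)
open import Data.Rational.Properties
open import Data.Rational.Unnormalised as ℚᵘ using (mkℚᵘ)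
import Data.Rational.Unnormalised.Properties as ℚᵘ
open import Data.Fin.Subset using (Subset; ∣_∣) renaming (_∈_ to _∈ₛ_; ⊥ to ∅)
open import Data.Fin.Subset.Properties using (anySubset?; _∈?_; ∣p∣≤n; ∉⊥)
open import Data.Sum using (_⊎_; inj₁; inj₂)
open import Data.Unit using (⊤; tt)
import Data.Vec as Vec
import Data.Vec.Properties as Vec
open import Function using (_∘_; id)
open import Function.Definitions using (Injective)
open import Relation.Binary.PropositionalEquality
  using (_≡_; _≢_; refl; sym; trans; cong; cong₂; subst; subst₂)
open import Relation.Nullary using (¬_; Dec; yes; no; does; dec⇒maybe)
open import Relation.Nullary.Decidable using (True; toWitness; dec-true; dec-false; map′; _→-dec_; _×-dec_)
open import Tactic.RingSolver using (solve-∀)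
open import Tactic.RingSolver.Core.AlmostCommutativeRing using (AlmostCommutativeRing; fromCommutativeRing)
open import Algebra.Properties.Semiring.Sum (CommutativeRing.semiring +-*-commutativeRing)
  using (sum-cong-≗; ∑-distrib-+; *-distribˡ-sum) renaming (sum to ∑ᶠ; ∑-comm to sum-comm)

-- Weights replace vertex counts because they can be perturbed by small factors. The price is
-- spread: the perturbing factor is at most 3/2 and the new mass at least 1/2, so a weight with m(v)
-- n ≤ K turns into one with bound 3 K. Each density bound is therefore proved for all K at once,
-- with `δ` depending on K. The stability error `τ` depends only on `ε`, so the decrement is uniform
-- and finitely many steps lead down from the trivial density 1. A K₈ is assembled from vertices,
-- edges and triangles of single parts and the K₅ of a dense pair. Choosing k vertices in one part
-- leaves at least the proportion 1 - k (1 - p) of a part joined to it with density p. The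
-- splittings 1 + 1 + 1 + 5, 1 + 2 + 5 and 2 + 3 + 3 thus exclude five linked parts and produce the
-- thresholds 1/2 and 2/3; a K₅ with 2 + 3 vertices in two parts, completed by a triangle in a
-- third, produces the condition 2p + 3r > 4. These are exactly the patterns that the Lagrangian
-- estimates need. The theorem is uniform in n because for small n ≥ 1 the hypothesis fails: it
-- would force α < 1.

ℚ-ring : AlmostCommutativeRing _ _
ℚ-ring = fromCommutativeRing +-*-commutativeRing (λ x → dec⇒maybe (0ℚ ≟ x))

-- Certificates for inequalities, finite sums and indicator functions

infixl 6 _⊕_
infixl 7 _⊗_

nonneg! : ∀ q {_ : True (0ℚ ≤? q)} → 0ℚ ≤ q
nonneg! q {t} = toWitness t

≤! : ∀ p q {_ : True (p ≤? q)} → p ≤ q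
≤! p q {t} = toWitness t

positive! : ∀ q {_ : True (0ℚ <? q)} → 0ℚ < q
positive! q {t} = toWitness t

_⊕_ : ∀ {a b} → 0ℚ ≤ a → 0ℚ ≤ b → 0ℚ ≤ a + b
p ⊕ q = +-mono-≤ p q

_⊗_ : ∀ {a b} → 0ℚ ≤ a → 0ℚ ≤ b → 0ℚ ≤ a * b
_⊗_ {a} {b} p q =
  nonNegative⁻¹ (a * b) {{nonNeg*nonNeg⇒nonNeg a {{nonNegative p}} b {{nonNegative q}}}}

_⊗⁺_ : ∀ {a b} → 0ℚ < a → 0ℚ < b → 0ℚ < a * b
_⊗⁺_ {a} {b} p q =
  positive⁻¹ (a * b) {{pos*pos⇒pos a {{positive p}} b {{positive q}}}}

gap : ∀ {a b} → a ≤ b → 0ℚ ≤ b - a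
gap {a} {b} p = subst (_≤ b - a) (+-inverseʳ a) (+-monoˡ-≤ (- a) p)

sub-add : ∀ a b → b - a + a ≡ b
sub-add = solve-∀ ℚ-ring

-- Inequalities are proved by a certificate: b - a is rewritten as a sum of products of non-negative factors,
-- and the proof term of 0 ≤ d displays these factors.
lin : ∀ {a b d} → 0ℚ ≤ d → b - a ≡ d → a ≤ b
lin {a} {b} {d} p refl = subst₂ _≤_ (+-identityˡ a) (sub-add a b) (+-monoˡ-≤ a p)

lin< : ∀ {a b d} → 0ℚ < d → b - a ≡ d → a < b
lin< {a} {b} {d} p refl = subst₂ _<_ (+-identityˡ a) (sub-add a b) (+-monoˡ-< a p)

square-nonneg-ring : ∀ a → a * a - 0ℚ ≡ (0ℚ - a) * (0ℚ - a)
square-nonneg-ring = solve-∀ ℚ-ring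

square-nonneg : ∀ a → 0ℚ ≤ a * a
square-nonneg a with ≤-total 0ℚ a
... | inj₁ p = p ⊗ p
... | inj₂ p = lin (gap p ⊗ gap p) (square-nonneg-ring a)

absurd : ∀ {a b} → a ≤ b → b < a → ⊥
absurd p q = <-irrefl refl (≤-<-trans p q)

cancel-≤ : ∀ {c a b} → 0ℚ < c → c * a ≤ c * b → a ≤ b
cancel-≤ {c} p = *-cancelˡ-≤-pos c {{positive p}}

opaque

  ∑ : ∀ {n} → (Fin n → ℚ) → ℚ
  ∑ = ∑ᶠ

  ∑-cong : ∀ {n} {f g : Fin n → ℚ} → (∀ i → f i ≡ g i) → ∑ f ≡ ∑ g
  ∑-cong = sum-cong-≗

  ∑-+ : ∀ {n} (f g : Fin n → ℚ) → ∑ (λ i → f i + g i) ≡ ∑ f + ∑ g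
  ∑-+ = ∑-distrib-+

  ∑-* : ∀ {n} c (f : Fin n → ℚ) → ∑ (λ i → c * f i) ≡ c * ∑ f
  ∑-* c f = sym (*-distribˡ-sum c f)

  ∑-empty : ∀ {f : Fin 0 → ℚ} → ∑ f ≡ 0ℚ
  ∑-empty = refl

  ∑-suc : ∀ {n} (f : Fin (suc n) → ℚ) → ∑ f ≡ f zero + ∑ (λ i → f (suc i))
  ∑-suc f = refl

  ∑-comm : ∀ {m n} (f : Fin m → Fin n → ℚ) → ∑ (λ i → ∑ (f i)) ≡ ∑ (λ j → ∑ (λ i → f i j))
  ∑-comm = sum-comm

  ∑-mono : ∀ {n} {f g : Fin n → ℚ} → (∀ i → f i ≤ g i) → ∑ f ≤ ∑ g
  ∑-mono {zero}  p = ≤-refl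
  ∑-mono {suc n} p = +-mono-≤ (p zero) (∑-mono (λ i → p (suc i)))

  ∑-zero : ∀ n → ∑ {n} (λ _ → 0ℚ) ≡ 0ℚ
  ∑-zero zero    = refl
  ∑-zero (suc n) = trans (+-identityˡ _) (∑-zero n)

  ∑-nonneg : ∀ {n} {f : Fin n → ℚ} → (∀ i → 0ℚ ≤ f i) → 0ℚ ≤ ∑ f
  ∑-nonneg {n} {f} p = subst (_≤ ∑ f) (∑-zero n) (∑-mono p)

  ∑-large : ∀ {n} (f : Fin n → ℚ) → 0ℚ < ∑ f → Σ (Fin n) λ i → 0ℚ < f i
  ∑-large {zero}  f p = ⊥-elim (<-irrefl refl p)
  ∑-large {suc n} f p with 0ℚ <? f zero
  ... | yes q = zero , q
  ... | no ¬q with ∑-large (λ i → f (suc i)) (<-≤-trans p (≤-trans (+-monoˡ-≤ _ (≮⇒≥ ¬q)) (≤-reflexive (+-identityˡ _))))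
  ...   | i , r = suc i , r

∑-linear : ∀ {n} x y (f g : Fin n → ℚ) → ∑ (λ i → x * f i + y * g i) ≡ x * ∑ f + y * ∑ g
∑-linear x y f g = trans (∑-+ (λ i → x * f i) (λ i → y * g i)) (cong₂ _+_ (∑-* x f) (∑-* y g))

fromℕ : ℕ → ℚ
fromℕ n = + n / 1

fromℕ-+ : ∀ a b → fromℕ (a ℕ.+ b) ≡ fromℕ a + fromℕ b
fromℕ-+ a b = toℚᵘ-injective (ℚᵘ.≃-trans (toℚᵘ-fromℚᵘ (mkℚᵘ (+ (a ℕ.+ b)) 0))
  (ℚᵘ.≃-trans (ℚᵘ.*≡* (cong (ℤ._* + 1) (sym (trans (cong₂ ℤ._+_ (ℤ.*-identityʳ (+ a)) (ℤ.*-identityʳ (+ b))) refl))))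
  (ℚᵘ.≃-sym (ℚᵘ.≃-trans (toℚᵘ-homo-+ (fromℕ a) (fromℕ b))
    (ℚᵘ.+-cong (toℚᵘ-fromℚᵘ (mkℚᵘ (+ a) 0)) (toℚᵘ-fromℚᵘ (mkℚᵘ (+ b) 0)))))))

fromℕ-*-ring : ∀ x y → y + x * y ≡ (1ℚ + x) * y
fromℕ-*-ring = solve-∀ ℚ-ring

fromℕ-* : ∀ a b → fromℕ (a ℕ.* b) ≡ fromℕ a * fromℕ b
fromℕ-* zero    b = sym (*-zeroˡ (fromℕ b))
fromℕ-* (suc a) b = trans (fromℕ-+ b (a ℕ.* b)) (trans (cong (_+_ (fromℕ b)) (fromℕ-* a b))
  (trans (fromℕ-*-ring (fromℕ a) (fromℕ b)) (cong (_* fromℕ b) (sym (fromℕ-+ 1 a)))))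

fromℕ-suc : ∀ a → fromℕ (suc a) ≡ 1ℚ + fromℕ a
fromℕ-suc a = fromℕ-+ 1 a

fromℕ-mono : ∀ {a b} → a ℕ.≤ b → fromℕ a ≤ fromℕ b
fromℕ-mono {a} {b} p with ℕ.m≤n⇒∃[o]m+o≡n p
... | c , refl = subst₂ _≤_ (+-identityʳ (fromℕ a)) (sym (fromℕ-+ a c))
  (+-monoʳ-≤ (fromℕ a) (fromℕ-nonneg c))
  where
  fromℕ-nonneg : ∀ c → 0ℚ ≤ fromℕ c
  fromℕ-nonneg zero = ≤-refl
  fromℕ-nonneg (suc c) = subst (0ℚ ≤_) (sym (fromℕ-suc c)) (nonneg! 1ℚ ⊕ fromℕ-nonneg c)

χ : Bool → ℚ
χ true  = 1ℚ
χ false = 0ℚ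

χ-nonneg : ∀ b → 0ℚ ≤ χ b
χ-nonneg true  = nonneg! 1ℚ
χ-nonneg false = nonneg! 0ℚ

χ≤1 : ∀ b → χ b ≤ 1ℚ
χ≤1 true  = ≤-refl
χ≤1 false = nonneg! 1ℚ

χ-∧ : ∀ a b → χ (a ∧ b) ≡ χ a * χ b
χ-∧ true  b = sym (*-identityˡ (χ b))
χ-∧ false b = sym (*-zeroˡ (χ b))

χ-split : ∀ x b → χ x ≡ χ (x ∧ b) + χ (x ∧ not b)
χ-split true  true  = refl
χ-split true  false = refl
χ-split false b     = refl

χ-mono : ∀ {a b} → (a ≡ true → b ≡ true) → χ a ≤ χ b
χ-mono {false} {b} f = χ-nonneg b
χ-mono {true} {b} f rewrite f refl = ≤-refl

does-true : ∀ {ℓ} {P : Set ℓ} (d : Dec P) → does d ≡ true → P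
does-true (yes p) _ = p

does-false : ∀ {ℓ} {P : Set ℓ} (d : Dec P) → does d ≡ false → ¬ P
does-false (no ¬p) _ = ¬p

not-true : ∀ {b} → not b ≡ true → b ≡ false
not-true {false} _ = refl

∧-fst : ∀ {a b} → a ∧ b ≡ true → a ≡ true
∧-fst {true} _ = refl

∧-snd : ∀ {a b} → a ∧ b ≡ true → b ≡ true
∧-snd {true} p = p

∧-both : ∀ {a b} → a ≡ true → b ≡ true → a ∧ b ≡ true
∧-both refl refl = refl

2ℚ 3ℚ 4ℚ 8ℚ : ℚ
2ℚ = + 2 / 1
3ℚ = + 3 / 1
4ℚ = + 4 / 1
8ℚ = + 8 / 1

-- Weighted graphs and cliques

Vset : ℕ → Set
Vset n = Fin n → Bool

_⊆_ : ∀ {n} → Vset n → Vset n → Set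
X ⊆ Y = ∀ v → X v ≡ true → Y v ≡ true

⊆-trans : ∀ {n} {X Y Z : Vset n} → X ⊆ Y → Y ⊆ Z → X ⊆ Z
⊆-trans p q v x = q v (p v x)

infixl 7 _∩_ _∖_

_∩_ _∖_ : ∀ {n} → Vset n → Vset n → Vset n
(X ∩ Y) v = X v ∧ Y v
(X ∖ Y) v = X v ∧ not (Y v)

full : ∀ {n} → Vset n
full _ = true

module _ {n : ℕ} (G : Graph n) where

  Adj : Fin n → Fin n → Set
  Adj u v = adj G u v ≡ true

  nbhd : Fin n → Vset n → Vset n
  nbhd v Y w = adj G v w ∧ Y w

  nbhds : List (Fin n) → Vset n → Vset n
  nbhds []       Y = Y
  nbhds (v ∷ vs) Y = nbhd v (nbhds vs Y)

  nbhds⊆ : ∀ vs {Y} → nbhds vs Y ⊆ Y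
  nbhds⊆ []       v p = p
  nbhds⊆ (x ∷ vs) v p = nbhds⊆ vs v (∧-snd {adj G x v} p)

  nbhds-adj : ∀ vs {Y w} → nbhds vs Y w ≡ true → All (λ v → Adj v w) vs
  nbhds-adj []       p = []
  nbhds-adj (v ∷ vs) {Y} {w} p = ∧-fst p ∷ nbhds-adj vs (∧-snd {adj G v w} p)

  nbhds-true : ∀ vs {Y w} → All (λ v → Adj v w) vs → Y w ≡ true → nbhds vs Y w ≡ true
  nbhds-true []       []       q = q
  nbhds-true (v ∷ vs) (p ∷ ps) q = ∧-both p (nbhds-true vs ps q)

  nbhds-++ : ∀ vs ws {Y} → Y ⊆ nbhds vs full → nbhds ws Y ⊆ nbhds (vs ++ ws) full
  nbhds-++ vs ws {Y} p v q = nbhds-true (vs ++ ws)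
    (All.++⁺ (nbhds-adj vs {full} (p v (nbhds⊆ ws v q))) (nbhds-adj ws {Y} q)) refl

  record Clique (k : ℕ) (X : Vset n) : Set where
    constructor clique
    field
      members : List (Fin n)
      size    : length members ≡ k
      pairs   : AllPairs Adj members
      inside  : All (λ v → X v ≡ true) members

  open Clique public

  widen : ∀ {k X Y} → X ⊆ Y → Clique k X → Clique k Y
  widen X⊆Y (clique vs s p i) = clique vs s p (All.map (λ {v} → X⊆Y v) i)

  empty-clique : Clique 0 full
  empty-clique = clique [] refl [] []

  singleton : ∀ {X} v → X v ≡ true → Clique 1 X
  singleton v p = clique (v ∷ []) refl ([] ∷ []) (p ∷ [])

  edge : ∀ {X} → Clique 3 X → Clique 2 X
  edge (clique (u ∷ v ∷ w ∷ []) refl ((p ∷ _) ∷ _) (a ∷ b ∷ _)) =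
    clique (u ∷ v ∷ []) refl ((p ∷ []) ∷ [] ∷ []) (a ∷ b ∷ [])

  append : ∀ {j k X} (c : Clique j full) → Clique k X → X ⊆ nbhds (members c) full → Clique (j ℕ.+ k) full
  append c d sub = clique (members c ++ members d)
    (trans (length-++ (members c)) (cong₂ ℕ._+_ (size c) (size d)))
    (AllPairs.++⁺ (pairs c) (pairs d)
      (All.tabulate λ x∈ → All.map (λ {w} r → All.lookup (nbhds-adj (members c) {full} (sub w r)) x∈) (inside d)))
    (All.++⁺ (inside c) (All.map (λ _ → refl) (inside d)))

pointwise-ring₃ : ∀ y → 0ℚ + y - (0ℚ + 0ℚ) ≡ y
pointwise-ring₃ = solve-∀ ℚ-ring

swap-ring : ∀ a b c d e → a * (b * (c * (d * e))) ≡ c * (d * (a * (b * e)))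
swap-ring = solve-∀ ℚ-ring

form≤I*I-ring : ∀ x a b → x * b - x * a ≡ x * (b - a)
form≤I*I-ring = solve-∀ ℚ-ring

form-scale-ring : ∀ x y a b → x * a * (y * b) ≡ x * y * (a * b)
form-scale-ring = solve-∀ ℚ-ring

form-monoˡ-ring : ∀ x y a → y * a - x * a ≡ (y - x) * a
form-monoˡ-ring = solve-∀ ℚ-ring

form-linearˡ-ring : ∀ x y b c a → (x * b + y * c) * a ≡ x * (b * a) + y * (c * a)
form-linearˡ-ring = solve-∀ ℚ-ring

deg≤I-ring : ∀ x a → x - x * a ≡ x * (1ℚ - a)
deg≤I-ring = solve-∀ ℚ-ring

I-*-ring : ∀ x a b → a * (x * b) ≡ x * (a * b)
I-*-ring = solve-∀ ℚ-ring

I-linear-ring : ∀ x y a b c → a * (x * b + y * c) ≡ x * (a * b) + y * (a * c)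
I-linear-ring = solve-∀ ℚ-ring

μ-nbhds-ring : ∀ y k l d z z′ w → w - (z - (1ℚ + l) * k) ≡ (d - (y - k)) + (z′ - (z - l * k)) + (w + y - (d + z′))
μ-nbhds-ring = solve-∀ ℚ-ring

μ-nbhds-ring₁ : ∀ a b → a - 0ℚ * b ≡ a
μ-nbhds-ring₁ = solve-∀ ℚ-ring

form-square-ring : ∀ x y a b c → x * (x * a + y * b) + y * (x * b + y * c)
  ≡ x * x * a + (1ℚ + 1ℚ) * (x * y) * b + y * y * c
form-square-ring = solve-∀ ℚ-ring

module Measure {n : ℕ} (G : Graph n) (m : Fin n → ℚ) (m≥0 : ∀ v → 0ℚ ≤ m v) where

  A : Fin n → Fin n → ℚ
  A u v = χ (adj G u v)

  opaque

    I : (Fin n → ℚ) → ℚ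
    I f = ∑ (λ u → m u * f u)

    I-cong : ∀ {f g} → (∀ v → f v ≡ g v) → I f ≡ I g
    I-cong p = ∑-cong (λ v → cong (m v *_) (p v))

    I-mono : ∀ {f g} → (∀ v → f v ≤ g v) → I f ≤ I g
    I-mono p = ∑-mono (λ v → lin (m≥0 v ⊗ gap (p v)) (form≤I*I-ring (m v) _ _))

    I-nonneg : ∀ {f} → (∀ v → 0ℚ ≤ f v) → 0ℚ ≤ I f
    I-nonneg p = ∑-nonneg (λ v → m≥0 v ⊗ p v)

    I-linear : ∀ x y f g → I (λ v → x * f v + y * g v) ≡ x * I f + y * I g
    I-linear x y f g = trans (∑-cong (λ v → I-linear-ring x y (m v) (f v) (g v))) (∑-linear x y _ _)

    I-+ : ∀ f g → I (λ v → f v + g v) ≡ I f + I g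
    I-+ f g = trans (∑-cong (λ v → *-distribˡ-+ (m v) (f v) (g v))) (∑-+ _ _)

    I-* : ∀ x f → I (λ v → x * f v) ≡ x * I f
    I-* x f = trans (∑-cong (λ v → I-*-ring x (m v) (f v))) (∑-* x _)

  opaque

    deg : (Fin n → ℚ) → Fin n → ℚ
    deg f u = I (λ v → f v * A u v)

    deg-nonneg : ∀ {f} u → (∀ v → 0ℚ ≤ f v) → 0ℚ ≤ deg f u
    deg-nonneg u p = I-nonneg (λ v → p v ⊗ χ-nonneg (adj G u v))

    deg≤I : ∀ {f} u → (∀ v → 0ℚ ≤ f v) → deg f u ≤ I f
    deg≤I {f} u p = I-mono (λ v → lin (p v ⊗ gap (χ≤1 (adj G u v))) (deg≤I-ring (f v) (A u v)))

  opaque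

    -- The bilinear form Σ f(u) m(u) A(u,v) m(v) g(v) of the weighted adjacency matrix.
    ⟨_,_⟩ : (Fin n → ℚ) → (Fin n → ℚ) → ℚ
    ⟨ f , g ⟩ = I (λ u → f u * deg g u)

    form-linearˡ : ∀ x y f g h → ⟨ (λ v → x * f v + y * g v) , h ⟩ ≡ x * ⟨ f , h ⟩ + y * ⟨ g , h ⟩
    form-linearˡ x y f g h = trans (I-cong (λ v → form-linearˡ-ring x y (f v) (g v) (deg h v))) (I-linear x y _ _)

    form-nonneg : ∀ {f g} → (∀ v → 0ℚ ≤ f v) → (∀ v → 0ℚ ≤ g v) → 0ℚ ≤ ⟨ f , g ⟩
    form-nonneg p q = I-nonneg (λ u → p u ⊗ deg-nonneg u q)

    form-monoˡ : ∀ {f f′ g} → (∀ v → f v ≤ f′ v) → (∀ v → 0ℚ ≤ g v) → ⟨ f , g ⟩ ≤ ⟨ f′ , g ⟩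
    form-monoˡ {f} {f′} {g} p q = I-mono (λ u → lin (gap (p u) ⊗ deg-nonneg u q) (form-monoˡ-ring (f u) (f′ u) (deg g u)))

  opaque
    unfolding I deg ⟨_,_⟩

    form-scale : ∀ x y f g → ⟨ (λ v → x * f v) , (λ v → y * g v) ⟩ ≡ x * y * ⟨ f , g ⟩
    form-scale x y f g =
      trans (I-cong (λ u → trans (cong (x * f u *_) (trans (I-cong (λ v → *-assoc y (g v) (A u v))) (I-* y _)))
        (form-scale-ring x y (f u) (deg g u)))) (I-* (x * y) _)

  opaque
    unfolding I deg ⟨_,_⟩

    form-sym : ∀ f g → ⟨ f , g ⟩ ≡ ⟨ g , f ⟩
    form-sym f g = trans (∑-cong (λ u → expand f g u))
      (trans (∑-comm (λ u v → m u * (f u * (m v * (g v * A u v)))))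
      (trans (∑-cong (λ v → ∑-cong (λ u → swap u v))) (sym (∑-cong (λ u → expand g f u)))))
      where
      expand : ∀ (f g : Fin n → ℚ) u → m u * (f u * deg g u) ≡ ∑ (λ v → m u * (f u * (m v * (g v * A u v))))
      expand f g u = trans (cong (m u *_) (sym (∑-* (f u) _))) (sym (∑-* (m u) _))
      swap : ∀ u v → m u * (f u * (m v * (g v * A u v))) ≡ m v * (g v * (m u * (f u * A v u)))
      swap u v rewrite Graph.sym G u v = swap-ring (m u) (f u) (m v) (g v) (A v u)

  form-linearʳ : ∀ x y f g h → ⟨ h , (λ v → x * f v + y * g v) ⟩ ≡ x * ⟨ h , f ⟩ + y * ⟨ h , g ⟩
  form-linearʳ x y f g h =
    trans (form-sym h _) (trans (form-linearˡ x y f g h) (cong₂ (λ a b → x * a + y * b) (form-sym f h) (form-sym g h)))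

  form-square : ∀ x y f g → let h = λ v → x * f v + y * g v in
    ⟨ h , h ⟩ ≡ x * x * ⟨ f , f ⟩ + (1ℚ + 1ℚ) * (x * y) * ⟨ f , g ⟩ + y * y * ⟨ g , g ⟩
  form-square x y f g = trans (form-linearˡ x y f g _)
    (trans (cong₂ (λ a b → x * a + y * b) (form-linearʳ x y f g f)
             (trans (form-linearʳ x y f g g) (cong (λ a → x * a + y * ⟨ g , g ⟩) (form-sym g f))))
      (form-square-ring x y ⟨ f , f ⟩ ⟨ f , g ⟩ ⟨ g , g ⟩))

  opaque
    unfolding ⟨_,_⟩

    form≤I*I : ∀ {f g} → (∀ v → 0ℚ ≤ f v) → (∀ v → 0ℚ ≤ g v) → ⟨ f , g ⟩ ≤ I f * I g
    form≤I*I {f} {g} p q = ≤-trans (I-mono (λ u → lin (p u ⊗ gap (deg≤I u q)) (form≤I*I-ring (f u) (deg g u) (I g))))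
      (≤-reflexive (trans (I-cong (λ u → *-comm (f u) (I g))) (trans (I-* (I g) f) (*-comm (I g) (I f)))))

  χ-nn : (X : Vset n) → ∀ v → 0ℚ ≤ χ (X v)
  χ-nn X v = χ-nonneg (X v)

  opaque

    μ : Vset n → ℚ
    μ X = I (λ v → χ (X v))

    E : Vset n → Vset n → ℚ
    E X Y = ⟨ (λ v → χ (X v)) , (λ v → χ (Y v)) ⟩

    dg : Vset n → Fin n → ℚ
    dg Y = deg (λ v → χ (Y v))

    μ-def : ∀ X → μ X ≡ I (λ v → χ (X v))
    μ-def X = refl

    E-def : ∀ X Y → E X Y ≡ ⟨ (λ v → χ (X v)) , (λ v → χ (Y v)) ⟩
    E-def X Y = refl

    μ-nonneg : ∀ X → 0ℚ ≤ μ X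
    μ-nonneg X = I-nonneg (χ-nn X)

    μ-mono : ∀ {X Y} → X ⊆ Y → μ X ≤ μ Y
    μ-mono p = I-mono (λ v → χ-mono (p v))

    E≤ : ∀ X Y → E X Y ≤ μ X * μ Y
    E≤ X Y = form≤I*I (χ-nn X) (χ-nn Y)

    E-sym : ∀ X Y → E X Y ≡ E Y X
    E-sym X Y = form-sym _ _

    E-monoˡ : ∀ {X X′} Y → X ⊆ X′ → E X Y ≤ E X′ Y
    E-monoˡ Y p = form-monoˡ (λ v → χ-mono (p v)) (χ-nn Y)

  opaque
    unfolding μ E dg ⟨_,_⟩

    E-deg-≥ : ∀ X Y θ → (∀ v → X v ≡ true → θ ≤ dg Y v) → θ * μ X ≤ E X Y
    E-deg-≥ X Y θ p = subst (_≤ E X Y) (I-* θ _) (I-mono (λ v → pointwise v (X v) refl))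
      where
      pointwise : ∀ v b → X v ≡ b → θ * χ b ≤ χ b * dg Y v
      pointwise v true  q = subst (_≤ 1ℚ * dg Y v) (sym (*-identityʳ θ)) (subst (θ ≤_) (sym (*-identityˡ _)) (p v q))
      pointwise v false q = ≤-reflexive (trans (*-zeroʳ θ) (sym (*-zeroˡ (dg Y v))))

    E-deg-≤ : ∀ X Y θ → (∀ v → X v ≡ true → dg Y v ≤ θ) → E X Y ≤ θ * μ X
    E-deg-≤ X Y θ p = subst (E X Y ≤_) (I-* θ _) (I-mono (λ v → pointwise v (X v) refl))
      where
      pointwise : ∀ v b → X v ≡ b → χ b * dg Y v ≤ θ * χ b
      pointwise v true  q = subst (1ℚ * dg Y v ≤_) (sym (*-identityʳ θ)) (subst (_≤ θ) (sym (*-identityˡ _)) (p v q))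
      pointwise v false q = ≤-reflexive (trans (*-zeroˡ (dg Y v)) (sym (*-zeroʳ θ)))

  opaque
    unfolding μ E ⟨_,_⟩

    μ-split : ∀ (X B : Vset n) → μ X ≡ μ (X ∩ B) + μ (X ∖ B)
    μ-split X B = trans (I-cong (λ v → χ-split (X v) (B v))) (I-+ _ _)

    E-splitˡ : ∀ (X B Y : Vset n) → E X Y ≡ E (X ∩ B) Y + E (X ∖ B) Y
    E-splitˡ X B Y = trans (I-cong (λ v → trans (cong (_* deg (λ w → χ (Y w)) v) (χ-split (X v) (B v)))
      (*-distribʳ-+ (deg (λ w → χ (Y w)) v) (χ (X v ∧ B v)) (χ (X v ∧ not (B v)))))) (I-+ _ _)

  E-splitʳ : ∀ (Y X B : Vset n) → E Y X ≡ E Y (X ∩ B) + E Y (X ∖ B)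
  E-splitʳ Y X B = trans (E-sym Y X) (trans (E-splitˡ X B Y) (cong₂ _+_ (E-sym (X ∩ B) Y) (E-sym (X ∖ B) Y)))

  opaque
    unfolding μ dg deg

    μ-nbhd : ∀ v Y → μ (nbhd G v Y) ≡ dg Y v
    μ-nbhd v Y = I-cong (λ w → trans (χ-∧ (adj G v w) (Y w)) (*-comm (χ (adj G v w)) (χ (Y w))))

    -- Rearranged: the part of Z outside X has measure at most that of the part of Y outside X.
    μ-meet : ∀ (X Y Z : Vset n) → Z ⊆ Y → μ (λ w → X w ∧ Y w) + μ Z ≤ μ (λ w → X w ∧ Z w) + μ Y
    μ-meet X Y Z Z⊆Y = subst₂ _≤_ (I-+ _ _) (I-+ _ _)
      (I-mono (λ w → pointwise (X w) (Z w) (Y w) (Z⊆Y w)))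
      where
      pointwise : ∀ a z y → (z ≡ true → y ≡ true) → χ (a ∧ y) + χ z ≤ χ (a ∧ z) + χ y
      pointwise true  true  y f rewrite f refl = ≤-refl
      pointwise true  false y f = ≤-reflexive (+-comm (χ y) 0ℚ)
      pointwise false true  y f rewrite f refl = ≤-refl
      pointwise false false y f = lin (χ-nonneg y) (pointwise-ring₃ (χ y))

  -- Union bound: a member of `vs` misses at most κ of Y, hence at most κ of the subset Z, and these
  -- losses add up.
  μ-nbhds : ∀ {Y Z κ} vs → Z ⊆ Y → All (λ v → μ Y - κ ≤ dg Y v) vs → μ Z - fromℕ (length vs) * κ ≤ μ (nbhds G vs Z)
  μ-nbhds {Y} {Z} {κ} [] Z⊆Y [] = ≤-reflexive (μ-nbhds-ring₁ (μ Z) κ)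
  μ-nbhds {Y} {Z} {κ} (v ∷ vs) Z⊆Y (p ∷ ps) =
    lin (gap p ⊕ gap (μ-nbhds vs Z⊆Y ps) ⊕ gap meet) (trans (cong (λ l → μ (nbhd G v Z′) - (μ Z - l * κ)) (fromℕ-suc (length vs)))
      (μ-nbhds-ring (μ Y) κ (fromℕ (length vs)) (dg Y v) (μ Z) (μ Z′) (μ (nbhd G v Z′))))
    where
    Z′ = nbhds G vs Z
    meet : dg Y v + μ Z′ ≤ μ (nbhd G v Z′) + μ Y
    meet = subst (λ d → d + μ Z′ ≤ μ (nbhd G v Z′) + μ Y) (μ-nbhd v Y)
      (μ-meet (adj G v) Y Z′ (λ w p → Z⊆Y w (nbhds⊆ G vs w p)))

-- Powers, sparse subsets and pruning

inverse : ∀ x → 0ℚ < x → Σ ℚ λ i → (x * i ≡ 1ℚ) × (0ℚ < i)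
inverse x p = (1/ x) {{pos⇒nonZero x {{positive p}}}} ,
  *-inverseʳ x {{pos⇒nonZero x {{positive p}}}} ,
  positive⁻¹ _ {{1/pos⇒pos x {{positive p}}}}

_^_ : ℚ → ℕ → ℚ
q ^ zero  = 1ℚ
q ^ suc k = q * q ^ k

^-pos : ∀ {q} → 0ℚ < q → ∀ k → 0ℚ < q ^ k
^-pos p zero    = positive! 1ℚ
^-pos p (suc k) = p ⊗⁺ ^-pos p k

^≤1-ring : ∀ q x → 1ℚ - q * x ≡ (1ℚ - q) + q * (1ℚ - x)
^≤1-ring = solve-∀ ℚ-ring

^≤1 : ∀ {q} → 0ℚ < q → q ≤ 1ℚ → ∀ k → q ^ k ≤ 1ℚ
^≤1 p r zero    = ≤-refl
^≤1 {q} p r (suc k) = lin (gap r ⊕ <⇒≤ p ⊗ gap (^≤1 p r k)) (^≤1-ring q (q ^ k))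

sparse-subset′-ring : ∀ c x y z d → c - x * y * z ≡ y * (d - x * z) + (c - y * d)
sparse-subset′-ring = solve-∀ ℚ-ring

sparse-subset′-ring₁ : ∀ x z → z - x * z ≡ (1ℚ - x) * z
sparse-subset′-ring₁ = solve-∀ ℚ-ring

prunes-ring : ∀ x y z l s → z + (1ℚ + l) * s - x ≡ (y + l * s - x) + (z + s - y)
prunes-ring = solve-∀ ℚ-ring

prunes-ring₁ : ∀ a s → a ≡ a + 0ℚ * s
prunes-ring₁ = solve-∀ ℚ-ring

module Sets {n : ℕ} (G : Graph n) (m : Fin n → ℚ) (m≥0 : ∀ v → 0ℚ ≤ m v) where
  open Measure G m m≥0

  -- Lower regularity only: building cliques asks for enough edges between large subsets, while
  -- upper bounds on densities come from exchanging sets. The inequality is strict so that it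
  -- directly refutes an upper bound on `E`.
  Regular : ℚ → ℚ → Vset n → Vset n → Set
  Regular λ′ p X Y = ∀ X′ Y′ → X′ ⊆ X → Y′ ⊆ Y → λ′ * μ X ≤ μ X′ → λ′ * μ Y ≤ μ Y′ → p * (μ X′ * μ Y′) < E X′ Y′

  Sparse : ℚ → Vset n → Set
  Sparse ν X = E X X ≤ ν * (μ X * μ X)

  high-degree : ∀ X Y θ → ¬ (E X Y ≤ θ * μ X) → Σ (Fin n) λ v → X v ≡ true × θ < dg Y v
  high-degree X Y θ ¬p with Fin.¬∀⟶∃¬ n (λ v → X v ≡ true → dg Y v ≤ θ)
      (λ v → (X v Bool.≟ true) →-dec (dg Y v ≤? θ)) (λ f → ¬p (E-deg-≤ X Y θ f))
  ... | v , q with X v in eq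
  ...   | true  = v , eq , ≰⇒> (λ r → q (λ _ → r))
  ...   | false = ⊥-elim (q λ ())

  module _ (noK8 : ¬ Clique G 8 full) (ν : ℚ) (0<ν : 0ℚ < ν) (ν≤1 : ν ≤ 1ℚ) where

    -- While Z is not sparse, some vertex of Z is joined to more than the proportion ν of Z. It
    -- joins the clique c, and Z shrinks to its neighbourhood at the cost of one factor ν. The
    -- invariant j + k = 8 bounds the number of rounds, since a clique with eight vertices is
    -- excluded.
    sparse-subset′ : ∀ j k → j ℕ.+ k ≡ 8 → (c : Clique G j full) (Z : Vset n) → Z ⊆ nbhds G (members c) full → 0ℚ < μ Z →
      Σ (Vset n) λ C → C ⊆ Z × (ν ^ k * μ Z ≤ μ C) × (E C C ≤ ν * (μ C * μ C))
    sparse-subset′ j zero eq c Z sub pos = ⊥-elim (noK8 (subst (λ k → Clique G k full) (trans (sym (ℕ.+-identityʳ j)) eq) c))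
    sparse-subset′ j (suc k) eq c Z sub pos = decide (E Z Z ≤? ν * (μ Z * μ Z))
      where
      Result : Set
      Result = Σ (Vset n) λ C → C ⊆ Z × (ν ^ suc k * μ Z ≤ μ C) × (E C C ≤ ν * (μ C * μ C))
      descend : (Σ (Fin n) λ v → Z v ≡ true × ν * μ Z < dg Z v) → Result
      descend (v , v∈Z , big) = proj₁ found , ⊆-trans (proj₁ (proj₂ found)) (nbhds⊆ G (v ∷ [])) ,
          lin (<⇒≤ (^-pos 0<ν k) ⊗ gap (<⇒≤ big) ⊕ gap (proj₁ (proj₂ (proj₂ found))))
            (trans (sparse-subset′-ring (μ (proj₁ found)) ν (ν ^ k) (μ Z) (dg Z v))
              (cong (λ d → ν ^ k * (dg Z v - ν * μ Z) + (μ (proj₁ found) - ν ^ k * d)) (sym (μ-nbhd v Z)))) ,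
          proj₂ (proj₂ (proj₂ found))
        where
        found = sparse-subset′ (j ℕ.+ 1) k (trans (ℕ.+-assoc j 1 k) eq) (append G c (singleton G v v∈Z) sub) (nbhd G v Z)
          (nbhds-++ G (members c) (v ∷ []) sub) (subst (0ℚ <_) (sym (μ-nbhd v Z)) (<-trans (0<ν ⊗⁺ pos) big))
      decide : Dec (E Z Z ≤ ν * (μ Z * μ Z)) → Result
      decide (yes p) = Z , (λ _ x → x) , lin (gap (^≤1 0<ν ν≤1 (suc k)) ⊗ <⇒≤ pos) (sparse-subset′-ring₁ (ν ^ suc k) (μ Z)) , p
      decide (no ¬p) = descend (high-degree Z Z (ν * μ Z) (λ q → ¬p (subst (E Z Z ≤_) (*-assoc ν (μ Z) (μ Z)) q)))

    sparse-subset : ∀ Z → 0ℚ < μ Z →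
      Σ (Vset n) λ C → C ⊆ Z × (ν ^ 8 * μ Z ≤ μ C) × (E C C ≤ ν * (μ C * μ C))
    sparse-subset Z = sparse-subset′ 0 8 refl (empty-clique G) Z (λ _ _ → refl)

  -- The vertices of degree at most θ have too few edges to Y; if their measure reached s, they
  -- would contradict the density assumed for all subsets of that size.
  prune : ∀ X Y θ s → (∀ X′ → X′ ⊆ X → s ≤ μ X′ → θ * μ X′ < E X′ Y) →
    Σ (Vset n) λ X₀ → X₀ ⊆ X × (μ X ≤ μ X₀ + s) × (∀ v → X₀ v ≡ true → θ ≤ dg Y v)
  prune X Y θ s dense = good , (λ v → ∧-fst) ,
    ≤-trans (≤-reflexive (trans (μ-split X B) (+-comm (μ bad) (μ good)))) (+-monoʳ-≤ (μ good) small) ,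
    λ v p → <⇒≤ (≰⇒> (does-false (dg Y v ≤? θ) (not-true (∧-snd {X v} p))))
    where
    B : Vset n
    B v = does (dg Y v ≤? θ)
    bad : Vset n
    bad v = X v ∧ B v
    good : Vset n
    good v = X v ∧ not (B v)
    small : μ bad ≤ s
    small = decide (s ≤? μ bad)
      where
      decide : Dec (s ≤ μ bad) → μ bad ≤ s
      decide (no ¬p) = <⇒≤ (≰⇒> ¬p)
      decide (yes p) = ⊥-elim (absurd (E-deg-≤ bad Y θ (λ v q → does-true (dg Y v ≤? θ) (∧-snd {X v} q)))
        (dense bad (λ v → ∧-fst) p))

  prunes : ∀ l X (Y : Fin l → Vset n) (θ : Fin l → ℚ) s →
    (∀ j X′ → X′ ⊆ X → s ≤ μ X′ → θ j * μ X′ < E X′ (Y j)) →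
    Σ (Vset n) λ X₀ → X₀ ⊆ X × (μ X ≤ μ X₀ + fromℕ l * s) × (∀ j v → X₀ v ≡ true → θ j ≤ dg (Y j) v)
  prunes zero X Y θ s dense = X , (λ _ p → p) , ≤-reflexive (prunes-ring₁ (μ X) s) , λ ()
  prunes (suc l) X Y θ s dense
    with prunes l X (λ j → Y (suc j)) (λ j → θ (suc j)) s (λ j → dense (suc j))
  ... | X₁ , X₁⊆ , large₁ , deg₁
    with prune X₁ (Y zero) (θ zero) s (λ X′ p → dense zero X′ (⊆-trans p X₁⊆))
  ...   | X₀ , X₀⊆ , large₀ , deg₀ = X₀ , ⊆-trans X₀⊆ X₁⊆ ,
    lin (gap large₁ ⊕ gap large₀) (trans (cong (λ a → μ X₀ + a * s - μ X) (fromℕ-suc l)) (prunes-ring (μ X) (μ X₁) (μ X₀) (fromℕ l) s)) ,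
    λ { zero → deg₀ ; (suc j) v p → deg₁ j v (X₀⊆ v p) }

-- Stability of optimal weights, and the regularity of sparse sets

Stable : ∀ {n} (G : Graph n) (m : Fin n → ℚ) → (∀ v → 0ℚ ≤ m v) → ℚ → Set
Stable G m m≥0 τ = ∀ g → (∀ v → - 1ℚ ≤ g v) → (∀ v → g v ≤ 1ℚ) → ⟨ g , g ⟩ ≤ I g * I g + τ
  where open Measure G m m≥0

near-ring : ∀ x y e ν l a b → e * e * (a * b) - 4ℚ * x ≡
  4ℚ * (y - x) + 4ℚ * (ν * (a * a) - y) + (e * e * l - 4ℚ * ν) * (a * a) + e * e * a * (b - l * a)
near-ring = solve-∀ ℚ-ring

whole-ring : ∀ l a → a - l * a ≡ (1ℚ - l) * a
whole-ring = solve-∀ ℚ-ring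

value-ring : ∀ u l k z y → l * k * (u * (z * y)) ≡ u * (z * l * (y * k))
value-ring = solve-∀ ℚ-ring

normalised-density-ring : ∀ x κ i c → x * i - κ * (i * c) ≡ i * (x - κ) + κ * i * (1ℚ - c)
normalised-density-ring = solve-∀ ℚ-ring

mass-g-ring : ∀ x y → x * (1ℚ * 1ℚ + (- 1ℚ) * 1ℚ) + y * 1ℚ ≡ y
mass-g-ring = solve-∀ ℚ-ring

upper-ring₁ : ∀ ε κ a b c → 1ℚ - (½ * κ * (1ℚ * a + (- 1ℚ) * b) + ε * (½ * κ) * c)
  ≡ ½ * (1ℚ - κ * a) + ½ * κ * b + ε * ½ * (1ℚ - κ * c) + ½ * (1ℚ - ε)
upper-ring₁ = solve-∀ ℚ-ring

lower-ring : ∀ ε κ a b c → ½ * κ * (1ℚ * a + (- 1ℚ) * b) + ε * (½ * κ) * c - (- 1ℚ)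
  ≡ ½ * κ * a + ½ * (1ℚ - κ * b) + ½ + ε * (½ * κ) * c
lower-ring = solve-∀ ℚ-ring

sparse-regular-ring : ∀ p e a → (p - e - e) * a - (p - 3ℚ * e) * a ≡ e * a
sparse-regular-ring = solve-∀ ℚ-ring

exchange-≤-ring : ∀ q ε s a → (q + ε) * a - s * a ≡ (q + ε - s) * a
exchange-≤-ring = solve-∀ ℚ-ring

exchange-≥-ring : ∀ q ε t a → t * a - (q - ε) * a ≡ (t + ε - q) * a
exchange-≥-ring = solve-∀ ℚ-ring

ratio-ring : ∀ e i a → e * i * a ≡ e * (a * i)
ratio-ring = solve-∀ ℚ-ring

exchange-ring₄ : ∀ e → e * (1ℚ * 1ℚ) ≡ e
exchange-ring₄ = solve-∀ ℚ-ring

exchange-ring₅ : ∀ e i j x y → i * j * (e * (x * y)) ≡ e * (x * i * (y * j))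
exchange-ring₅ = solve-∀ ℚ-ring

exchange-ring₆ : ∀ i j e → i * j * (4ℚ * e) ≡ 4ℚ * (i * j * e)
exchange-ring₆ = solve-∀ ℚ-ring

exchange-densities-ring : ∀ ε κ τ aa ab bb ac bc cc →
  ε * ½ * (κ * κ) * (bc + ε) - ε * ½ * (κ * κ) * ac ≡
  (ε * (½ * κ) * (ε * (½ * κ)) + τ
  - (½ * κ * (½ * κ) * (1ℚ * 1ℚ * aa + (1ℚ + 1ℚ) * (1ℚ * (- 1ℚ)) * ab + (- 1ℚ) * (- 1ℚ) * bb)
  + (1ℚ + 1ℚ) * (½ * κ * (ε * (½ * κ))) * (1ℚ * ac + (- 1ℚ) * bc) + ε * (½ * κ) * (ε * (½ * κ)) * cc))
  + ½ * κ * (½ * κ) * aa + ½ * κ * (½ * κ) * bb + ε * (½ * κ) * (ε * (½ * κ)) * cc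
  + (+ 1 / 8) * (κ * κ) * (ε * ε - 4ℚ * ab) + (+ 1 / 8) * (ε * ε * (κ * κ) - 8ℚ * τ)
exchange-densities-ring = solve-∀ ℚ-ring

module Exchange {n : ℕ} (G : Graph n) (m : Fin n → ℚ) (m≥0 : ∀ v → 0ℚ ≤ m v) (κ τ : ℚ) (0<κ : 0ℚ < κ)
  (stable : Stable G m m≥0 τ)
  where
  open Measure G m m≥0
  open Sets G m m≥0

  -- A probability density with respect to m that is bounded by 1/κ; the cap keeps the perturbation
  -- below between -1 and 1.
  record Density (a : Fin n → ℚ) : Set where
    constructor is-density
    field
      nonneg : ∀ v → 0ℚ ≤ a v
      cap    : ∀ v → κ * a v ≤ 1ℚ
      mass   : I a ≡ 1ℚ

  -- Stability is applied to the perturbation x (a - b) + y c with x = κ/2 and y = ε κ/2.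
  exchange-densities : ∀ {a b c} ε → 0ℚ < ε → ε ≤ 1ℚ → 8ℚ * τ ≤ ε * ε * (κ * κ) →
    Density a → Density b → Density c → 4ℚ * ⟨ a , b ⟩ ≤ ε * ε → ⟨ a , c ⟩ ≤ ⟨ b , c ⟩ + ε
  exchange-densities {a} {b} {c} ε 0<ε ε≤1 small da db dc near =
    -- The cancelled factor is 2xy. The square of a - b contributes at least -2⟨a,b⟩, so the errors
    -- are y² = ε²κ²/4, τ ≤ ε²κ²/8 and 2x²⟨a,b⟩ ≤ ε²κ²/8; their sum is ε times 2xy.
    cancel-≤ {ε * ½ * (κ * κ)} ((0<ε ⊗⁺ positive! ½) ⊗⁺ (0<κ ⊗⁺ 0<κ))
      (lin (gap bound
            ⊕ (nonneg! ½ ⊗ <⇒≤ 0<κ) ⊗ (nonneg! ½ ⊗ <⇒≤ 0<κ) ⊗ form-nonneg (nonneg da) (nonneg da)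
            ⊕ (nonneg! ½ ⊗ <⇒≤ 0<κ) ⊗ (nonneg! ½ ⊗ <⇒≤ 0<κ) ⊗ form-nonneg (nonneg db) (nonneg db)
            ⊕ y≥0 ⊗ y≥0 ⊗ form-nonneg (nonneg dc) (nonneg dc)
            ⊕ nonneg! (+ 1 / 8) ⊗ (<⇒≤ 0<κ ⊗ <⇒≤ 0<κ) ⊗ gap near
            ⊕ nonneg! (+ 1 / 8) ⊗ gap small)
        (exchange-densities-ring ε κ τ ⟨ a , a ⟩ ⟨ a , b ⟩ ⟨ b , b ⟩ ⟨ a , c ⟩ ⟨ b , c ⟩ ⟨ c , c ⟩))
    where
    open Density
    x y : ℚ
    x = ½ * κ
    y = ε * (½ * κ)
    y≥0 : 0ℚ ≤ y
    y≥0 = <⇒≤ 0<ε ⊗ (nonneg! ½ ⊗ <⇒≤ 0<κ)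
    h g : Fin n → ℚ
    h v = 1ℚ * a v + (- 1ℚ) * b v
    g v = x * h v + y * c v
    lower : ∀ v → - 1ℚ ≤ g v
    lower v = lin (nonneg! ½ ⊗ <⇒≤ 0<κ ⊗ nonneg da v ⊕ nonneg! ½ ⊗ gap (cap db v) ⊕ nonneg! ½ ⊕ y≥0 ⊗ nonneg dc v)
      (lower-ring ε κ (a v) (b v) (c v))
    upper : ∀ v → g v ≤ 1ℚ
    upper v = lin (nonneg! ½ ⊗ gap (cap da v) ⊕ nonneg! ½ ⊗ <⇒≤ 0<κ ⊗ nonneg db v ⊕ <⇒≤ 0<ε ⊗ nonneg! ½ ⊗ gap (cap dc v) ⊕ nonneg! ½ ⊗ gap ε≤1)
      (upper-ring₁ ε κ (a v) (b v) (c v))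
    mass-g : I g ≡ y
    mass-g = trans (I-linear x y h c) (trans (cong₂ (λ p q → x * p + y * q)
      (trans (I-linear 1ℚ (- 1ℚ) a b) (cong₂ (λ p q → 1ℚ * p + (- 1ℚ) * q) (mass da) (mass db))) (mass dc)) (mass-g-ring x y))
    square-g : ⟨ g , g ⟩ ≡ x * x * (1ℚ * 1ℚ * ⟨ a , a ⟩ + (1ℚ + 1ℚ) * (1ℚ * (- 1ℚ)) * ⟨ a , b ⟩ + (- 1ℚ) * (- 1ℚ) * ⟨ b , b ⟩)
      + (1ℚ + 1ℚ) * (x * y) * (1ℚ * ⟨ a , c ⟩ + (- 1ℚ) * ⟨ b , c ⟩) + y * y * ⟨ c , c ⟩
    square-g = trans (form-square x y h c)
      (cong₂ (λ p q → x * x * p + (1ℚ + 1ℚ) * (x * y) * q + y * y * ⟨ c , c ⟩)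
        (form-square 1ℚ (- 1ℚ) a b) (form-linearˡ 1ℚ (- 1ℚ) a b c))
    bound : x * x * (1ℚ * 1ℚ * ⟨ a , a ⟩ + (1ℚ + 1ℚ) * (1ℚ * (- 1ℚ)) * ⟨ a , b ⟩ + (- 1ℚ) * (- 1ℚ) * ⟨ b , b ⟩)
      + (1ℚ + 1ℚ) * (x * y) * (1ℚ * ⟨ a , c ⟩ + (- 1ℚ) * ⟨ b , c ⟩) + y * y * ⟨ c , c ⟩ ≤ y * y + τ
    bound = subst₂ _≤_ square-g (cong (λ i → i * i + τ) mass-g) (stable g lower upper)

  normalised : Vset n → ℚ → Fin n → ℚ
  normalised X i v = i * χ (X v)

  opaque
    unfolding μ E

    normalised-density : ∀ {X i} → κ ≤ μ X → μ X * i ≡ 1ℚ → 0ℚ < i → Density (normalised X i)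
    normalised-density {X} {i} large inv pos = is-density (λ v → <⇒≤ pos ⊗ χ-nonneg (X v))
      (λ v → lin (<⇒≤ pos ⊗ gap large ⊕ <⇒≤ 0<κ ⊗ <⇒≤ pos ⊗ gap (χ≤1 (X v)))
        (trans (cong (λ o → o - κ * (i * χ (X v))) (sym inv)) (normalised-density-ring (μ X) κ i (χ (X v)))))
      (trans (I-* i _) (trans (*-comm i (μ X)) inv))

    normalised-form : ∀ X Y i j → ⟨ normalised X i , normalised Y j ⟩ ≡ i * j * E X Y
    normalised-form X Y i j = form-scale i j _ _

  large-pos : ∀ {X} → κ ≤ μ X → 0ℚ < μ X
  large-pos p = <-≤-trans 0<κ p

  -- `exchange-densities` for indicator functions divided by measures, whose pairings are edge
  -- densities. Few edges between X and X̃, not disjointness, is what the hypothesis demands, so a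
  -- sparse set can be exchanged for its own subset.
  exchange : ∀ {X X̃ Y} ε s t → 0ℚ < ε → ε ≤ 1ℚ → 8ℚ * τ ≤ ε * ε * (κ * κ) →
    κ ≤ μ X → κ ≤ μ X̃ → κ ≤ μ Y → 4ℚ * E X X̃ ≤ ε * ε * (μ X * μ X̃) →
    E X Y ≡ s * (μ X * μ Y) → E X̃ Y ≡ t * (μ X̃ * μ Y) → s ≤ t + ε
  exchange {X} {X̃} {Y} ε s t 0<ε ε≤1 small lX lX̃ lY near es et =
    subst₂ (λ a b → a ≤ b + ε) (trans (normalised-form X Y i k) (value X s i p es)) (trans (normalised-form X̃ Y j k) (value X̃ t j q et))
      (exchange-densities ε 0<ε ε≤1 small (normalised-density lX p i>0) (normalised-density lX̃ q j>0)
        (normalised-density lY r k>0)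
        (subst₂ _≤_ (trans (exchange-ring₆ i j (E X X̃)) (cong (4ℚ *_) (sym (normalised-form X X̃ i j))))
          (trans (exchange-ring₅ (ε * ε) i j (μ X) (μ X̃)) (trans (cong₂ (λ a b → ε * ε * (a * b)) p q) (exchange-ring₄ (ε * ε))))
          (*-monoˡ-≤-nonNeg (i * j) {{nonNegative (<⇒≤ (i>0 ⊗⁺ j>0))}} near)))
    where
    ix = inverse (μ X) (large-pos lX)
    ix̃ = inverse (μ X̃) (large-pos lX̃)
    iy = inverse (μ Y) (large-pos lY)
    i j k : ℚ
    i = proj₁ ix
    j = proj₁ ix̃
    k = proj₁ iy
    p = proj₁ (proj₂ ix)
    q = proj₁ (proj₂ ix̃)
    r = proj₁ (proj₂ iy)
    i>0 = proj₂ (proj₂ ix)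
    j>0 = proj₂ (proj₂ ix̃)
    k>0 = proj₂ (proj₂ iy)
    value : ∀ Z u l → μ Z * l ≡ 1ℚ → E Z Y ≡ u * (μ Z * μ Y) → l * k * E Z Y ≡ u
    value Z u l inv eq = trans (cong (l * k *_) eq) (trans (value-ring u l k (μ Z) (μ Y))
      (trans (cong₂ (λ a b → u * (a * b)) inv r) (exchange-ring₄ u)))

  ratio : ∀ X Y → 0ℚ < μ X → 0ℚ < μ Y → Σ ℚ λ t → (E X Y ≡ t * (μ X * μ Y)) × (t ≤ 1ℚ)
  ratio X Y p q = E X Y * i ,
    sym (trans (ratio-ring (E X Y) i (μ X * μ Y)) (trans (cong (E X Y *_) inv) (*-identityʳ (E X Y)))) ,
    subst (E X Y * i ≤_) inv (*-monoʳ-≤-nonNeg i {{nonNegative (<⇒≤ i>0)}} (E≤ X Y))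
    where
    inverted = inverse (μ X * μ Y) (p ⊗⁺ q)
    i = proj₁ inverted
    inv = proj₁ (proj₂ inverted)
    i>0 = proj₂ (proj₂ inverted)

  exchange-≥ : ∀ {X X̃ Y} ε q → 0ℚ < ε → ε ≤ 1ℚ → 8ℚ * τ ≤ ε * ε * (κ * κ) →
    κ ≤ μ X → κ ≤ μ X̃ → κ ≤ μ Y → 4ℚ * E X X̃ ≤ ε * ε * (μ X * μ X̃) →
    q * (μ X * μ Y) ≤ E X Y → (q - ε) * (μ X̃ * μ Y) ≤ E X̃ Y
  exchange-≥ {X} {X̃} {Y} ε q 0<ε ε≤1 small lX lX̃ lY near dense
    = subst ((q - ε) * (μ X̃ * μ Y) ≤_) (sym et)
    (lin (gap (≤-trans q≤s s≤t+ε) ⊗ (μ-nonneg X̃ ⊗ μ-nonneg Y)) (exchange-≥-ring q ε t (μ X̃ * μ Y)))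
    where
    s t : ℚ
    s = proj₁ (ratio X Y (large-pos lX) (large-pos lY))
    t = proj₁ (ratio X̃ Y (large-pos lX̃) (large-pos lY))
    es : E X Y ≡ s * (μ X * μ Y)
    es = proj₁ (proj₂ (ratio X Y (large-pos lX) (large-pos lY)))
    et : E X̃ Y ≡ t * (μ X̃ * μ Y)
    et = proj₁ (proj₂ (ratio X̃ Y (large-pos lX̃) (large-pos lY)))
    s≤t+ε : s ≤ t + ε
    s≤t+ε = exchange ε s t 0<ε ε≤1 small lX lX̃ lY near es et
    q≤s : q ≤ s
    q≤s = cancel-≤ {μ X * μ Y} (large-pos lX ⊗⁺ large-pos lY)
      (subst₂ _≤_ (*-comm q (μ X * μ Y)) (trans es (*-comm s (μ X * μ Y))) dense)

  exchange-≤ : ∀ {X X̃ Y} ε q → 0ℚ < ε → ε ≤ 1ℚ → 8ℚ * τ ≤ ε * ε * (κ * κ) →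
    κ ≤ μ X → κ ≤ μ X̃ → κ ≤ μ Y → 4ℚ * E X X̃ ≤ ε * ε * (μ X * μ X̃) →
    E X̃ Y ≤ q * (μ X̃ * μ Y) → E X Y ≤ (q + ε) * (μ X * μ Y)
  exchange-≤ {X} {X̃} {Y} ε q 0<ε ε≤1 small lX lX̃ lY near sparse
    = subst (_≤ (q + ε) * (μ X * μ Y)) (sym es)
    (lin (gap (≤-trans s≤t+ε (+-monoˡ-≤ ε t≤q)) ⊗ (μ-nonneg X ⊗ μ-nonneg Y)) (exchange-≤-ring q ε s (μ X * μ Y)))
    where
    s t : ℚ
    s = proj₁ (ratio X Y (large-pos lX) (large-pos lY))
    t = proj₁ (ratio X̃ Y (large-pos lX̃) (large-pos lY))
    es : E X Y ≡ s * (μ X * μ Y)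
    es = proj₁ (proj₂ (ratio X Y (large-pos lX) (large-pos lY)))
    et : E X̃ Y ≡ t * (μ X̃ * μ Y)
    et = proj₁ (proj₂ (ratio X̃ Y (large-pos lX̃) (large-pos lY)))
    s≤t+ε : s ≤ t + ε
    s≤t+ε = exchange ε s t 0<ε ε≤1 small lX lX̃ lY near es et
    t≤q : t ≤ q
    t≤q = cancel-≤ {μ X̃ * μ Y} (large-pos lX̃ ⊗⁺ large-pos lY)
      (subst₂ _≤_ (trans et (*-comm t (μ X̃ * μ Y))) (*-comm q (μ X̃ * μ Y)) sparse)

  -- A large subset X of the sparse set C has few edges to C: E X C ≤ E C C ≤ ν μ(C)², and μ(X) ≥ λ′
  -- μ(C) turns this into the hypothesis of the exchange. Replacing C by X and then D by Y costs e
  -- each; the third e makes the inequality strict.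
  sparse-regular : ∀ {C D ν λ′} e p → 0ℚ < e → e ≤ 1ℚ → 8ℚ * τ ≤ e * e * (κ * κ) →
    0ℚ < λ′ → λ′ ≤ 1ℚ → 4ℚ * ν ≤ e * e * λ′ → κ ≤ λ′ * μ C → κ ≤ λ′ * μ D →
    Sparse ν C → Sparse ν D → p * (μ C * μ D) ≤ E C D → Regular λ′ (p - 3ℚ * e) C D
  sparse-regular {C} {D} {ν} {λ′} e p 0<e e≤1 small 0<λ λ≤1 tiny lC lD spC spD dense X Y X⊆C Y⊆D lX lY =
    <-≤-trans
      (lin< (0<e ⊗⁺ (large-pos κ≤X ⊗⁺ large-pos κ≤Y)) (sparse-regular-ring p e (μ X * μ Y)))
      (subst₂ _≤_ (cong ((p - e - e) *_) (*-comm (μ Y) (μ X))) (E-sym Y X) step₂)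
    where
    shrink : ∀ {A B} → κ ≤ λ′ * μ A → λ′ * μ A ≤ μ B → κ ≤ μ B
    shrink = ≤-trans
    whole : ∀ {A} → κ ≤ λ′ * μ A → κ ≤ μ A
    whole {A} l = ≤-trans l (lin (gap λ≤1 ⊗ μ-nonneg A) (whole-ring λ′ (μ A)))
    κ≤X = ≤-trans lC lX
    κ≤Y = ≤-trans lD lY
    near : ∀ {A B} → B ⊆ A → λ′ * μ A ≤ μ B → Sparse ν A → 4ℚ * E A B ≤ e * e * (μ A * μ B)
    near {A} {B} sub l sp = lin (nonneg! 4ℚ ⊗ gap (E-monoˡ A sub) ⊕ nonneg! 4ℚ ⊗ gap sp ⊕ gap tiny ⊗ (μ-nonneg A ⊗ μ-nonneg A)
        ⊕ square-nonneg e ⊗ μ-nonneg A ⊗ gap l)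
      (trans (cong (λ x → e * e * (μ A * μ B) - 4ℚ * x) (E-sym A B)) (near-ring (E B A) (E A A) e ν λ′ (μ A) (μ B)))
    step₁ : (p - e) * (μ X * μ D) ≤ E X D
    step₁ = exchange-≥ e p 0<e e≤1 small (whole lC) κ≤X (whole lD) (near X⊆C lX spC) dense
    step₂ : (p - e - e) * (μ Y * μ X) ≤ E Y X
    step₂ = exchange-≥ e (p - e) 0<e e≤1 small (whole lD) κ≤Y κ≤X (near Y⊆D lY spD)
      (subst₂ _≤_ (cong ((p - e) *_) (*-comm (μ X) (μ D))) (E-sym X D) step₁)

-- Complete graphs on eight vertices inside regular tuples of sparse sets

rearrange-ring : ∀ y p → p * y ≡ y - (1ℚ - p) * y
rearrange-ring = solve-∀ ℚ-ring

halve-ring : ∀ β s → 1ℚ - 2ℚ * (1ℚ - s) - β ≡ 2ℚ * s - (1ℚ + β)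
halve-ring = solve-∀ ℚ-ring

deep-ring : ∀ β r x y → (1ℚ - 2ℚ * (1ℚ - r)) * y - β * β * x ≡ β * (y - β * x) + (2ℚ * r - (1ℚ + β)) * y
deep-ring = solve-∀ ℚ-ring

deg₁-ring : ∀ β → 1ℚ - 1ℚ * (1ℚ - β) ≡ β
deg₁-ring = solve-∀ ℚ-ring

degrees-ring : ∀ β b d y → (1ℚ - 1ℚ * (1ℚ - β)) * y - β * b * d ≡ β * (y - b * d)
degrees-ring = solve-∀ ℚ-ring

roomy-ring : ∀ x b → b - x * b ≡ (1ℚ - x) * b
roomy-ring = solve-∀ ℚ-ring

l≤3′-ring : ∀ x → 1ℚ + x - x ≡ 1ℚ
l≤3′-ring = solve-∀ ℚ-ring

degrees-ring₁ : ∀ y k p → y - k * ((1ℚ - p) * y) ≡ (1ℚ - k * (1ℚ - p)) * y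
degrees-ring₁ = solve-∀ ℚ-ring

X₀-large-ring : ∀ l c z x f b → z - l * c ≡ (z + f * (l * c) - x) + (x - b * c) + (b - (f + 1ℚ) * l) * c
X₀-large-ring = solve-∀ ℚ-ring

pruned-ring : ∀ p x y → p * (x * y) ≡ p * y * x
pruned-ring = solve-∀ ℚ-ring

no-cherry-ring : ∀ β p r b x y → y - β * b ≡ (x - (b - 2ℚ * ((1ℚ - p) * b))) + (y - (x - 3ℚ * ((1ℚ - r) * b)))
  + (2ℚ * p + 3ℚ * r - (4ℚ + β)) * b
no-cherry-ring = solve-∀ ℚ-ring

good-part-ring : ∀ l a x → x - l * a ≡ (x + l * a - a) + ((1ℚ - + 5 / 1 * l) + 3ℚ * l) * a
good-part-ring = solve-∀ ℚ-ring

good-part-ring₁ : ∀ p x y → p * (x * y) ≡ p * y * x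
good-part-ring₁ = solve-∀ ℚ-ring

no-three-parts-ring : ∀ β r x y → (1ℚ - 3ℚ * (1ℚ - r)) * y - β * β * x ≡ β * (y - β * x) + (3ℚ * r - (2ℚ + β)) * y
no-three-parts-ring = solve-∀ ℚ-ring

5λ≤ββ-ring : ∀ β → β * (β * 1ℚ) ≡ β * β
5λ≤ββ-ring = solve-∀ ℚ-ring

dense-family-ring : ∀ β x b → β * x * b ≡ x * (β * b)
dense-family-ring = solve-∀ ℚ-ring

room-for-ring : ∀ f b l → b - (f + 1ℚ) * l ≡ (4ℚ - f) * l + (b - + 5 / 1 * l)
room-for-ring = solve-∀ ℚ-ring

λ≤5λ-ring : ∀ l → + 5 / 1 * l - l ≡ 4ℚ * l
λ≤5λ-ring = solve-∀ ℚ-ring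

shrink-ring : ∀ b d x y → x - b * y ≡ (x - d * y) + (d - b) * y
shrink-ring = solve-∀ ℚ-ring

dense-five-ring : ∀ b k x y → b * (x * y) - b * (k * k) ≡ b * ((x - k) * y) + b * (k * (y - k))
dense-five-ring = solve-∀ ℚ-ring

module Finders {n : ℕ} (G : Graph n) (m : Fin n → ℚ) (m≥0 : ∀ v → 0ℚ ≤ m v) (λ′ β κ κ₀ : ℚ)
  (0<λ : 0ℚ < λ′) (0<β : 0ℚ < β) (β≤1 : β ≤ 1ℚ) (λ-small : + 5 / 1 * λ′ ≤ β ^ 3)
  (0<κ : 0ℚ < κ) (κ₀≤κ : κ₀ ≤ κ) (κ₀≤βκκ : κ₀ ≤ β * (κ * κ))
  (triangle : ∀ X → κ₀ ≤ Measure.μ G m m≥0 X → Clique G 3 X)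
  (five : ∀ X Y → κ₀ ≤ Measure.E G m m≥0 X Y → Σ (Clique G 2 X) λ c → Clique G 3 (nbhds G (members c) Y))
  (noK8 : ¬ Clique G 8 full)
  where
  open Measure G m m≥0
  open Sets G m m≥0

  -- For each of the l targets, pruning removes measure at most λ′ μ(C), and (l + 1) λ′ ≤ b leaves
  -- λ′ μ(C), enough for a triangle. The k vertices taken from it each miss at most the proportion 1
  -- - p j of Y j.
  step : ∀ l {C X : Vset n} (D Y : Fin l → Vset n) (p : Fin l → ℚ) k → (∀ {Z} → Clique G 3 Z → Clique G k Z) → ∀ b →
    κ ≤ λ′ * μ C → X ⊆ C → b * μ C ≤ μ X → (fromℕ l + 1ℚ) * λ′ ≤ b →
    (∀ j → Regular λ′ (p j) C (D j)) → (∀ j → Y j ⊆ D j) → (∀ j → λ′ * μ (D j) ≤ μ (Y j)) →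
    Σ (Clique G k X) λ c → ∀ j → (1ℚ - fromℕ k * (1ℚ - p j)) * μ (Y j) ≤ μ (nbhds G (members c) (Y j))
  step l {C} {X} D Y p k sub b big X⊆C large room reg Y⊆D Y-large = widen G X₀⊆X c , degrees
    where
    pruned = prunes l X Y (λ j → p j * μ (Y j)) (λ′ * μ C) λ j X′ X′⊆X s≤ →
      subst (_< E X′ (Y j)) (pruned-ring (p j) (μ X′) (μ (Y j)))
        (reg j X′ (Y j) (⊆-trans X′⊆X X⊆C) (Y⊆D j) s≤ (Y-large j))
    X₀ : Vset n
    X₀ = proj₁ pruned
    X₀⊆X : X₀ ⊆ X
    X₀⊆X = proj₁ (proj₂ pruned)
    X₀-large : λ′ * μ C ≤ μ X₀
    X₀-large = lin (gap (proj₁ (proj₂ (proj₂ pruned))) ⊕ gap large ⊕ gap room ⊗ μ-nonneg C)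
      (X₀-large-ring λ′ (μ C) (μ X₀) (μ X) (fromℕ l) b)
    c : Clique G k X₀
    c = sub (triangle X₀ (≤-trans κ₀≤κ (≤-trans big X₀-large)))
    degrees : ∀ j → (1ℚ - fromℕ k * (1ℚ - p j)) * μ (Y j) ≤ μ (nbhds G (members c) (Y j))
    degrees j = subst (_≤ μ (nbhds G (members c) (Y j)))
      (trans (cong (λ s → μ (Y j) - fromℕ s * ((1ℚ - p j) * μ (Y j))) (size c)) (degrees-ring₁ (μ (Y j)) (fromℕ k) (p j)))
      (μ-nbhds {Y j} (members c) (λ _ q → q) (All.map (λ {v} q → subst (_≤ dg (Y j) v) (rearrange-ring (μ (Y j)) (p j))
        (proj₂ (proj₂ (proj₂ pruned)) j v q)) (inside c)))

  vertex : ∀ {Z} → Clique G 3 Z → Clique G 1 Z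
  vertex (clique (u ∷ v ∷ w ∷ []) refl _ (a ∷ _)) = singleton G u a

  -- Both subsets have measure at least κ, so their edge weight exceeds β κ² ≥ κ₀.
  dense-five : ∀ {C D X Y} → κ ≤ λ′ * μ C → κ ≤ λ′ * μ D → Regular λ′ β C D → X ⊆ C → Y ⊆ D →
    λ′ * μ C ≤ μ X → λ′ * μ D ≤ μ Y → κ₀ ≤ E X Y
  dense-five {C} {D} {X} {Y} bC bD reg X⊆C Y⊆D lX lY = ≤-trans κ₀≤βκκ
    (≤-trans (lin (<⇒≤ 0<β ⊗ (gap κ≤X ⊗ μ-nonneg Y) ⊕ <⇒≤ 0<β ⊗ (<⇒≤ 0<κ ⊗ gap κ≤Y)) (dense-five-ring β κ (μ X) (μ Y)))
      (<⇒≤ (reg X Y X⊆C Y⊆D lX lY)))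
    where
    κ≤X = ≤-trans bC lX
    κ≤Y = ≤-trans bD lY

  finish : ∀ {j X Y} → j ℕ.+ 5 ≡ 8 → (c : Clique G j full) →
    X ⊆ nbhds G (members c) full → Y ⊆ nbhds G (members c) full → κ₀ ≤ E X Y → ⊥
  finish {j} {X} {Y} eq c X⊆ Y⊆ dense = noK8 (subst (λ k → Clique G k full) (trans (ℕ.+-assoc j 2 3) eq)
    (append G (append G c two X⊆) three (nbhds-++ G (members c) (members two) Y⊆)))
    where
    two = proj₁ (five X Y dense)
    three = proj₂ (five X Y dense)

  shrink : ∀ {b d x y} → b ≤ d → 0ℚ ≤ y → d * y ≤ x → b * y ≤ x
  shrink {b} {d} {x} {y} b≤d 0≤y p = lin (gap p ⊕ gap b≤d ⊗ 0≤y) (shrink-ring b d x y)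

  λ≤5λ : λ′ ≤ + 5 / 1 * λ′
  λ≤5λ = lin (nonneg! 4ℚ ⊗ <⇒≤ 0<λ) (λ≤5λ-ring λ′)

  room-for : ∀ {f b} → f ≤ 4ℚ → + 5 / 1 * λ′ ≤ b → (f + 1ℚ) * λ′ ≤ b
  room-for {f} {b} p q = lin (gap p ⊗ <⇒≤ 0<λ ⊕ gap q) (room-for-ring f b λ′)

  -- One vertex is taken from each part in turn until two parts are left, where a K₅ completes the
  -- clique. At each stage j vertices are chosen, l are still to come, and Y i, of proportion at
  -- least b in D i, consists of common neighbours of the chosen ones. A choice multiplies b by β,
  -- so the condition on β ^ l * b guarantees that enough survives to the end.
  dense-family : ∀ l j → fromℕ l ≤ 3ℚ → j ℕ.+ l ≡ 3 → (c : Clique G j full) (D Y : Fin (2 ℕ.+ l) → Vset n) → ∀ b → 0ℚ ≤ b →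
    + 5 / 1 * λ′ ≤ β ^ l * b →
    (∀ i → κ ≤ λ′ * μ (D i)) → (∀ i k → i ≢ k → Regular λ′ β (D i) (D k)) →
    (∀ i → Y i ⊆ D i) → (∀ i → b * μ (D i) ≤ μ (Y i)) → (∀ i → Y i ⊆ nbhds G (members c) full) → ⊥
  dense-family zero j _ eq c D Y b 0≤b room big reg Y⊆D large sub =
    finish eq′ c (sub zero) (sub (suc zero))
      (dense-five (big zero) (big (suc zero)) (reg zero (suc zero) λ ()) (Y⊆D zero) (Y⊆D (suc zero)) (enough zero) (enough (suc zero)))
    where
    eq′ : j ℕ.+ 5 ≡ 8
    eq′ = trans (cong (ℕ._+ 5) (sym (ℕ.+-identityʳ j))) (cong (ℕ._+ 5) eq)
    enough : ∀ i → λ′ * μ (D i) ≤ μ (Y i)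
    enough i = shrink (≤-trans λ≤5λ (≤-trans room (≤-reflexive (*-identityˡ b)))) (μ-nonneg (D i)) (large i)
  dense-family (suc l) j l≤3 eq c D Y b 0≤b room big reg Y⊆D large sub =
    dense-family l (j ℕ.+ 1) l≤3′ (trans (ℕ.+-assoc j 1 l) eq) (append G c v (sub zero)) (λ i → D (suc i))
      (λ i → nbhds G (members v) (Y (suc i))) (β * b) (<⇒≤ 0<β ⊗ 0≤b)
      (subst (+ 5 / 1 * λ′ ≤_) (dense-family-ring β (β ^ l) b) room)
      (λ i → big (suc i)) (λ i k i≢k → reg (suc i) (suc k) (λ e → i≢k (Fin.suc-injective e)))
      (λ i → ⊆-trans (nbhds⊆ G (members v)) (Y⊆D (suc i))) degrees
      (λ i → nbhds-++ G (members c) (members v) (sub (suc i)))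
    where
    l≤3′ : fromℕ l ≤ 3ℚ
    l≤3′ = ≤-trans (lin (nonneg! 1ℚ) (trans (cong (_- fromℕ l) (fromℕ-suc l)) (l≤3′-ring (fromℕ l)))) l≤3
    roomy : + 5 / 1 * λ′ ≤ b
    roomy = ≤-trans room (lin (gap (^≤1 0<β β≤1 (suc l)) ⊗ 0≤b) (roomy-ring (β ^ suc l) b))
    stepped = step (2 ℕ.+ l) (λ i → D (suc i)) (λ i → Y (suc i)) (λ _ → β) 1 vertex b
      (big zero) (Y⊆D zero) (large zero)
      (room-for (subst (_≤ 4ℚ) (sym (fromℕ-suc (suc l))) (+-monoʳ-≤ 1ℚ l≤3)) roomy)
      (λ i → reg zero (suc i) (λ ())) (λ i → Y⊆D (suc i))
      (λ i → shrink (≤-trans λ≤5λ roomy) (μ-nonneg (D (suc i))) (large (suc i)))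
    v = proj₁ stepped
    degrees : ∀ i → β * b * μ (D (suc i)) ≤ μ (nbhds G (members v) (Y (suc i)))
    degrees i = ≤-trans (lin (<⇒≤ 0<β ⊗ gap (large (suc i))) (degrees-ring β b (μ (D (suc i))) (μ (Y (suc i))))) (proj₂ stepped i)

  -- 8 = 1 + 1 + 1 + 5.
  no-five-parts : (D : Fin 5 → Vset n) → (∀ i → κ ≤ λ′ * μ (D i)) → (∀ i k → i ≢ k → Regular λ′ β (D i) (D k)) → ⊥
  no-five-parts D big reg = dense-family 3 0 ≤-refl refl (empty-clique G) D D 1ℚ (nonneg! 1ℚ)
    (subst (+ 5 / 1 * λ′ ≤_) (sym (*-identityʳ (β ^ 3))) λ-small) big reg (λ i v p → p)
    (λ i → ≤-reflexive (*-identityˡ _)) (λ i v p → refl)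

  5λ≤1 : + 5 / 1 * λ′ ≤ 1ℚ
  5λ≤1 = ≤-trans λ-small (^≤1 0<β β≤1 3)

  5λ≤β : + 5 / 1 * λ′ ≤ β
  5λ≤β = ≤-trans λ-small (subst (β ^ 3 ≤_) (*-identityʳ β) (*-monoˡ-≤-nonNeg β {{nonNegative (<⇒≤ 0<β)}} (^≤1 0<β β≤1 2)))

  5λ≤ββ : + 5 / 1 * λ′ ≤ β * β
  5λ≤ββ = ≤-trans λ-small (subst (β ^ 3 ≤_) (5λ≤ββ-ring β) (*-monoˡ-≤-nonNeg β {{nonNegative (<⇒≤ 0<β)}}
    (*-monoˡ-≤-nonNeg β {{nonNegative (<⇒≤ 0<β)}} (^≤1 0<β β≤1 1))))

  relative : ∀ {D} → λ′ * μ D ≤ μ D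
  relative {D} = shrink {d = 1ℚ} (≤-trans λ≤5λ 5λ≤1) (μ-nonneg D) (≤-reflexive (*-identityˡ _))

  -- 8 = 1 + 2 + 5: a vertex v of D, an edge of A in its neighbourhood, and a K₅ in what remains of
  -- B and C. The edge leaves at least the proportion 2p - 1 of B and 2q - 1 of C, which is where
  -- the threshold 1/2 comes from.
  no-four-parts : ∀ A B C D p q → κ ≤ λ′ * μ A → κ ≤ λ′ * μ B → κ ≤ λ′ * μ C → κ ≤ λ′ * μ D →
    Regular λ′ β D A → Regular λ′ β D B → Regular λ′ β D C → Regular λ′ β B C →
    Regular λ′ p A B → Regular λ′ q A C → 1ℚ + β ≤ 2ℚ * p → 1ℚ + β ≤ 2ℚ * q → ⊥
  no-four-parts A B C D p q bA bB bC bD DA DB DC BC AB AC p-big q-big =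
    finish refl (append G (append G (empty-clique G) v (λ _ _ → refl)) uv (λ w r → nbhds-++ G [] (members v) {A} (λ _ _ → refl) w r))
      (nbhds-++ G (members v) (members uv) {nbhds G (members v) B} (λ w r → nbhds-++ G [] (members v) {B} (λ _ _ → refl) w r))
      (nbhds-++ G (members v) (members uv) {nbhds G (members v) C} (λ w r → nbhds-++ G [] (members v) {C} (λ _ _ → refl) w r))
      (dense-five bB bC BC (⊆-trans (nbhds⊆ G (members uv)) (nbhds⊆ G (members v)))
        (⊆-trans (nbhds⊆ G (members uv)) (nbhds⊆ G (members v)))
        (deep B p p-big (deg₁ (suc zero)) (deg₂ zero)) (deep C q q-big (deg₁ (suc (suc zero))) (deg₂ (suc zero))))
    where
    parts : Fin 3 → Vset n
    parts zero = A
    parts (suc zero) = B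
    parts (suc (suc _)) = C
    stepped₁ = step 3 {D} {D} parts parts (λ _ → β) 1 vertex 1ℚ bD (λ _ r → r) (≤-reflexive (*-identityˡ _))
      (room-for (≤! 3ℚ 4ℚ) 5λ≤1)
      (λ { zero → DA ; (suc zero) → DB ; (suc (suc zero)) → DC }) (λ _ _ r → r) (λ j → relative)
    v = proj₁ stepped₁
    deg₁ : ∀ j → β * μ (parts j) ≤ μ (nbhds G (members v) (parts j))
    deg₁ j = subst (λ x → x * μ (parts j) ≤ μ (nbhds G (members v) (parts j))) (deg₁-ring β) (proj₂ stepped₁ j)
    targets : Fin 2 → Vset n
    targets zero = B
    targets (suc _) = C
    stepped₂ = step 2 {A} {nbhds G (members v) A} targets (λ j → nbhds G (members v) (targets j))
      (λ { zero → p ; (suc _) → q }) 2 (edge G) β bA (nbhds⊆ G (members v)) (deg₁ zero) (room-for (≤! 2ℚ 4ℚ) 5λ≤β)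
      (λ { zero → AB ; (suc zero) → AC }) (λ j → nbhds⊆ G (members v))
      (λ { zero → shrink (≤-trans λ≤5λ 5λ≤β) (μ-nonneg B) (deg₁ (suc zero))
         ; (suc zero) → shrink (≤-trans λ≤5λ 5λ≤β) (μ-nonneg C) (deg₁ (suc (suc zero))) })
    uv = proj₁ stepped₂
    deg₂ = proj₂ stepped₂
    deep : ∀ X r → 1ℚ + β ≤ 2ℚ * r → β * μ X ≤ μ (nbhds G (members v) X) →
      (1ℚ - 2ℚ * (1ℚ - r)) * μ (nbhds G (members v) X) ≤ μ (nbhds G (members uv) (nbhds G (members v) X)) →
      λ′ * μ X ≤ μ (nbhds G (members uv) (nbhds G (members v) X))
    deep X r big once twice = shrink (≤-trans λ≤5λ 5λ≤ββ) (μ-nonneg X)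
      (≤-trans (lin (<⇒≤ 0<β ⊗ gap once ⊕ gap big ⊗ μ-nonneg (nbhds G (members v) X))
        (deep-ring β r (μ X) (μ (nbhds G (members v) X)))) twice)

  extend-by-triangle : ∀ {j X} → j ℕ.+ 3 ≡ 8 → (c : Clique G j full) → X ⊆ nbhds G (members c) full → κ ≤ μ X → ⊥
  extend-by-triangle {X = X} eq c sub large =
    noK8 (subst (λ k → Clique G k full) eq (append G c (triangle X (≤-trans κ₀≤κ large)) sub))

  -- 8 = 2 + 3 + 3: an edge in A, a triangle among its common neighbours in B, and a triangle in
  -- what remains of C. The edge keeps at least the proportion 2q - 1 of C, and the triangle at
  -- least 3r - 2 of that.
  no-three-parts : ∀ A B C p q r → κ ≤ λ′ * μ A → κ ≤ λ′ * μ B → κ ≤ λ′ * μ C →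
    Regular λ′ p A B → Regular λ′ q A C → Regular λ′ r B C →
    1ℚ + β ≤ 2ℚ * p → 1ℚ + β ≤ 2ℚ * q → 2ℚ + β ≤ 3ℚ * r → ⊥
  no-three-parts A B C p q r bA bB bC AB AC BC p-big q-big r-big =
    extend-by-triangle refl (append G (append G (empty-clique G) uv (λ _ _ → refl)) T (inB uv))
      (nbhds-++ G (members uv) (members T) (inC uv))
      (≤-trans bC (shrink (≤-trans λ≤5λ 5λ≤ββ) (μ-nonneg C)
        (≤-trans (lin (<⇒≤ 0<β ⊗ gap once ⊕ gap r-big ⊗ μ-nonneg (nbhds G (members uv) C))
          (no-three-parts-ring β r (μ C) (μ (nbhds G (members uv) C)))) (proj₂ stepped₂ zero))))
    where
    targets : Fin 2 → Vset n
    targets zero = B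
    targets (suc _) = C
    stepped₁ = step 2 {A} {A} targets targets (λ { zero → p ; (suc _) → q }) 2 (edge G) 1ℚ bA (λ _ r → r)
      (≤-reflexive (*-identityˡ _)) (room-for (≤! 2ℚ 4ℚ) 5λ≤1)
      (λ { zero → AB ; (suc zero) → AC }) (λ _ _ r → r) (λ j → relative)
    uv = proj₁ stepped₁
    inB : (c : Clique G 2 A) → nbhds G (members c) B ⊆ nbhds G (members c) full
    inB c = nbhds-++ G [] (members c) {B} (λ _ _ → refl)
    inC : (c : Clique G 2 A) → nbhds G (members c) C ⊆ nbhds G (members c) full
    inC c = nbhds-++ G [] (members c) {C} (λ _ _ → refl)
    halve : ∀ s {x y} → 1ℚ + β ≤ 2ℚ * s → 0ℚ ≤ y → (1ℚ - 2ℚ * (1ℚ - s)) * y ≤ x → β * y ≤ x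
    halve s big = shrink {d = 1ℚ - 2ℚ * (1ℚ - s)} (lin (gap big) (halve-ring β s))
    once : β * μ C ≤ μ (nbhds G (members uv) C)
    once = halve q q-big (μ-nonneg C) (proj₂ stepped₁ (suc zero))
    stepped₂ = step 1 {B} {nbhds G (members uv) B} (λ _ → C) (λ _ → nbhds G (members uv) C) (λ _ → r) 3 (λ c → c) β bB
      (nbhds⊆ G (members uv)) (halve p p-big (μ-nonneg B) (proj₂ stepped₁ zero)) (room-for (≤! 1ℚ 4ℚ) 5λ≤β)
      (λ _ → BC) (λ _ → nbhds⊆ G (members uv)) (λ _ → shrink (≤-trans λ≤5λ 5λ≤β) (μ-nonneg C) once)
    T = proj₁ stepped₂

  good-part : ∀ A B p → Regular λ′ p A B → Σ (Vset n) λ A₀ → A₀ ⊆ A × (λ′ * μ A ≤ μ A₀) × (∀ v → A₀ v ≡ true → p * μ B ≤ dg B v)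
  good-part A B p reg = proj₁ pruned , proj₁ (proj₂ pruned) ,
    lin (gap (proj₁ (proj₂ (proj₂ pruned))) ⊕ (gap 5λ≤1 ⊕ nonneg! 3ℚ ⊗ <⇒≤ 0<λ) ⊗ μ-nonneg A) (good-part-ring λ′ (μ A) (μ (proj₁ pruned))) ,
    proj₂ (proj₂ (proj₂ pruned))
    where
    pruned = prune A B (p * μ B) (λ′ * μ A) λ X X⊆A s≤ →
      subst (_< E X B) (good-part-ring₁ p (μ X) (μ B)) (reg X B X⊆A (λ _ q → q) s≤ relative)

  -- 8 = 5 + 3: the pair A, C contains a K₅ with two vertices in A and three in C, which together
  -- miss at most the proportion 2 (1 - p) + 3 (1 - r) of B. This is at most 1 - β, and the rest of
  -- B contains a triangle.
  no-cherry : ∀ A B C p r → κ ≤ λ′ * μ A → κ ≤ λ′ * μ B → κ ≤ λ′ * μ C →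
    Regular λ′ p A B → Regular λ′ r C B → Regular λ′ β A C → 4ℚ + β ≤ 2ℚ * p + 3ℚ * r → ⊥
  no-cherry A B C p r bA bB bC AB CB AC dense =
    extend-by-triangle refl (append G (append G (empty-clique G) uv (λ _ _ → refl)) T
        (nbhds-++ G [] (members uv) {C₀} (λ _ _ → refl)))
      (nbhds-++ G (members uv) (members T) {nbhds G (members uv) B} (nbhds-++ G [] (members uv) {B} (λ _ _ → refl)))
      (≤-trans bB (shrink (≤-trans λ≤5λ 5λ≤β) (μ-nonneg B)
        (lin (gap first ⊕ gap second ⊕ gap dense ⊗ μ-nonneg B)
          (no-cherry-ring β p r (μ B) (μ (nbhds G (members uv) B)) (μ (nbhds G (members T) (nbhds G (members uv) B)))))))
    where
    goodA = good-part A B p AB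
    goodC = good-part C B r CB
    C₀ = proj₁ goodC
    pair = five (proj₁ goodA) C₀ (dense-five bA bC AC (proj₁ (proj₂ goodA)) (proj₁ (proj₂ goodC))
      (proj₁ (proj₂ (proj₂ goodA))) (proj₁ (proj₂ (proj₂ goodC))))
    uv = proj₁ pair
    T = proj₂ pair
    rearrange : ∀ p v → p * μ B ≤ dg B v → μ B - (1ℚ - p) * μ B ≤ dg B v
    rearrange p v = subst (_≤ dg B v) (rearrange-ring (μ B) p)
    first : μ B - 2ℚ * ((1ℚ - p) * μ B) ≤ μ (nbhds G (members uv) B)
    first = subst (λ s → μ B - fromℕ s * ((1ℚ - p) * μ B) ≤ μ (nbhds G (members uv) B)) (size uv)
      (μ-nbhds {B} (members uv) (λ _ q → q) (All.map (λ {v} q → rearrange p v (proj₂ (proj₂ (proj₂ goodA)) v q)) (inside uv)))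
    second : μ (nbhds G (members uv) B) - 3ℚ * ((1ℚ - r) * μ B) ≤ μ (nbhds G (members T) (nbhds G (members uv) B))
    second = subst (λ s → μ (nbhds G (members uv) B) - fromℕ s * ((1ℚ - r) * μ B) ≤ μ (nbhds G (members T) (nbhds G (members uv) B))) (size T)
      (μ-nbhds {B} (members T) (nbhds⊆ G (members uv))
        (All.map (λ {v} q → rearrange r v (proj₂ (proj₂ (proj₂ goodC)) v (nbhds⊆ G (members uv) v q))) (inside T)))

-- Quadratic forms of the admissible density patterns

⅓ ⅔ : ℚ
⅓ = + 1 / 3
⅔ = + 2 / 3

p≤-ring : ∀ p r ε → + 25 / 26 - p ≡ + 1 / 5 * (4ℚ + ε - (2ℚ * p + 3ℚ * r)) + + 3 / 5 * (r - p) + + 1 / 5 * (½ - ε) + + 8 / 130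
p≤-ring = solve-∀ ℚ-ring

st≤1-ring : ∀ x y z w → 1ℚ - (x + y) * (z + w) ≡ (1ℚ - (x + y + z + w)) + z + w + (x + y) * ((1ℚ - (x + y + z + w)) + x + y)
st≤1-ring = solve-∀ ℚ-ring

heavy-ring₁ : ∀ p q r x y z ε → ½ + 3ℚ * ε - 2ℚ * (p * (x * y) + q * (x * z) + r * (y * z)) ≡
  ½ * ((1ℚ - (x + y + z)) * (1ℚ + (x + y + z))) + 2ℚ * (x * z * (½ + ε - q))
  + ½ * ((x - (2ℚ * p - 1ℚ) * y) * (x - (2ℚ * p - 1ℚ) * y))
  + ½ * ((y - z - ⅔ * (2ℚ * p - 1ℚ) * y) * (y - z - ⅔ * (2ℚ * p - 1ℚ) * y))
  + (2ℚ * (p - ½)) * (+ 25 / 26 - p) * (+ 13 / 9) * (y * y)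
  + ⅔ * ((4ℚ + ε - (2ℚ * p + 3ℚ * r)) * (y * z)) + ⅓ * ε + ⅔ * (ε * (1ℚ - y * z)) + 2ℚ * (ε * (1ℚ - x * z))
heavy-ring₁ = solve-∀ ℚ-ring

light-ring : ∀ p q r x y z ε → ½ + 3ℚ * ε - 2ℚ * (p * (x * y) + q * (x * z) + r * (y * z)) ≡
  ½ * ((1ℚ - (x + y + z)) * (1ℚ + (x + y + z))) + 2ℚ * (x * z * (½ + ε - q))
  + ½ * ((y - z) * (y - z)) + ½ * (x * x) + 2ℚ * ((½ - p) * (x * y)) + 2ℚ * ((1ℚ - r) * (y * z)) + ε
  + 2ℚ * (ε * (1ℚ - x * z))
light-ring = solve-∀ ℚ-ring

balanced-ring : ∀ p q r x y z ε → ½ + 3ℚ * ε - 2ℚ * (p * (x * y) + q * (x * z) + r * (y * z)) ≡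
  2ℚ * ((⅔ + ε - p) * (x * y)) + 2ℚ * ((⅔ + ε - q) * (x * z)) + 2ℚ * ((⅔ + ε - r) * (y * z))
  + 2ℚ * (⅔ + ε) * (⅓ - (x * y + x * z + y * z)) + + 1 / 18 + + 7 / 3 * ε
balanced-ring = solve-∀ ℚ-ring

matching-form-ring : ∀ p q a b c d x y z w ε →
  ½ + 3ℚ * ε - 2ℚ * (p * (x * y) + q * (z * w) + a * (x * z) + b * (x * w) + c * (y * z) + d * (y * w)) ≡
  ½ * ((1ℚ - (x + y + z + w)) * (1ℚ + (x + y + z + w))) + ½ * ((x - y) * (x - y)) + ½ * ((z - w) * (z - w))
  + 2ℚ * ((1ℚ - p) * (x * y) + (1ℚ - q) * (z * w) + (½ + ε - a) * (x * z) + (½ + ε - b) * (x * w)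
  + (½ + ε - c) * (y * z) + (½ + ε - d) * (y * w))
  + ε + 2ℚ * (ε * (1ℚ - (x + y) * (z + w)))
matching-form-ring = solve-∀ ℚ-ring

spread-ring : ∀ x y z → ⅓ - (x * y + x * z + y * z) ≡ + 1 / 6 * ((x - y) * (x - y)) + + 1 / 6 * ((x - z) * (x - z))
  + + 1 / 6 * ((y - z) * (y - z)) + ⅓ * ((1ℚ - (x + y + z)) * (1ℚ + (x + y + z)))
spread-ring = solve-∀ ℚ-ring

pair≤1-ring : ∀ x y z → 1ℚ - x * z ≡ (1ℚ - (x + y + z)) + y + z + x * ((1ℚ - (x + y + z)) + x + y)
pair≤1-ring = solve-∀ ℚ-ring

module Forms (ε : ℚ) (0≤ε : 0ℚ ≤ ε) (ε≤½ : ε ≤ ½) where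

  Big : ℚ → Set
  Big p = ½ + ε ≤ p

  pair≤1 : ∀ {x y z} → 0ℚ ≤ x → 0ℚ ≤ y → 0ℚ ≤ z → x + y + z ≤ 1ℚ → x * z ≤ 1ℚ
  pair≤1 {x} {y} {z} 0≤x 0≤y 0≤z sum≤1 =
    lin (gap sum≤1 ⊕ 0≤y ⊕ 0≤z ⊕ 0≤x ⊗ (gap sum≤1 ⊕ 0≤x ⊕ 0≤y)) (pair≤1-ring x y z)

  spread : ∀ {x y z} → 0ℚ ≤ x → 0ℚ ≤ y → 0ℚ ≤ z → x + y + z ≤ 1ℚ → x * y + x * z + y * z ≤ ⅓
  spread {x} {y} {z} 0≤x 0≤y 0≤z sum≤1 = lin (nonneg! (+ 1 / 6) ⊗ square-nonneg (x - y) ⊕ nonneg! (+ 1 / 6) ⊗ square-nonneg (x - z)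
      ⊕ nonneg! (+ 1 / 6) ⊗ square-nonneg (y - z) ⊕ nonneg! ⅓ ⊗ (gap sum≤1 ⊗ (nonneg! 1ℚ ⊕ (0≤x ⊕ 0≤y ⊕ 0≤z)))) (spread-ring x y z)

  -- The two excluded patterns are the configurations 2 + 3 + 3 and 5 + 3 of a K₈. They leave three
  -- cases, each settled by a certificate made of squares and products of the slacks.
  triangle-form : ∀ p q r → p ≤ r → q ≤ p → r ≤ 1ℚ →
    (Big p → Big q → ⅔ + ε ≤ r → ⊥) → (4ℚ + ε ≤ 2ℚ * p + 3ℚ * r → ⊥) →
    ∀ x y z → 0ℚ ≤ x → 0ℚ ≤ y → 0ℚ ≤ z → x + y + z ≤ 1ℚ →
    2ℚ * (p * (x * y) + q * (x * z) + r * (y * z)) ≤ ½ + 3ℚ * ε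
  triangle-form p q r p≤r q≤p r≤1 no-triangle no-cherry x y z 0≤x 0≤y 0≤z sum≤1 = decide ((½ + ε) ≤? q) (½ ≤? p)
    where
    Goal : Set
    Goal = 2ℚ * (p * (x * y) + q * (x * z) + r * (y * z)) ≤ ½ + 3ℚ * ε
    -- All three densities are at most 2/3 + ε, and 2 · 2/3 · 1/3 = 4/9 lies 1/18 below 1/2.
    balanced : Big q → Goal
    balanced big = lin
        (nonneg! 2ℚ ⊗ (gap (≤-trans p≤r r≤) ⊗ (0≤x ⊗ 0≤y)) ⊕ nonneg! 2ℚ ⊗ (gap (≤-trans q≤p (≤-trans p≤r r≤)) ⊗ (0≤x ⊗ 0≤z))
          ⊕ nonneg! 2ℚ ⊗ (gap r≤ ⊗ (0≤y ⊗ 0≤z)) ⊕ nonneg! 2ℚ ⊗ (nonneg! ⅔ ⊕ 0≤ε) ⊗ gap (spread 0≤x 0≤y 0≤z sum≤1) ⊕ nonneg! (+ 1 / 18) ⊕ nonneg! (+ 7 / 3) ⊗ 0≤ε)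
        (balanced-ring p q r x y z ε)
      where
      r≤ : r ≤ ⅔ + ε
      r≤ = <⇒≤ (≰⇒> (no-triangle (≤-trans big q≤p) big))
    -- Only r may be well above 1/2; the extremal case is r = 1 with x = 0 and y = z.
    light : ¬ Big q → ¬ (½ ≤ p) → Goal
    light small p<½ = lin
        (nonneg! ½ ⊗ (gap sum≤1 ⊗ (nonneg! 1ℚ ⊕ (0≤x ⊕ 0≤y ⊕ 0≤z))) ⊕ nonneg! 2ℚ ⊗ (0≤x ⊗ 0≤z ⊗ gap q≤)
          ⊕ nonneg! ½ ⊗ square-nonneg (y - z) ⊕ nonneg! ½ ⊗ square-nonneg x ⊕ nonneg! 2ℚ ⊗ (gap p≤½ ⊗ (0≤x ⊗ 0≤y))
          ⊕ nonneg! 2ℚ ⊗ (gap r≤1 ⊗ (0≤y ⊗ 0≤z)) ⊕ 0≤ε ⊕ nonneg! 2ℚ ⊗ (0≤ε ⊗ gap xz≤1))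
        (light-ring p q r x y z ε)
      where
      q≤ : q ≤ ½ + ε
      q≤ = <⇒≤ (≰⇒> small)
      p≤½ : p ≤ ½
      p≤½ = <⇒≤ (≰⇒> p<½)
      xz≤1 : x * z ≤ 1ℚ
      xz≤1 = pair≤1 0≤x 0≤y 0≤z sum≤1
    -- Write s = 2p - 1. In the limiting case q = 1/2, r = 1 - s/3, completing squares leaves s (4/3
    -- - 13s/9) y²/2, which is non-negative as long as s ≤ 12/13, that is p ≤ 25/26.
    heavy : ¬ Big q → ½ ≤ p → Goal
    heavy small ½≤p = lin
        (nonneg! ½ ⊗ (gap sum≤1 ⊗ (nonneg! 1ℚ ⊕ (0≤x ⊕ 0≤y ⊕ 0≤z))) ⊕ nonneg! 2ℚ ⊗ (0≤x ⊗ 0≤z ⊗ gap q≤)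
          ⊕ nonneg! ½ ⊗ square-nonneg (x - (2ℚ * p - 1ℚ) * y) ⊕ nonneg! ½ ⊗ square-nonneg (y - z - ⅔ * (2ℚ * p - 1ℚ) * y)
          ⊕ ((nonneg! 2ℚ ⊗ gap ½≤p) ⊗ gap p≤ ⊗ nonneg! (+ 13 / 9)) ⊗ square-nonneg y
          ⊕ nonneg! ⅔ ⊗ (gap cherry ⊗ (0≤y ⊗ 0≤z)) ⊕ nonneg! ⅓ ⊗ 0≤ε ⊕ nonneg! ⅔ ⊗ (0≤ε ⊗ gap yz≤1) ⊕ nonneg! 2ℚ ⊗ (0≤ε ⊗ gap xz≤1))
        (heavy-ring₁ p q r x y z ε)
      where
      q≤ : q ≤ ½ + ε
      q≤ = <⇒≤ (≰⇒> small)
      cherry : 2ℚ * p + 3ℚ * r ≤ 4ℚ + ε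
      cherry = <⇒≤ (≰⇒> no-cherry)
      -- Since p ≤ r, the bound on 2p + 3r gives 5p ≤ 4 + ε ≤ 9/2.
      p≤ : p ≤ + 25 / 26
      p≤ = lin (nonneg! (+ 1 / 5) ⊗ gap cherry ⊕ nonneg! (+ 3 / 5) ⊗ gap p≤r ⊕ nonneg! (+ 1 / 5) ⊗ gap ε≤½ ⊕ nonneg! (+ 8 / 130))
        (p≤-ring p r ε)
      xz≤1 : x * z ≤ 1ℚ
      xz≤1 = pair≤1 0≤x 0≤y 0≤z sum≤1
      yz≤1 : y * z ≤ 1ℚ
      yz≤1 = pair≤1 0≤y 0≤x 0≤z (subst (λ s → s + z ≤ 1ℚ) (+-comm x y) sum≤1)
    decide : Dec (Big q) → Dec (½ ≤ p) → Goal
    decide (yes big)  _         = balanced big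
    decide (no small) (yes ½≤p) = heavy small ½≤p
    decide (no small) (no p<½)  = light small p<½

  -- In the limiting case, with coefficients 1 on xy and zw and 1/2 across, 2xy ≤ (x + y)²/2 and 2zw
  -- ≤ (z + w)²/2 bound the form by (x + y + z + w)²/2.
  matching-form : ∀ p q a b c d → p ≤ 1ℚ → q ≤ 1ℚ → a ≤ ½ + ε → b ≤ ½ + ε → c ≤ ½ + ε → d ≤ ½ + ε →
    ∀ x y z w → 0ℚ ≤ x → 0ℚ ≤ y → 0ℚ ≤ z → 0ℚ ≤ w → x + y + z + w ≤ 1ℚ →
    2ℚ * (p * (x * y) + q * (z * w) + a * (x * z) + b * (x * w) + c * (y * z) + d * (y * w)) ≤ ½ + 3ℚ * ε
  matching-form p q a b c d p≤ q≤ a≤ b≤ c≤ d≤ x y z w 0≤x 0≤y 0≤z 0≤w sum≤1 = lin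
    (nonneg! ½ ⊗ (gap sum≤1 ⊗ (nonneg! 1ℚ ⊕ (0≤x ⊕ 0≤y ⊕ 0≤z ⊕ 0≤w))) ⊕ nonneg! ½ ⊗ square-nonneg (x - y) ⊕ nonneg! ½ ⊗ square-nonneg (z - w)
      ⊕ nonneg! 2ℚ ⊗ (gap p≤ ⊗ (0≤x ⊗ 0≤y) ⊕ gap q≤ ⊗ (0≤z ⊗ 0≤w) ⊕ gap a≤ ⊗ (0≤x ⊗ 0≤z) ⊕ gap b≤ ⊗ (0≤x ⊗ 0≤w)
           ⊕ gap c≤ ⊗ (0≤y ⊗ 0≤z) ⊕ gap d≤ ⊗ (0≤y ⊗ 0≤w))
      ⊕ 0≤ε ⊕ nonneg! 2ℚ ⊗ (0≤ε ⊗ gap st≤1))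
    (matching-form-ring p q a b c d x y z w ε)
    where
    st≤1 : (x + y) * (z + w) ≤ 1ℚ
    st≤1 = lin (gap sum≤1 ⊕ 0≤z ⊕ 0≤w ⊕ (0≤x ⊕ 0≤y) ⊗ (gap sum≤1 ⊕ 0≤x ⊕ 0≤y)) (st≤1-ring x y z w)

-- The structure of optimal weights

-- ρ is the density from which two centres count as adjacent, e the error allowed in regular pairs, β the factor
-- by which a set shrinks when one passes to common neighbours, λ′ the relative size of the subsets controlled by
-- regularity, ν the density of the centres, κ their measure and κ₁ the measure of their controlled subsets;
-- sets of measure κ₀ contain triangles, and τ is the stability error.
record Scales (ε : ℚ) : Set where
  field
    ρ e β λ′ ν κ κ₁ κ₀ τ : ℚ
    0<ε : 0ℚ < ε
    ε≤½ : ε ≤ ½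
    0<ρ : 0ℚ < ρ
    ρ-small : 4ℚ * ρ ≤ ε * ε
    0<e : 0ℚ < e
    0<β : 0ℚ < β
    β≤ρ : β + 3ℚ * e ≤ ρ
    β≤ε : β + + 15 / 1 * e ≤ ε
    0<λ : 0ℚ < λ′
    λ-small : + 5 / 1 * λ′ ≤ β ^ 3
    0<ν : 0ℚ < ν
    ν-small : 4ℚ * ν ≤ e * e * λ′
    κ-small : κ ≤ ν ^ 8 * ε
    0<κ₁ : 0ℚ < κ₁
    κ₁-small : κ₁ ≤ λ′ * κ
    0<κ₀ : 0ℚ < κ₀
    κ₀≤κ₁ : κ₀ ≤ κ₁
    κ₀-small : κ₀ ≤ β * (κ₁ * κ₁)
    0<τ : 0ℚ < τ
    τ-small : 8ℚ * τ ≤ e * e * (κ₁ * κ₁)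

sum+r≤1-ring : ∀ x y z w r → x + y + z + w + r ≡ x + (y + (z + (w + r)))
sum+r≤1-ring = solve-∀ ℚ-ring

sum≤1-ring : ∀ x y z w r → x + (y + (z + (w + r))) - (x + y + z + w) ≡ r
sum≤1-ring = solve-∀ ℚ-ring

ρ≤ε-ring : ∀ r e → e - r ≡ + 1 / 4 * (e * e - 4ℚ * r) + + 1 / 4 * (e * (1ℚ - e)) + + 3 / 4 * e
ρ≤ε-ring = solve-∀ ℚ-ring

thick-ring : ∀ f p e a → p * a + 3ℚ * e - f ≡ ((p + 2ℚ * e) * a - f) + 2ℚ * (e * (1ℚ - a)) + e
thick-ring = solve-∀ ℚ-ring

thin-right-ring : ∀ f p e k x y → p * (x * y) + 3ℚ * e - f ≡ (x * y - f) + (k - y) * x + k * (1ℚ - x) + (e - k) + p * (x * y) + 2ℚ * e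
thin-right-ring = solve-∀ ℚ-ring

thin-left-ring : ∀ f p e k x y → p * (x * y) + 3ℚ * e - f ≡ (x * y - f) + (k - x) * y + k * (1ℚ - y) + (e - k) + p * (x * y) + 2ℚ * e
thin-left-ring = solve-∀ ℚ-ring

with-three-ring : ∀ x y z w → x + y + z + w - (x + y + z) ≡ w
with-three-ring = solve-∀ ℚ-ring

with-three-ring₁ : ∀ p q r x y z w → 2ℚ * (p * (x * y) + q * (x * z) + r * (y * z)) ≡
  2ℚ * (p * (x * y) + 0ℚ * (z * w) + q * (x * z) + 0ℚ * (x * w) + r * (y * z) + 0ℚ * (y * w))
with-three-ring₁ = solve-∀ ℚ-ring

pairing₂-ring : ∀ x y z w → x + y + z + w ≡ x + w + y + z
pairing₂-ring = solve-∀ ℚ-ring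

pairing₂-ring₁ : ∀ p q a b c d x y z w → 2ℚ * (b * (x * w) + c * (y * z) + p * (x * y) + a * (x * z) + d * (w * y) + q * (w * z)) ≡
  2ℚ * (p * (x * y) + q * (z * w) + a * (x * z) + b * (x * w) + c * (y * z) + d * (y * w))
pairing₂-ring₁ = solve-∀ ℚ-ring

pairing₁-ring : ∀ x y z w → x + y + z + w ≡ x + z + y + w
pairing₁-ring = solve-∀ ℚ-ring

pairing₁-ring₁ : ∀ p q a b c d x y z w → 2ℚ * (a * (x * z) + d * (y * w) + p * (x * y) + b * (x * w) + c * (z * y) + q * (z * w)) ≡
  2ℚ * (p * (x * y) + q * (z * w) + a * (x * z) + b * (x * w) + c * (y * z) + d * (y * w))
pairing₁-ring₁ = solve-∀ ℚ-ring

triangle-swap-ring : ∀ x y z → x + y + z ≡ x + z + y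
triangle-swap-ring = solve-∀ ℚ-ring

triangle-swap-ring₁ : ∀ p q r x y z → 2ℚ * (q * (x * z) + p * (x * y) + r * (z * y)) ≡ 2ℚ * (p * (x * y) + q * (x * z) + r * (y * z))
triangle-swap-ring₁ = solve-∀ ℚ-ring

triangle-rotate-ring : ∀ x y z → x + y + z ≡ z + x + y
triangle-rotate-ring = solve-∀ ℚ-ring

triangle-rotate-ring₁ : ∀ p q r x y z → 2ℚ * (q * (z * x) + r * (z * y) + p * (x * y)) ≡ 2ℚ * (p * (x * y) + q * (x * z) + r * (y * z))
triangle-rotate-ring₁ = solve-∀ ℚ-ring

conclude-ring : ∀ p q a b c d x y z w r e e₀₀ e₁₁ e₂₂ e₃₃ e₀₁ e₂₃ e₀₂ e₀₃ e₁₂ e₁₃ e₀ e₁ e₂ e₃ eᵣ →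
  ½ + + 53 / 1 * e - (e₀₀ + 2ℚ * (e₀₁ + (e₀₂ + (e₀₃ + e₀))) + (e₁₁ + 2ℚ * (e₁₂ + (e₁₃ + e₁))
  + (e₂₂ + 2ℚ * (e₂₃ + e₂) + (e₃₃ + 2ℚ * e₃ + eᵣ)))) ≡
  (3ℚ * e - e₀₀) + (3ℚ * e - e₁₁) + (3ℚ * e - e₂₂) + (3ℚ * e - e₃₃)
  + 2ℚ * ((p * (x * y) + 3ℚ * e - e₀₁) + (q * (z * w) + 3ℚ * e - e₂₃) + (a * (x * z) + 3ℚ * e - e₀₂)
  + (b * (x * w) + 3ℚ * e - e₀₃) + (c * (y * z) + 3ℚ * e - e₁₂) + (d * (y * w) + 3ℚ * e - e₁₃))
  + 2ℚ * ((x * r - e₀) + (y * r - e₁) + (z * r - e₂) + (w * r - e₃)) + (r * r - eᵣ)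
  + (½ + 3ℚ * e - 2ℚ * (p * (x * y) + q * (z * w) + a * (x * z) + b * (x * w) + c * (y * z) + d * (y * w)))
  + 2ℚ * (r * (1ℚ - (x + y + z + w + r))) + 2ℚ * (e - r) + r * r
conclude-ring = solve-∀ ℚ-ring

E-peel-ring : ∀ a b c → a + b + (b + c) ≡ a + 2ℚ * b + c
E-peel-ring = solve-∀ ℚ-ring

diagonal-bound-ring : ∀ r e a → (0ℚ + 2ℚ * e) * a - (r + e) * a ≡ (e - r) * a
diagonal-bound-ring = solve-∀ ℚ-ring

diagonal-bound-ring₁ : ∀ a e → 0ℚ * a + 3ℚ * e ≡ 3ℚ * e
diagonal-bound-ring₁ = solve-∀ ℚ-ring

pair-bound-ring : ∀ p e → p + e + e ≡ p + 2ℚ * e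
pair-bound-ring = solve-∀ ℚ-ring

near-core₄-ring : ∀ f r e a → e * e * a - 4ℚ * f ≡ 4ℚ * (r * a - f) + (e * e - 4ℚ * r) * a
near-core₄-ring = solve-∀ ℚ-ring

near-core-ring : ∀ r c x → r * c * x ≡ r * (x * c)
near-core-ring = solve-∀ ℚ-ring

product≤1-ring : ∀ x y → 1ℚ - x * y ≡ (1ℚ - x) + x * (1ℚ - y)
product≤1-ring = solve-∀ ℚ-ring

slack-cherry-ring : ∀ b x e p r → 2ℚ * (p - 3ℚ * e) + 3ℚ * (r - 3ℚ * e) - (4ℚ + b) ≡ (2ℚ * p + 3ℚ * r - (4ℚ + x)) + (x - (b + + 15 / 1 * e))
slack-cherry-ring = solve-∀ ℚ-ring

slack₃-ring : ∀ b x e p → 3ℚ * (p - 3ℚ * e) - (2ℚ + b) ≡ 3ℚ * (p - (⅔ + x)) + (x - (b + + 15 / 1 * e)) + 2ℚ * x + + 6 / 1 * e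
slack₃-ring = solve-∀ ℚ-ring

slack-ring : ∀ b x e p → 2ℚ * (p - 3ℚ * e) - (1ℚ + b) ≡ 2ℚ * (p - (½ + x)) + (x - (b + + 15 / 1 * e)) + x + + 9 / 1 * e
slack-ring = solve-∀ ℚ-ring

regular-β-ring : ∀ b r e p → p - 3ℚ * e - b ≡ (r - (b + 3ℚ * e)) + (p - r)
regular-β-ring = solve-∀ ℚ-ring

far-ring : ∀ r x y → r * x * y ≡ x * y * r
far-ring = solve-∀ ℚ-ring

τ-small′-ring : ∀ ε e k → ε * ε * (k * k) - e * e * (k * k) ≡ (ε - e) * (ε + e) * (k * k)
τ-small′-ring = solve-∀ ℚ-ring

ν≤1-ring : ∀ ν e l → 1ℚ - ν ≡ + 1 / 4 * (e * e * l - 4ℚ * ν) + + 1 / 4 * (e * e * (1ℚ - l)) + + 1 / 4 * ((1ℚ - e) * (1ℚ + e)) + + 3 / 4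
ν≤1-ring = solve-∀ ℚ-ring

λ≤1-ring : ∀ l b → 1ℚ - l ≡ (b - + 5 / 1 * l) + (1ℚ - b) + 4ℚ * l
λ≤1-ring = solve-∀ ℚ-ring

e≤ε-ring : ∀ b e x → x - e ≡ (x - (b + + 15 / 1 * e)) + b + + 14 / 1 * e
e≤ε-ring = solve-∀ ℚ-ring

β≤1-ring : ∀ b e x → 1ℚ - b ≡ (x - (b + + 15 / 1 * e)) + (1ℚ - x) + + 15 / 1 * e
β≤1-ring = solve-∀ ℚ-ring

module Structure {n : ℕ} (G : Graph n) (m : Fin n → ℚ) (m≥0 : ∀ v → 0ℚ ≤ m v) (ε : ℚ) (S : Scales ε)
  (mass : Measure.μ G m m≥0 full ≡ 1ℚ)
  (stable : Stable G m m≥0 (Scales.τ S))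
  (triangle : ∀ X → Scales.κ₀ S ≤ Measure.μ G m m≥0 X → Clique G 3 X)
  (five : ∀ X Y → Scales.κ₀ S ≤ Measure.E G m m≥0 X Y → Σ (Clique G 2 X) λ c → Clique G 3 (nbhds G (members c) Y))
  (noK8 : ¬ Clique G 8 full)
  where
  open Measure G m m≥0
  open Sets G m m≥0
  open Scales S

  0≤ε = <⇒≤ 0<ε

  ε≤1 : ε ≤ 1ℚ
  ε≤1 = ≤-trans ε≤½ (≤! ½ 1ℚ)

  β≤1 : β ≤ 1ℚ
  β≤1 = lin (gap β≤ε ⊕ gap ε≤1 ⊕ nonneg! (+ 15 / 1) ⊗ <⇒≤ 0<e) (β≤1-ring β e ε)

  e≤ε : e ≤ ε
  e≤ε = lin (gap β≤ε ⊕ <⇒≤ 0<β ⊕ nonneg! (+ 14 / 1) ⊗ <⇒≤ 0<e) (e≤ε-ring β e ε)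

  Big : ℚ → Set
  Big = Forms.Big ε 0≤ε ε≤½

  large-pos : ∀ {X} → κ₁ ≤ μ X → 0ℚ < μ X
  large-pos = <-≤-trans 0<κ₁

  λ≤1 : λ′ ≤ 1ℚ
  λ≤1 = lin (gap λ-small ⊕ gap (^≤1 0<β β≤1 3) ⊕ nonneg! 4ℚ ⊗ <⇒≤ 0<λ) (λ≤1-ring λ′ (β ^ 3))

  ν≤1 : ν ≤ 1ℚ
  ν≤1 = lin (nonneg! (+ 1 / 4) ⊗ gap ν-small ⊕ nonneg! (+ 1 / 4) ⊗ ((<⇒≤ 0<e ⊗ <⇒≤ 0<e) ⊗ gap λ≤1)
      ⊕ nonneg! (+ 1 / 4) ⊗ (gap e≤1 ⊗ (nonneg! 1ℚ ⊕ <⇒≤ 0<e)) ⊕ nonneg! (+ 3 / 4)) (ν≤1-ring ν e λ′)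
    where
    e≤1 = ≤-trans e≤ε ε≤1

  τ-small′ : 8ℚ * τ ≤ ε * ε * (κ₁ * κ₁)
  τ-small′ = ≤-trans τ-small (lin ((gap e≤ε ⊗ (0≤ε ⊕ <⇒≤ 0<e)) ⊗ (<⇒≤ 0<κ₁ ⊗ <⇒≤ 0<κ₁)) (τ-small′-ring ε e κ₁))

  κ₁≤κ : κ₁ ≤ κ
  κ₁≤κ = ≤-trans κ₁-small (lin (gap λ≤1 ⊗ 0≤κ) (sparse-subset′-ring₁ λ′ κ))
    where
    0≤κ : 0ℚ ≤ κ
    0≤κ = cancel-≤ 0<λ (subst (_≤ λ′ * κ) (sym (*-zeroʳ λ′)) (≤-trans (<⇒≤ 0<κ₁) κ₁-small))

  κ₁≤ε : κ₁ ≤ ε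
  κ₁≤ε = ≤-trans κ₁≤κ (≤-trans κ-small (lin (gap (^≤1 0<ν ν≤1 8) ⊗ 0≤ε) (sparse-subset′-ring₁ (ν ^ 8) ε)))

  μ≤1 : ∀ X → μ X ≤ 1ℚ
  μ≤1 X = subst (μ X ≤_) mass (μ-mono (λ _ _ → refl))

  record Center : Set where
    constructor center
    field
      core   : Vset n
      large  : κ ≤ μ core
      sparse : Sparse ν core
  open Center

  core-large : ∀ c → κ₁ ≤ λ′ * μ (core c)
  core-large c = ≤-trans κ₁-small (*-monoˡ-≤-nonNeg λ′ {{nonNegative (<⇒≤ 0<λ)}} (large c))

  core-κ₁ : ∀ c → κ₁ ≤ μ (core c)
  core-κ₁ c = ≤-trans κ₁≤κ (large c)

  new-center : ∀ R → ε ≤ μ R → Σ Center λ c → core c ⊆ R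
  new-center R ε≤ = center (proj₁ found)
      (≤-trans κ-small (≤-trans (*-monoˡ-≤-nonNeg (ν ^ 8) {{nonNegative (<⇒≤ (^-pos 0<ν 8))}} ε≤) (proj₁ (proj₂ (proj₂ found)))))
      (proj₂ (proj₂ (proj₂ found))) , proj₁ (proj₂ found)
    where
    found = sparse-subset noK8 ν 0<ν ν≤1 R (<-≤-trans 0<ε ε≤)

  -- The density is kept as a number with its defining equation, so that links can be compared and
  -- sorted without dividing by measures.
  record Link (c d : Center) : Set where
    constructor link
    field
      density : ℚ
      value   : E (core c) (core d) ≡ density * (μ (core c) * μ (core d))
      lower   : ρ ≤ density
      upper   : density ≤ 1ℚ
  open Link

  far : ∀ c d → (∀ v → core d v ≡ true → ρ * μ (core c) ≤ dg (core c) v) → Link c d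
  far c d away = link t eq
    (cancel-≤ {μ (core c) * μ (core d)} (large-pos (core-κ₁ c) ⊗⁺ large-pos (core-κ₁ d))
      (subst₂ _≤_ (far-ring ρ (μ (core c)) (μ (core d))) (trans (E-sym (core d) (core c)) (trans eq (*-comm t (μ (core c) * μ (core d)))))
        (E-deg-≥ (core d) (core c) (ρ * μ (core c)) away)))
    t≤1
    where
    found = Exchange.ratio G m m≥0 κ₁ τ 0<κ₁ stable (core c) (core d) (large-pos (core-κ₁ c)) (large-pos (core-κ₁ d))
    t = proj₁ found
    eq = proj₁ (proj₂ found)
    t≤1 = proj₂ (proj₂ found)

  regular-sym : ∀ {p X Y} → Regular λ′ p X Y → Regular λ′ p Y X
  regular-sym {p} reg Y′ X′ Y⊆ X⊆ lY lX =
    subst₂ _<_ (cong (p *_) (*-comm (μ X′) (μ Y′))) (E-sym X′ Y′) (reg X′ Y′ X⊆ Y⊆ lX lY)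

  regular-mono : ∀ {p q X Y} → p ≤ q → Regular λ′ q X Y → Regular λ′ p X Y
  regular-mono {p} {q} p≤q reg X′ Y′ X⊆ Y⊆ lX lY =
    ≤-<-trans (lin (gap p≤q ⊗ (μ-nonneg X′ ⊗ μ-nonneg Y′)) (form-monoˡ-ring p q (μ X′ * μ Y′))) (reg X′ Y′ X⊆ Y⊆ lX lY)

  regular : ∀ {c d} (l : Link c d) → Regular λ′ (density l - 3ℚ * e) (core c) (core d)
  regular {c} {d} l = Exchange.sparse-regular G m m≥0 κ₁ τ 0<κ₁ stable {ν = ν} {λ′ = λ′} e (density l) 0<e (≤-trans e≤ε ε≤1) τ-small 0<λ λ≤1 ν-small
    (core-large c) (core-large d) (sparse c) (sparse d) (≤-reflexive (sym (value l)))

  regular-β : ∀ {c d} → Link c d → Regular λ′ β (core c) (core d)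
  regular-β l = regular-mono {β} {density l - 3ℚ * e} (lin (gap β≤ρ ⊕ gap (lower l)) (regular-β-ring β ρ e (density l))) (regular l)

  slack : ∀ {p} → Big p → 1ℚ + β ≤ 2ℚ * (p - 3ℚ * e)
  slack {p} big = lin (nonneg! 2ℚ ⊗ gap big ⊕ gap β≤ε ⊕ 0≤ε ⊕ nonneg! (+ 9 / 1) ⊗ <⇒≤ 0<e) (slack-ring β ε e p)

  slack₃ : ∀ {p} → ⅔ + ε ≤ p → 2ℚ + β ≤ 3ℚ * (p - 3ℚ * e)
  slack₃ {p} big = lin (nonneg! 3ℚ ⊗ gap big ⊕ gap β≤ε ⊕ nonneg! 2ℚ ⊗ 0≤ε ⊕ nonneg! (+ 6 / 1) ⊗ <⇒≤ 0<e) (slack₃-ring β ε e p)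

  slack-cherry : ∀ {p r} → 4ℚ + ε ≤ 2ℚ * p + 3ℚ * r → 4ℚ + β ≤ 2ℚ * (p - 3ℚ * e) + 3ℚ * (r - 3ℚ * e)
  slack-cherry {p} {r} big = lin (gap big ⊕ gap β≤ε) (slack-cherry-ring β ε e p r)

  flip : ∀ {c d} → Link c d → Link d c
  flip {c} {d} (link p v l u) = link p (trans (E-sym (core d) (core c)) (trans v (cong (p *_) (*-comm (μ (core c)) (μ (core d)))))) l u

  link-triangle : ∀ {a b c} (ab : Link a b) (ac : Link a c) (bc : Link b c) →
    Big (density ab) → Big (density ac) → ⅔ + ε ≤ density bc → ⊥
  link-triangle {a} {b} {c} ab ac bc p q r = Finders.no-three-parts G m m≥0 λ′ β κ₁ κ₀ 0<λ 0<β β≤1 λ-small 0<κ₁ κ₀≤κ₁ κ₀-small triangle five noK8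
    (core a) (core b) (core c)
    (density ab - 3ℚ * e) (density ac - 3ℚ * e) (density bc - 3ℚ * e)
    (core-large a) (core-large b) (core-large c) (regular ab) (regular ac) (regular bc)
    (slack {density ab} p) (slack {density ac} q) (slack₃ {density bc} r)

  link-cherry : ∀ {a b c} (ab : Link a b) (ac : Link a c) (bc : Link b c) →
    4ℚ + ε ≤ 2ℚ * density ab + 3ℚ * density bc → ⊥
  link-cherry {a} {b} {c} ab ac bc big = Finders.no-cherry G m m≥0 λ′ β κ₁ κ₀ 0<λ 0<β β≤1 λ-small 0<κ₁ κ₀≤κ₁ κ₀-small triangle five noK8
    (core a) (core b) (core c) (density ab - 3ℚ * e) (density bc - 3ℚ * e)
    (core-large a) (core-large b) (core-large c) (regular ab) (regular-sym {density bc - 3ℚ * e} (regular bc)) (regular-β ac)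
    (slack-cherry {density ab} {density bc} big)

  link-star : ∀ {a b c d} (ab : Link a b) (ac : Link a c) → Link b c → Link d a → Link d b → Link d c →
    Big (density ab) → Big (density ac) → ⊥
  link-star {a} {b} {c} {d} ab ac bc da db dc p q = Finders.no-four-parts G m m≥0 λ′ β κ₁ κ₀ 0<λ 0<β β≤1 λ-small 0<κ₁ κ₀≤κ₁ κ₀-small triangle five noK8
    (core a) (core b) (core c) (core d)
    (density ab - 3ℚ * e) (density ac - 3ℚ * e)
    (core-large a) (core-large b) (core-large c) (core-large d) (regular-β da) (regular-β db) (regular-β dc) (regular-β bc)
    (regular ab) (regular ac) (slack {density ab} p) (slack {density ac} q)

  -- `nothing` is an absent centre without near vertices; it lets a single computation treat one,
  -- two, three and four centres.
  near : Maybe Center → Vset n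
  near nothing  v = false
  near (just c) v = does (dg (core c) v <? ρ * μ (core c))

  Bounded : Maybe Center → Maybe Center → ℚ → Set
  Bounded (just c) (just d) p = E (core c) (core d) ≤ p * (μ (core c) * μ (core d))
  Bounded _        _        p = ⊤

  product≤1 : ∀ X Y → μ X * μ Y ≤ 1ℚ
  product≤1 X Y = lin (gap (μ≤1 X) ⊕ μ-nonneg X ⊗ gap (μ≤1 Y)) (product≤1-ring (μ X) (μ Y))

  -- Exchange works only for sets of measure at least κ₁. The edge weight between a smaller set and
  -- any other is at most κ₁ ≤ ε, which the additive error absorbs.
  bounded-pair : ∀ {X Y p} → 0ℚ ≤ p → (κ₁ ≤ μ X → κ₁ ≤ μ Y → E X Y ≤ (p + 2ℚ * ε) * (μ X * μ Y)) → E X Y ≤ p * (μ X * μ Y) + 3ℚ * ε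
  bounded-pair {X} {Y} {p} 0≤p bound = decide (κ₁ ≤? μ X) (κ₁ ≤? μ Y)
    where
    Goal : Set
    Goal = E X Y ≤ p * (μ X * μ Y) + 3ℚ * ε
    thin-left : ¬ (κ₁ ≤ μ X) → Goal
    thin-left small = lin (gap (E≤ X Y) ⊕ gap (<⇒≤ (≰⇒> small)) ⊗ μ-nonneg Y ⊕ <⇒≤ 0<κ₁ ⊗ gap (μ≤1 Y) ⊕ gap κ₁≤ε
        ⊕ 0≤p ⊗ (μ-nonneg X ⊗ μ-nonneg Y) ⊕ nonneg! 2ℚ ⊗ 0≤ε) (thin-left-ring (E X Y) p ε κ₁ (μ X) (μ Y))
    thin-right : ¬ (κ₁ ≤ μ Y) → Goal
    thin-right small = lin (gap (E≤ X Y) ⊕ gap (<⇒≤ (≰⇒> small)) ⊗ μ-nonneg X ⊕ <⇒≤ 0<κ₁ ⊗ gap (μ≤1 X) ⊕ gap κ₁≤ε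
        ⊕ 0≤p ⊗ (μ-nonneg X ⊗ μ-nonneg Y) ⊕ nonneg! 2ℚ ⊗ 0≤ε) (thin-right-ring (E X Y) p ε κ₁ (μ X) (μ Y))
    thick : κ₁ ≤ μ X → κ₁ ≤ μ Y → Goal
    thick lX lY = lin (gap (bound lX lY) ⊕ nonneg! 2ℚ ⊗ (0≤ε ⊗ gap (product≤1 X Y)) ⊕ 0≤ε) (thick-ring (E X Y) p ε (μ X * μ Y))
    decide : Dec (κ₁ ≤ μ X) → Dec (κ₁ ≤ μ Y) → Goal
    decide (no small) _          = thin-left small
    decide (yes lX)   (no small) = thin-right small
    decide (yes lX)   (yes lY)   = thick lX lY

  near-core : ∀ c X → X ⊆ near (just c) → E X (core c) ≤ ρ * (μ X * μ (core c))
  near-core c X sub = subst (E X (core c) ≤_) (near-core-ring ρ (μ (core c)) (μ X))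
    (E-deg-≤ X (core c) (ρ * μ (core c)) (λ v p → <⇒≤ (does-true (dg (core c) v <? ρ * μ (core c)) (sub v p))))

  near-core₄ : ∀ c X → X ⊆ near (just c) → 4ℚ * E X (core c) ≤ ε * ε * (μ X * μ (core c))
  near-core₄ c X sub = lin (nonneg! 4ℚ ⊗ gap (near-core c X sub) ⊕ gap ρ-small ⊗ (μ-nonneg X ⊗ μ-nonneg (core c)))
    (near-core₄-ring (E X (core c)) ρ ε (μ X * μ (core c)))

  empty : ∀ {X} Y → (∀ v → X v ≡ true → ⊥) → E X Y ≤ 0ℚ
  empty {X} Y none = subst (E X Y ≤_) (*-zeroˡ (μ X)) (E-deg-≤ X Y 0ℚ (λ v p → ⊥-elim (none v p)))

  nonneg-slack : ∀ {f p X Y} → 0ℚ ≤ p → f ≤ 0ℚ → f ≤ p * (μ X * μ Y) + 3ℚ * ε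
  nonneg-slack {f} {p} {X} {Y} 0≤p f≤0 = ≤-trans f≤0 (0≤p ⊗ (μ-nonneg X ⊗ μ-nonneg Y) ⊕ nonneg! 3ℚ ⊗ 0≤ε)

  -- Against the core of c, the core of d is exchanged for Y; then, against Y, the core of c is
  -- exchanged for X. Each exchange adds ε to p.
  pair-bound : ∀ c d {p X Y} → 0ℚ ≤ p → Bounded c d p → X ⊆ near c → Y ⊆ near d → E X Y ≤ p * (μ X * μ Y) + 3ℚ * ε
  pair-bound nothing d {p} {X} {Y} 0≤p _ X⊆ _ = nonneg-slack {X = X} {Y} 0≤p (empty Y (λ v p → false≢true (X⊆ v p)))
    where
    false≢true : false ≡ true → ⊥
    false≢true ()
  pair-bound (just _) nothing {p} {X} {Y} 0≤p _ _ Y⊆ =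
    nonneg-slack {X = X} {Y} 0≤p (subst (_≤ 0ℚ) (E-sym Y X) (empty X (λ v p → false≢true (Y⊆ v p))))
    where
    false≢true : false ≡ true → ⊥
    false≢true ()
  pair-bound (just c) (just d) {p} {X} {Y} 0≤p cd X⊆ Y⊆ = bounded-pair 0≤p λ lX lY →
    subst (λ q → E X Y ≤ q * (μ X * μ Y)) (pair-bound-ring p ε)
      (Exchange.exchange-≤ G m m≥0 κ₁ τ 0<κ₁ stable ε (p + ε) 0<ε ε≤1 τ-small′ lX (core-κ₁ c) lY (near-core₄ c X X⊆)
        (subst₂ _≤_ (E-sym Y (core c)) (cong ((p + ε) *_) (*-comm (μ Y) (μ (core c))))
          (Exchange.exchange-≤ G m m≥0 κ₁ τ 0<κ₁ stable ε p 0<ε ε≤1 τ-small′ lY (core-κ₁ d) (core-κ₁ c) (near-core₄ d Y Y⊆)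
            (subst₂ _≤_ (E-sym (core c) (core d)) (cong (p *_) (*-comm (μ (core c)) (μ (core d)))) cd))))

  -- X has density at most ρ to the core; exchanging the core for X, against X itself, bounds the
  -- density inside X by ρ + ε ≤ 2ε.
  diagonal-bound : ∀ c {X} → X ⊆ near c → E X X ≤ 3ℚ * ε
  diagonal-bound nothing {X} X⊆ = ≤-trans (empty X (λ v p → false≢true (X⊆ v p))) (nonneg! 3ℚ ⊗ 0≤ε)
    where
    false≢true : false ≡ true → ⊥
    false≢true ()
  diagonal-bound (just c) {X} X⊆ = subst (E X X ≤_) (diagonal-bound-ring₁ (μ X * μ X) ε)
    (bounded-pair {X} {X} {0ℚ} ≤-refl λ lX _ → ≤-trans
      (Exchange.exchange-≤ G m m≥0 κ₁ τ 0<κ₁ stable ε ρ 0<ε ε≤1 τ-small′ lX (core-κ₁ c) lX (near-core₄ c X X⊆)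
        (subst₂ _≤_ (E-sym X (core c)) (cong (ρ *_) (*-comm (μ X) (μ (core c)))) (near-core c X X⊆)))
      (lin (gap ρ≤ε ⊗ (μ-nonneg X ⊗ μ-nonneg X)) (diagonal-bound-ring ρ ε (μ X * μ X))))
    where
    ρ≤ε : ρ ≤ ε
    ρ≤ε = lin (nonneg! (+ 1 / 4) ⊗ gap ρ-small ⊕ nonneg! (+ 1 / 4) ⊗ (0≤ε ⊗ gap ε≤1) ⊕ nonneg! (+ 3 / 4) ⊗ 0≤ε) (ρ≤ε-ring ρ ε)

  E-peel : ∀ R B → E R R ≡ E (R ∩ B) (R ∩ B) + 2ℚ * E (R ∩ B) (R ∖ B) + E (R ∖ B) (R ∖ B)
  E-peel R B = trans (E-splitˡ R B R) (trans (cong₂ _+_ (E-splitʳ (R ∩ B) R B) (E-splitʳ (R ∖ B) R B))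
    (trans (cong (λ x → E (R ∩ B) (R ∩ B) + E (R ∩ B) (R ∖ B) + (x + E (R ∖ B) (R ∖ B))) (E-sym (R ∖ B) (R ∩ B)))
      (E-peel-ring (E (R ∩ B) (R ∩ B)) (E (R ∩ B) (R ∖ B)) (E (R ∖ B) (R ∖ B)))))

  -- p and q belong to the disjoint pairs xy and zw, the other coefficients to the pairs across.
  -- Renaming variables brings any of the three perfect matchings into this position.
  FormBound : (p q a b c d : ℚ) → Set
  FormBound p q a b c d = ∀ x y z w → 0ℚ ≤ x → 0ℚ ≤ y → 0ℚ ≤ z → 0ℚ ≤ w → x + y + z + w ≤ 1ℚ →
    2ℚ * (p * (x * y) + q * (z * w) + a * (x * z) + b * (x * w) + c * (y * z) + d * (y * w)) ≤ ½ + 3ℚ * ε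

  remove₁ : Maybe Center → Vset n
  remove₁ c₀ = full ∖ near c₀

  remove₂ : Maybe Center → Maybe Center → Vset n
  remove₂ c₀ c₁ = remove₁ c₀ ∖ near c₁

  remove₃ : Maybe Center → Maybe Center → Maybe Center → Vset n
  remove₃ c₀ c₁ c₂ = remove₂ c₀ c₁ ∖ near c₂

  remove₄ : Maybe Center → Maybe Center → Maybe Center → Maybe Center → Vset n
  remove₄ c₀ c₁ c₂ c₃ = remove₃ c₀ c₁ c₂ ∖ near c₃

  -- The vertices are split greedily: those near the first centre, those of the rest near the
  -- second, and so on, with remainder R. The constant is 53 = 4 · 3 + 2 · 6 · 3 + 3 + 2, from the
  -- four diagonal blocks, the six pairs of blocks, the quadratic form and the edges meeting R.
  conclude : ∀ c₀ c₁ c₂ c₃ {p q a b c d} → 0ℚ ≤ p → 0ℚ ≤ q → 0ℚ ≤ a → 0ℚ ≤ b → 0ℚ ≤ c → 0ℚ ≤ d →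
    Bounded c₀ c₁ p → Bounded c₂ c₃ q → Bounded c₀ c₂ a → Bounded c₀ c₃ b → Bounded c₁ c₂ c → Bounded c₁ c₃ d →
    FormBound p q a b c d → μ (remove₄ c₀ c₁ c₂ c₃) ≤ ε → E full full ≤ ½ + + 53 / 1 * ε
  conclude c₀ c₁ c₂ c₃ {p} {q} {a} {b} {c} {d} 0≤p 0≤q 0≤a 0≤b 0≤c 0≤d B₀₁ B₂₃ B₀₂ B₀₃ B₁₂ B₁₃ form rest =
    subst (_≤ ½ + + 53 / 1 * ε) (sym expansion)
      (lin (gap (diagonal-bound c₀ X₀⊆) ⊕ gap (diagonal-bound c₁ X₁⊆) ⊕ gap (diagonal-bound c₂ X₂⊆) ⊕ gap (diagonal-bound c₃ X₃⊆)
          ⊕ nonneg! 2ℚ ⊗ (gap (pair-bound c₀ c₁ 0≤p B₀₁ X₀⊆ X₁⊆) ⊕ gap (pair-bound c₂ c₃ 0≤q B₂₃ X₂⊆ X₃⊆)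
              ⊕ gap (pair-bound c₀ c₂ 0≤a B₀₂ X₀⊆ X₂⊆) ⊕ gap (pair-bound c₀ c₃ 0≤b B₀₃ X₀⊆ X₃⊆)
              ⊕ gap (pair-bound c₁ c₂ 0≤c B₁₂ X₁⊆ X₂⊆) ⊕ gap (pair-bound c₁ c₃ 0≤d B₁₃ X₁⊆ X₃⊆))
          ⊕ nonneg! 2ℚ ⊗ (gap (E≤ X₀ R) ⊕ gap (E≤ X₁ R) ⊕ gap (E≤ X₂ R) ⊕ gap (E≤ X₃ R)) ⊕ gap (E≤ R R)
          ⊕ gap (form x y z w (μ-nonneg X₀) (μ-nonneg X₁) (μ-nonneg X₂) (μ-nonneg X₃) sum≤1)
          ⊕ nonneg! 2ℚ ⊗ (μ-nonneg R ⊗ gap sum+r≤1) ⊕ nonneg! 2ℚ ⊗ gap rest ⊕ square-nonneg r)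
        (conclude-ring p q a b c d x y z w r ε (E X₀ X₀) (E X₁ X₁) (E X₂ X₂) (E X₃ X₃)
            (E X₀ X₁) (E X₂ X₃) (E X₀ X₂) (E X₀ X₃) (E X₁ X₂) (E X₁ X₃) (E X₀ R) (E X₁ R) (E X₂ R) (E X₃ R) (E R R)))
    where
    X₀ X₁ X₂ X₃ R : Vset n
    X₀ = full ∩ near c₀
    X₁ = remove₁ c₀ ∩ near c₁
    X₂ = remove₂ c₀ c₁ ∩ near c₂
    X₃ = remove₃ c₀ c₁ c₂ ∩ near c₃
    R = remove₄ c₀ c₁ c₂ c₃
    x = μ X₀
    y = μ X₁
    z = μ X₂
    w = μ X₃
    r = μ R
    X₀⊆ : X₀ ⊆ near c₀
    X₀⊆ v = ∧-snd {full {n} v}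
    X₁⊆ : X₁ ⊆ near c₁
    X₁⊆ v = ∧-snd {remove₁ c₀ v}
    X₂⊆ : X₂ ⊆ near c₂
    X₂⊆ v = ∧-snd {remove₂ c₀ c₁ v}
    X₃⊆ : X₃ ⊆ near c₃
    X₃⊆ v = ∧-snd {remove₃ c₀ c₁ c₂ v}
    total : x + (y + (z + (w + r))) ≡ 1ℚ
    total = sym (trans (sym mass) (trans (μ-split full (near c₀)) (cong (_+_ x) (trans (μ-split (remove₁ c₀) (near c₁))
      (cong (_+_ y) (trans (μ-split (remove₂ c₀ c₁) (near c₂)) (cong (_+_ z) (μ-split (remove₃ c₀ c₁ c₂) (near c₃)))))))))
    sum≤1 : x + y + z + w ≤ 1ℚ
    sum≤1 = subst (x + y + z + w ≤_) total (lin (μ-nonneg R) (sum≤1-ring x y z w r))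
    sum+r≤1 : x + y + z + w + r ≤ 1ℚ
    sum+r≤1 = ≤-reflexive (trans (sum+r≤1-ring x y z w r) total)
    expansion : E full full ≡
      E X₀ X₀ + 2ℚ * (E X₀ X₁ + (E X₀ X₂ + (E X₀ X₃ + E X₀ R)))
      + (E X₁ X₁ + 2ℚ * (E X₁ X₂ + (E X₁ X₃ + E X₁ R))
      + (E X₂ X₂ + 2ℚ * (E X₂ X₃ + E X₂ R)
      + (E X₃ X₃ + 2ℚ * E X₃ R + E R R)))
    expansion = trans (E-peel full (near c₀)) (cong₂ (λ s t → E X₀ X₀ + 2ℚ * s + t)
      (trans (E-splitʳ X₀ (remove₁ c₀) (near c₁)) (cong (_+_ (E X₀ X₁)) (trans (E-splitʳ X₀ (remove₂ c₀ c₁) (near c₂))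
        (cong (_+_ (E X₀ X₂)) (E-splitʳ X₀ (remove₃ c₀ c₁ c₂) (near c₃))))))
      (trans (E-peel (remove₁ c₀) (near c₁)) (cong₂ (λ s t → E X₁ X₁ + 2ℚ * s + t)
        (trans (E-splitʳ X₁ (remove₂ c₀ c₁) (near c₂)) (cong (_+_ (E X₁ X₂)) (E-splitʳ X₁ (remove₃ c₀ c₁ c₂) (near c₃))))
        (trans (E-peel (remove₂ c₀ c₁) (near c₂)) (cong₂ (λ s t → E X₂ X₂ + 2ℚ * s + t)
          (E-splitʳ X₂ (remove₃ c₀ c₁ c₂) (near c₃)) (E-peel (remove₃ c₀ c₁ c₂) (near c₃)))))))

  away : ∀ {c v} → not (near (just c) v) ≡ true → ρ * μ (core c) ≤ dg (core c) v
  away {c} {v} p = ≮⇒≥ (does-false (dg (core c) v <? ρ * μ (core c)) (not-true p))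

  0≤ρ = <⇒≤ 0<ρ

  0≤density : ∀ {c d} (l : Link c d) → 0ℚ ≤ density l
  0≤density l = ≤-trans 0≤ρ (lower l)

  bounded : ∀ {c d} (l : Link c d) → Bounded (just c) (just d) (density l)
  bounded l = ≤-reflexive (value l)

  0≤½+ε : 0ℚ ≤ ½ + ε
  0≤½+ε = nonneg! ½ ⊕ 0≤ε

  two-parts : ∀ {p} → p ≤ 1ℚ → FormBound p 0ℚ 0ℚ 0ℚ 0ℚ 0ℚ
  two-parts {p} p≤1 = Forms.matching-form ε 0≤ε ε≤½ p 0ℚ 0ℚ 0ℚ 0ℚ 0ℚ p≤1 (nonneg! 1ℚ) 0≤½+ε 0≤½+ε 0≤½+ε 0≤½+ε

  TriangleBound : ℚ → ℚ → ℚ → Set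
  TriangleBound p q r = ∀ x y z → 0ℚ ≤ x → 0ℚ ≤ y → 0ℚ ≤ z → x + y + z ≤ 1ℚ →
    2ℚ * (p * (x * y) + q * (x * z) + r * (y * z)) ≤ ½ + 3ℚ * ε

  triangle-rotate : ∀ p q r → TriangleBound q r p → TriangleBound p q r
  triangle-rotate p q r bound x y z 0≤x 0≤y 0≤z sum =
    subst (_≤ ½ + 3ℚ * ε) (triangle-rotate-ring₁ p q r x y z) (bound z x y 0≤z 0≤x 0≤y (subst (_≤ 1ℚ) (triangle-rotate-ring x y z) sum))

  triangle-swap : ∀ p q r → TriangleBound q p r → TriangleBound p q r
  triangle-swap p q r bound x y z 0≤x 0≤y 0≤z sum =
    subst (_≤ ½ + 3ℚ * ε) (triangle-swap-ring₁ p q r x y z) (bound x z y 0≤x 0≤z 0≤y (subst (_≤ 1ℚ) (triangle-swap-ring x y z) sum))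

  sorted-triangle : ∀ {a b c} (ab : Link a b) (ac : Link a c) (bc : Link b c) →
    density ac ≤ density ab → density ab ≤ density bc → TriangleBound (density ab) (density ac) (density bc)
  sorted-triangle ab ac bc q≤p p≤r = Forms.triangle-form ε 0≤ε ε≤½ (density ab) (density ac) (density bc) p≤r q≤p (upper bc)
    (link-triangle ab ac bc) (link-cherry ab ac bc)

  largest-last : ∀ {a b c} (ab : Link a b) (ac : Link a c) (bc : Link b c) →
    density ab ≤ density bc → density ac ≤ density bc → TriangleBound (density ab) (density ac) (density bc)
  largest-last ab ac bc p≤r q≤r = decide (≤-total (density ac) (density ab))
    where
    decide : density ac ≤ density ab ⊎ density ab ≤ density ac → TriangleBound (density ab) (density ac) (density bc)
    decide (inj₁ q≤p) = sorted-triangle ab ac bc q≤p p≤r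
    decide (inj₂ p≤q) = triangle-swap (density ab) (density ac) (density bc) (sorted-triangle ac ab (flip bc) p≤q q≤r)

  -- `triangle-form` wants the densities in the order q ≤ p ≤ r; renaming the parts achieves this.
  three-parts : ∀ {a b c} (ab : Link a b) (ac : Link a c) (bc : Link b c) → TriangleBound (density ab) (density ac) (density bc)
  three-parts ab ac bc = decide (≤-total (density ab) (density bc)) (≤-total (density ac) (density bc)) (≤-total (density ab) (density ac))
    where
    middle : density ab ≤ density ac → density bc ≤ density ac → TriangleBound (density ab) (density ac) (density bc)
    middle p≤q r≤q = triangle-rotate (density ab) (density ac) (density bc) (triangle-rotate (density ac) (density bc) (density ab) (largest-last bc (flip ab) (flip ac) r≤q p≤q))
    decide : density ab ≤ density bc ⊎ density bc ≤ density ab → density ac ≤ density bc ⊎ density bc ≤ density ac →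
      density ab ≤ density ac ⊎ density ac ≤ density ab → TriangleBound (density ab) (density ac) (density bc)
    decide (inj₁ p≤r) (inj₁ q≤r) _          = largest-last ab ac bc p≤r q≤r
    decide (inj₁ p≤r) (inj₂ r≤q) _          = middle (≤-trans p≤r r≤q) r≤q
    decide (inj₂ r≤p) _          (inj₁ p≤q) = middle p≤q (≤-trans r≤p p≤q)
    decide (inj₂ r≤p) _          (inj₂ q≤p) = triangle-rotate (density ab) (density ac) (density bc) (largest-last (flip ac) (flip bc) ab q≤p r≤p)

  small : ∀ {p} → ¬ Big p → p ≤ ½ + ε
  small ¬big = <⇒≤ (≰⇒> ¬big)

  pairing₁ : ∀ p q a b c d → FormBound a d p b c q → FormBound p q a b c d
  pairing₁ p q a b c d bound x y z w 0≤x 0≤y 0≤z 0≤w sum =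
    subst (_≤ ½ + 3ℚ * ε) (pairing₁-ring₁ p q a b c d x y z w) (bound x z y w 0≤x 0≤z 0≤y 0≤w (subst (_≤ 1ℚ) (pairing₁-ring x y z w) sum))

  pairing₂ : ∀ p q a b c d → FormBound b c p a d q → FormBound p q a b c d
  pairing₂ p q a b c d bound x y z w 0≤x 0≤y 0≤z 0≤w sum =
    subst (_≤ ½ + 3ℚ * ε) (pairing₂-ring₁ p q a b c d x y z w) (bound x w y z 0≤x 0≤w 0≤y 0≤z (subst (_≤ 1ℚ) (pairing₂-ring x y z w) sum))

  -- By `link-star`, none of four linked centres has two links of density at least 1/2 + ε, so the
  -- heavy links form a matching. It lies in one of the three perfect matchings, and `matching-form`
  -- applies after renaming.
  four-parts : ∀ {a b c d} (ab : Link a b) (cd : Link c d) (ac : Link a c) (ad : Link a d) (bc : Link b c) (bd : Link b d) →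
    FormBound (density ab) (density cd) (density ac) (density ad) (density bc) (density bd)
  four-parts {a} {b} {c} {d} ab cd ac ad bc bd =
    choose (½ + ε ≤? density ab) (½ + ε ≤? density ac) (½ + ε ≤? density ad) (½ + ε ≤? density bc) (½ + ε ≤? density bd)
    where
    ba = flip ab
    ca = flip ac
    da = flip ad
    cb = flip bc
    db = flip bd
    dc = flip cd
    straight : density ac ≤ ½ + ε → density ad ≤ ½ + ε → density bc ≤ ½ + ε → density bd ≤ ½ + ε →
      FormBound (density ab) (density cd) (density ac) (density ad) (density bc) (density bd)
    straight = Forms.matching-form ε 0≤ε ε≤½ (density ab) (density cd) (density ac) (density ad) (density bc) (density bd) (upper ab) (upper cd)
    crossed : density ab ≤ ½ + ε → density ad ≤ ½ + ε → density bc ≤ ½ + ε → density cd ≤ ½ + ε →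
      FormBound (density ab) (density cd) (density ac) (density ad) (density bc) (density bd)
    crossed p q r s = pairing₁ (density ab) (density cd) (density ac) (density ad) (density bc) (density bd)
      (Forms.matching-form ε 0≤ε ε≤½ (density ac) (density bd) (density ab) (density ad) (density bc) (density cd) (upper ac) (upper bd) p q r s)
    outer : density ab ≤ ½ + ε → density ac ≤ ½ + ε → density bd ≤ ½ + ε → density cd ≤ ½ + ε →
      FormBound (density ab) (density cd) (density ac) (density ad) (density bc) (density bd)
    outer p q r s = pairing₂ (density ab) (density cd) (density ac) (density ad) (density bc) (density bd)
      (Forms.matching-form ε 0≤ε ε≤½ (density ad) (density bc) (density ab) (density ac) (density bd) (density cd) (upper ad) (upper bc) p q r s)
    Goal : Set
    Goal = FormBound (density ab) (density cd) (density ac) (density ad) (density bc) (density bd)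
    choose : Dec (Big (density ab)) → Dec (Big (density ac)) → Dec (Big (density ad)) → Dec (Big (density bc)) → Dec (Big (density bd)) → Goal
    choose (yes big) _ _ _ _ = straight (small (link-star ab ac bc da db dc big)) (small (link-star ab ad bd ca cb cd big))
      (small (link-star ba bc ac db da dc big)) (small (link-star ba bd ad cb ca cd big))
    choose (no ¬ab) (yes big) _ _ _ = crossed (small ¬ab) (small (link-star ac ad cd ba bc bd big))
      (small (link-star ca cb ab dc da db big)) (small (link-star ca cd ad bc ba bd big))
    choose (no ¬ab) (no ¬ac) (yes big) _ _ = outer (small ¬ab) (small ¬ac)
      (small (link-star da db ab cd ca cb big)) (small (link-star da dc ac bd ba bc big))
    choose (no ¬ab) (no ¬ac) (no ¬ad) (yes big) _ = outer (small ¬ab) (small ¬ac)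
      (small (link-star bc bd cd ab ac ad big)) (small (link-star cb cd bd ac ab ad big))
    choose (no ¬ab) (no ¬ac) (no ¬ad) (no ¬bc) (yes big) = crossed (small ¬ab) (small ¬ad) (small ¬bc) (small (link-star db dc bc ad ab ac big))
    choose (no ¬ab) (no ¬ac) (no ¬ad) (no ¬bc) (no ¬bd) = straight (small ¬ac) (small ¬ad) (small ¬bc) (small ¬bd)

  five-parts : ∀ {a b c d f} → Link a b → Link a c → Link a d → Link a f → Link b c → Link b d → Link b f →
    Link c d → Link c f → Link d f → ⊥
  five-parts {a} {b} {c} {d} {f} ab ac ad af bc bd bf cd cf df = Finders.no-five-parts G m m≥0 λ′ β κ₁ κ₀ 0<λ 0<β β≤1 λ-small 0<κ₁ κ₀≤κ₁ κ₀-small triangle five noK8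
    parts big linked
    where
    pick : Fin 5 → Center
    pick zero = a
    pick (suc zero) = b
    pick (suc (suc zero)) = c
    pick (suc (suc (suc zero))) = d
    pick (suc (suc (suc (suc zero)))) = f
    parts : Fin 5 → Vset n
    parts i = core (pick i)
    big : ∀ i → κ₁ ≤ λ′ * μ (parts i)
    big i = core-large (pick i)
    links : ∀ i k → i ≢ k → Link (pick i) (pick k)
    links zero zero ne = ⊥-elim (ne refl)
    links zero (suc zero) _ = ab
    links zero (suc (suc zero)) _ = ac
    links zero (suc (suc (suc zero))) _ = ad
    links zero (suc (suc (suc (suc zero)))) _ = af
    links (suc zero) (suc zero) ne = ⊥-elim (ne refl)
    links (suc zero) (suc (suc zero)) _ = bc
    links (suc zero) (suc (suc (suc zero))) _ = bd
    links (suc zero) (suc (suc (suc (suc zero)))) _ = bf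
    links (suc (suc zero)) (suc (suc zero)) ne = ⊥-elim (ne refl)
    links (suc (suc zero)) (suc (suc (suc zero))) _ = cd
    links (suc (suc zero)) (suc (suc (suc (suc zero)))) _ = cf
    links (suc (suc (suc zero))) (suc (suc (suc zero))) ne = ⊥-elim (ne refl)
    links (suc (suc (suc zero))) (suc (suc (suc (suc zero)))) _ = df
    links (suc (suc (suc (suc zero)))) (suc (suc (suc (suc zero)))) ne = ⊥-elim (ne refl)
    links (suc zero) zero _ = flip ab
    links (suc (suc zero)) zero _ = flip ac
    links (suc (suc (suc zero))) zero _ = flip ad
    links (suc (suc (suc (suc zero)))) zero _ = flip af
    links (suc (suc zero)) (suc zero) _ = flip bc
    links (suc (suc (suc zero))) (suc zero) _ = flip bd
    links (suc (suc (suc (suc zero)))) (suc zero) _ = flip bf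
    links (suc (suc (suc zero))) (suc (suc zero)) _ = flip cd
    links (suc (suc (suc (suc zero)))) (suc (suc zero)) _ = flip cf
    links (suc (suc (suc (suc zero)))) (suc (suc (suc zero))) _ = flip df
    linked : ∀ i k → i ≢ k → Regular λ′ β (parts i) (parts k)
    linked i k ne = regular-β (links i k ne)

  Goal : Set
  Goal = E full full ≤ ½ + + 53 / 1 * ε

  leftover : ∀ R → (ε ≤ μ R → Goal) → (μ R ≤ ε → Goal) → Goal
  leftover R more done = decide (ε ≤? μ R)
    where
    decide : Dec (ε ≤ μ R) → Goal
    decide (yes p) = more p
    decide (no ¬p) = done (<⇒≤ (≰⇒> ¬p))

  remove-nothing : ∀ {R} → (R ∖ near nothing) ⊆ R
  remove-nothing v = ∧-fst

  -- A remainder of measure at least ε would contain a fifth centre, linked to the other four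
  -- because it avoids all vertices near them.
  with-four : ∀ {a b c d} → Link a b → Link a c → Link a d → Link b c → Link b d → Link c d → Goal
  with-four {a} {b} {c} {d} ab ac ad bc bd cd = leftover (remove₄ (just a) (just b) (just c) (just d))
    (λ more → let f , f⊆ = new-center _ more in ⊥-elim (five-parts ab ac ad
      (far a f (λ v p → away {a} {v} (∧-snd {true} (∧-fst (∧-fst (∧-fst (f⊆ v p)))))))
      bc bd (far b f (λ v p → away {b} {v} (∧-snd {remove₁ (just a) v} (∧-fst (∧-fst (f⊆ v p))))))
      cd (far c f (λ v p → away {c} {v} (∧-snd {remove₂ (just a) (just b) v} (∧-fst (f⊆ v p)))))
      (far d f (λ v p → away {d} {v} (∧-snd {remove₃ (just a) (just b) (just c) v} (f⊆ v p))))))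
    (conclude (just a) (just b) (just c) (just d) (0≤density ab) (0≤density cd) (0≤density ac) (0≤density ad) (0≤density bc) (0≤density bd)
      (bounded ab) (bounded cd) (bounded ac) (bounded ad) (bounded bc) (bounded bd) (four-parts ab cd ac ad bc bd))

  with-three : ∀ {a b c} → Link a b → Link a c → Link b c → Goal
  with-three {a} {b} {c} ab ac bc = leftover (remove₃ (just a) (just b) (just c))
    (λ more → let d , d⊆ = new-center _ more in with-four ab ac
      (far a d (λ v p → away {a} {v} (∧-snd {true} (∧-fst (∧-fst (d⊆ v p))))))
      bc (far b d (λ v p → away {b} {v} (∧-snd {remove₁ (just a) v} (∧-fst (d⊆ v p)))))
      (far c d (λ v p → away {c} {v} (∧-snd {remove₂ (just a) (just b) v} (d⊆ v p)))))
    (λ done → conclude (just a) (just b) (just c) nothing {density ab} {0ℚ} {density ac} {0ℚ} {density bc} {0ℚ}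
      (0≤density ab) ≤-refl (0≤density ac) ≤-refl (0≤density bc) ≤-refl
      (bounded ab) tt (bounded ac) tt (bounded bc) tt
      (λ x y z w 0≤x 0≤y 0≤z 0≤w sum → subst (_≤ ½ + 3ℚ * ε) (with-three-ring₁ (density ab) (density ac) (density bc) x y z w)
        (three-parts ab ac bc x y z 0≤x 0≤y 0≤z (≤-trans (lin 0≤w (with-three-ring x y z w)) sum)))
      (≤-trans (μ-mono (remove-nothing {remove₃ (just a) (just b) (just c)})) done))

  with-two : ∀ {a b} → Link a b → Goal
  with-two {a} {b} ab = leftover (remove₂ (just a) (just b))
    (λ more → let c , c⊆ = new-center _ more in with-three ab
      (far a c (λ v p → away {a} {v} (∧-snd {true} (∧-fst (c⊆ v p)))))
      (far b c (λ v p → away {b} {v} (∧-snd {remove₁ (just a) v} (c⊆ v p)))))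
    (λ done → conclude (just a) (just b) nothing nothing {density ab} {0ℚ} {0ℚ} {0ℚ} {0ℚ} {0ℚ}
      (0≤density ab) ≤-refl ≤-refl ≤-refl ≤-refl ≤-refl (bounded ab) tt tt tt tt tt (two-parts (upper ab))
      (≤-trans (μ-mono (⊆-trans (remove-nothing {remove₃ (just a) (just b) nothing}) (remove-nothing {remove₂ (just a) (just b)}))) done))

  structure : Goal
  structure = leftover full (λ more → let a , _ = new-center full more in with-one a)
    (λ done → ⊥-elim (absurd (≤-trans done ε≤½) (subst (½ <_) (sym mass) (gap⁻ (positive! ½)))))
    where
    gap⁻ : 0ℚ < ½ → ½ < 1ℚ
    gap⁻ p = lin< p refl
    with-one : Center → Goal
    with-one a = leftover (remove₁ (just a))
      (λ more → let b , b⊆ = new-center _ more in with-two (far a b (λ v p → away {a} {v} (∧-snd {true} (b⊆ v p)))))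
      (λ done → conclude (just a) nothing nothing nothing {0ℚ} {0ℚ} {0ℚ} {0ℚ} {0ℚ} {0ℚ}
        ≤-refl ≤-refl ≤-refl ≤-refl ≤-refl ≤-refl tt tt tt tt tt tt (two-parts (nonneg! 1ℚ))
        (≤-trans (μ-mono (⊆-trans (remove-nothing {remove₃ (just a) nothing nothing})
          (⊆-trans (remove-nothing {remove₂ (just a) nothing}) (remove-nothing {remove₁ (just a)})))) done))

minimum : ∀ {a b} → 0ℚ < a → 0ℚ < b → Σ ℚ λ d → 0ℚ < d × d ≤ a × d ≤ b
minimum {a} {b} p q with ≤-total a b
... | inj₁ a≤b = a , p , ≤-refl , a≤b
... | inj₂ b≤a = b , q , b≤a , ≤-refl

scales-ring : ∀ x y → 8ℚ * (x * (y * (+ 1 / 8))) ≡ x * y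
scales-ring = solve-∀ ℚ-ring

scales-ring₁ : ∀ x → + 5 / 1 * (x * (+ 1 / 5)) ≡ x
scales-ring₁ = solve-∀ ℚ-ring

scales-ring₂ : ∀ x → x - (x * x * (+ 1 / 4) * ½ + + 15 / 1 * (x * x * (+ 1 / 4) * (+ 1 / 30))) ≡ x * (½ - x) * (+ 1 / 4) + + 7 / 8 * x
scales-ring₂ = solve-∀ ℚ-ring

scales-ring₃ : ∀ r → r - (r * ½ + 3ℚ * (r * (+ 1 / 30))) ≡ + 2 / 5 * r
scales-ring₃ = solve-∀ ℚ-ring

scales-ring₄ : ∀ x → 4ℚ * (x * (+ 1 / 4)) ≡ x
scales-ring₄ = solve-∀ ℚ-ring

-- The factor 1/30 gives β + 15 e = ρ ≤ ε, where 15 e = 2 · 3e + 3 · 3e is what regularity loses in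
-- the condition on 2p + 3r. From λ′ on, every constant is the largest that its constraints allow.
scales : ∀ ε → 0ℚ < ε → ε ≤ ½ → Scales ε
scales ε 0<ε ε≤½ = record
  { ρ = ρ ; e = e ; β = β ; λ′ = λ′ ; ν = ν ; κ = κ ; κ₁ = κ₁ ; κ₀ = proj₁ κ₀ ; τ = τ
  ; 0<ε = 0<ε ; ε≤½ = ε≤½ ; 0<ρ = 0<ρ
  ; ρ-small = ≤-reflexive (scales-ring₄ (ε * ε))
  ; 0<e = 0<e ; 0<β = 0<β
  ; β≤ρ = lin (nonneg! (+ 2 / 5) ⊗ <⇒≤ 0<ρ) (scales-ring₃ ρ)
  ; β≤ε = lin (<⇒≤ 0<ε ⊗ gap ε≤½ ⊗ nonneg! (+ 1 / 4) ⊕ nonneg! (+ 7 / 8) ⊗ <⇒≤ 0<ε) (scales-ring₂ ε)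
  ; 0<λ = 0<λ
  ; λ-small = ≤-reflexive (scales-ring₁ (β ^ 3))
  ; 0<ν = 0<ν
  ; ν-small = ≤-reflexive (scales-ring₄ (e * e * λ′))
  ; κ-small = ≤-refl
  ; 0<κ₁ = 0<κ₁ ; κ₁-small = ≤-refl
  ; 0<κ₀ = proj₁ (proj₂ κ₀) ; κ₀≤κ₁ = proj₁ (proj₂ (proj₂ κ₀)) ; κ₀-small = proj₂ (proj₂ (proj₂ κ₀))
  ; 0<τ = (0<e ⊗⁺ 0<e) ⊗⁺ ((0<κ₁ ⊗⁺ 0<κ₁) ⊗⁺ positive! (+ 1 / 8))
  ; τ-small = ≤-reflexive (scales-ring (e * e) (κ₁ * κ₁))
  }
  where
  ρ e β λ′ ν κ κ₁ τ : ℚ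
  ρ = ε * ε * (+ 1 / 4)
  e = ρ * (+ 1 / 30)
  β = ρ * ½
  λ′ = β ^ 3 * (+ 1 / 5)
  ν = e * e * λ′ * (+ 1 / 4)
  κ = ν ^ 8 * ε
  κ₁ = λ′ * κ
  τ = e * e * (κ₁ * κ₁ * (+ 1 / 8))
  0<ρ : 0ℚ < ρ
  0<ρ = (0<ε ⊗⁺ 0<ε) ⊗⁺ positive! (+ 1 / 4)
  0<e : 0ℚ < e
  0<e = 0<ρ ⊗⁺ positive! (+ 1 / 30)
  0<β : 0ℚ < β
  0<β = 0<ρ ⊗⁺ positive! ½
  0<λ : 0ℚ < λ′
  0<λ = ^-pos 0<β 3 ⊗⁺ positive! (+ 1 / 5)
  0<ν : 0ℚ < ν
  0<ν = ((0<e ⊗⁺ 0<e) ⊗⁺ 0<λ) ⊗⁺ positive! (+ 1 / 4)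
  0<κ₁ : 0ℚ < κ₁
  0<κ₁ = 0<λ ⊗⁺ (^-pos 0<ν 8 ⊗⁺ 0<ε)
  κ₀ = minimum 0<κ₁ (0<β ⊗⁺ (0<κ₁ ⊗⁺ 0<κ₁))

-- Spread-out weights and the density decrement

below-ℕ : ∀ q → Σ ℕ λ k → q ≤ fromℕ k
below-ℕ q@(mkℚ n d c) = ℤ.∣ n ∣ , toℚᵘ-cancel-≤ (ℚᵘ.≤-respʳ-≃ (ℚᵘ.≃-sym (toℚᵘ-fromℚᵘ (mkℚᵘ (+ ℤ.∣ n ∣) 0))) (ℚᵘ.*≤* bound))
  where
  bound : n ℤ.* + 1 ℤ.≤ + ℤ.∣ n ∣ ℤ.* + suc d
  bound = ℤ.≤-trans (ℤ.≤-reflexive (ℤ.*-identityʳ n)) (ℤ.≤-trans (below n)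
    (ℤ.≤-trans (ℤ.≤-reflexive (sym (ℤ.*-identityʳ (+ ℤ.∣ n ∣)))) (ℤ.*-monoˡ-≤-nonNeg (+ ℤ.∣ n ∣) (ℤ.+≤+ (ℕ.s≤s ℕ.z≤n)))))
    where
    below : ∀ i → i ℤ.≤ + ℤ.∣ i ∣
    below (+ k)      = ℤ.≤-refl
    below ℤ.-[1+ k ] = ℤ.-≤+

archimedean-ring : ∀ k x y i → k * x - y * (x * i) ≡ (k - y * i) * x
archimedean-ring = solve-∀ ℚ-ring

archimedean : ∀ x → 0ℚ < x → ∀ y → Σ ℕ λ k → y ≤ fromℕ k * x
archimedean x 0<x y = proj₁ found , lin (gap (proj₂ found) ⊗ <⇒≤ 0<x)
    (trans (cong (λ o → fromℕ (proj₁ found) * x - o) (trans (sym (*-identityʳ y)) (cong (y *_) (sym (proj₁ (proj₂ inv))))))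
      (archimedean-ring (fromℕ (proj₁ found)) x y (proj₁ inv)))
  where
  inv = inverse x 0<x
  found = below-ℕ (y * proj₁ inv)

ones : ∀ {n} → Fin n → ℚ
ones _ = 1ℚ

module Count {n : ℕ} (G : Graph n) = Measure G ones (λ _ → nonneg! 1ℚ)

-- The interface between the independence number and the density argument. The thresholds refer to
-- the counting measure, so that they serve all spread-out weights at once.
record Good {n : ℕ} (δ : ℚ) (G : Graph n) : Set where
  field
    triangles : ∀ X → δ * fromℕ n ≤ Count.μ G X → Clique G 3 X
    fives     : ∀ X Y → δ * (fromℕ n * fromℕ n) ≤ Count.E G X Y →
                Σ (Clique G 2 X) λ c → Clique G 3 (nbhds G (members c) Y)
    noK8      : ¬ Clique G 8 full

0≤fromℕ : ∀ n → 0ℚ ≤ fromℕ n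
0≤fromℕ n = fromℕ-mono {0} {n} ℕ.z≤n

good-mono : ∀ {n δ δ′} {G : Graph n} → δ ≤ δ′ → Good δ G → Good δ′ G
good-mono {n} {δ} {δ′} δ≤δ′ good = record
  { triangles = λ X p → Good.triangles good X (≤-trans (scale (0≤fromℕ n)) p)
  ; fives     = λ X Y p → Good.fives good X Y (≤-trans (scale (0≤fromℕ n ⊗ 0≤fromℕ n)) p)
  ; noK8      = Good.noK8 good
  }
  where
  scale : ∀ {a} → 0ℚ ≤ a → δ * a ≤ δ′ * a
  scale {a} p = *-monoʳ-≤-nonNeg a {{nonNegative p}} δ≤δ′

inner-ring : ∀ N K f a b → K * (f * b) - N * (f * a) ≡ f * (K * b - N * a)
inner-ring = solve-∀ ℚ-ring

form-transfer-ring : ∀ N K b → K * (N * b) ≡ N * K * b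
form-transfer-ring = solve-∀ ℚ-ring

form-transfer-ring₁ : ∀ N K a b → N * K * b - N * N * a ≡ N * (K * b - N * a)
form-transfer-ring₁ = solve-∀ ℚ-ring

I-transfer-ring : ∀ N K m f → K * (1ℚ * f) - N * (m * f) ≡ (K - m * N) * f
I-transfer-ring = solve-∀ ℚ-ring

-- The weight m is at most K/n times the counting measure, so what is large for m has linearly many
-- vertices or quadratically many edges.
module Transfer {n : ℕ} (G : Graph n) (m : Fin n → ℚ) (m≥0 : ∀ v → 0ℚ ≤ m v) (K : ℚ) (0≤K : 0ℚ ≤ K)
  (spread : ∀ v → m v * fromℕ n ≤ K) where
  private
    module M = Measure G m m≥0
    module C = Count G
    N = fromℕ n

  opaque
    unfolding M.I M.deg M.⟨_,_⟩ M.μ M.E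

    I-transfer : ∀ {f} → (∀ v → 0ℚ ≤ f v) → N * M.I f ≤ K * C.I f
    I-transfer {f} p = subst₂ _≤_ (∑-* N _) (∑-* K _)
      (∑-mono (λ v → lin (gap (spread v) ⊗ p v) (I-transfer-ring N K (m v) (f v))))

    deg-transfer : ∀ {f} u → (∀ v → 0ℚ ≤ f v) → N * M.deg f u ≤ K * C.deg f u
    deg-transfer u p = I-transfer (λ v → p v ⊗ χ-nonneg (adj G u v))

    form-transfer : ∀ {f g} → (∀ v → 0ℚ ≤ f v) → (∀ v → 0ℚ ≤ g v) → N * N * M.⟨ f , g ⟩ ≤ K * K * C.⟨ f , g ⟩
    form-transfer {f} {g} p q = ≤-trans
      (lin (0≤fromℕ n ⊗ gap (I-transfer {λ u → f u * M.deg g u} (λ u → p u ⊗ M.deg-nonneg u q))) (form-transfer-ring₁ N K M.⟨ f , g ⟩ (C.I (λ u → f u * M.deg g u))))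
      (subst₂ _≤_ (form-transfer-ring N K (C.I (λ u → f u * M.deg g u))) (sym (*-assoc K K C.⟨ f , g ⟩)) (*-monoˡ-≤-nonNeg K {{nonNegative 0≤K}} inner))
      where
      inner : N * C.I (λ u → f u * M.deg g u) ≤ K * C.⟨ f , g ⟩
      inner = subst₂ _≤_ (C.I-* N (λ u → f u * M.deg g u)) (C.I-* K (λ u → f u * C.deg g u))
        (C.I-mono {λ u → N * (f u * M.deg g u)} {λ u → K * (f u * C.deg g u)}
          (λ u → lin (p u ⊗ gap (deg-transfer {g} u q)) (inner-ring N K (f u) (M.deg g u) (C.deg g u))))

    μ-transfer : ∀ X → N * M.μ X ≤ K * C.μ X
    μ-transfer X = I-transfer (M.χ-nn X)

    E-transfer : ∀ X Y → N * N * M.E X Y ≤ K * K * C.E X Y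
    E-transfer X Y = form-transfer (M.χ-nn X) (M.χ-nn Y)

𝟙 : ∀ {n} → Fin n → ℚ
𝟙 v = χ (full v)

module Reweight {n : ℕ} (G : Graph n) (m : Fin n → ℚ) (m≥0 : ∀ v → 0ℚ ≤ m v) (f : Fin n → ℚ) (f≥0 : ∀ v → 0ℚ ≤ f v) where
  private
    module M = Measure G m m≥0

  w : Fin n → ℚ
  w v = m v * f v

  w≥0 : ∀ v → 0ℚ ≤ w v
  w≥0 v = m≥0 v ⊗ f≥0 v

  private
    module W = Measure G w w≥0

  opaque
    unfolding M.I M.deg M.⟨_,_⟩ M.μ M.E

    I-reweight : ∀ h → W.I h ≡ M.I (λ v → f v * h v)
    I-reweight h = ∑-cong (λ v → *-assoc (m v) (f v) (h v))

    μ-reweight : W.μ full ≡ M.I f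
    μ-reweight = trans (I-reweight 𝟙) (M.I-cong (λ v → *-identityʳ (f v)))

    E-reweight : W.E full full ≡ M.⟨ f , f ⟩
    E-reweight = trans (I-reweight _) (M.I-cong (λ u → cong (f u *_) (trans (*-identityˡ _)
      (trans (I-reweight _) (M.I-cong (λ v → cong (f v *_) (*-identityˡ (χ (adj G u v)))))))))

WeightBound : ℚ → ℚ → ∀ {n} → Graph n → Set
WeightBound D K {n} G = ∀ (w : Fin n → ℚ) (w≥0 : ∀ v → 0ℚ ≤ w v) → let open Measure G w w≥0 in
  (∀ v → w v * fromℕ n ≤ K * μ full) → E full full ≤ D * (μ full * μ full)

-- K is quantified inside the bound, so that the proof of the next bound at K may use this one at 3
-- K.
EdgeBound : ℚ → Set
EdgeBound D = ∀ K → 1ℚ ≤ K → Σ ℚ λ δ → 0ℚ < δ × (∀ {n} (G : Graph n) → Good δ G → WeightBound D K G)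

trivial-bound-ring : ∀ D a → D * a - a ≡ (D - 1ℚ) * a
trivial-bound-ring = solve-∀ ℚ-ring

trivial-bound : ∀ {D} → 1ℚ ≤ D → EdgeBound D
trivial-bound {D} 1≤D K _ = 1ℚ , positive! 1ℚ , λ G _ w w≥0 _ → let open Measure G w w≥0 in
  ≤-trans (E≤ full full) (lin (gap 1≤D ⊗ (μ-nonneg full ⊗ μ-nonneg full)) (trivial-bound-ring D (μ full * μ full)))

w-spread-ring : ∀ K m N W x → 3ℚ * K * W - m * (1ℚ * 1ℚ + x) * N ≡
  + 3 / 2 * (K - m * N) + (+ 3 / 2 - (1ℚ + x)) * (m * N) + 3ℚ * (K * (W - ½))
w-spread-ring = solve-∀ ℚ-ring

lemma₁-ring : ∀ d j x → d * (x * j * (x * j)) ≡ j * j * (d * (x * x))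
lemma₁-ring = solve-∀ ℚ-ring

m-spread-ring : ∀ K μ j w N → K * (μ * j) - w * (j * 1ℚ) * N ≡ j * (K * μ - w * N)
m-spread-ring = solve-∀ ℚ-ring

perturbation-ring : ∀ D D′ τ e x q i → i * i + τ - q ≡
  2ℚ * (D * ((1ℚ + ½ * i) * (1ℚ + ½ * i)) - (1ℚ * 1ℚ * e + (1ℚ + 1ℚ) * (1ℚ * ½) * x + ½ * ½ * q))
  + 2ℚ * (D * ((1ℚ + -½ * i) * (1ℚ + -½ * i)) - (1ℚ * 1ℚ * e + (1ℚ + 1ℚ) * (1ℚ * -½) * x + -½ * -½ * q))
  + 4ℚ * (e - D′) + 4ℚ * (D′ - (D - + 1 / 4 * τ)) + (1ℚ - D) * (i * i)
perturbation-ring = solve-∀ ℚ-ring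

minus-upper-ring : ∀ x → + 3 / 2 - (1ℚ + -½ * x) ≡ ½ * (x - - 1ℚ)
minus-upper-ring = solve-∀ ℚ-ring

minus-lower-ring : ∀ x → 1ℚ + -½ * x - ½ ≡ ½ * (1ℚ - x)
minus-lower-ring = solve-∀ ℚ-ring

plus-upper-ring : ∀ x → + 3 / 2 - (1ℚ + ½ * x) ≡ ½ * (1ℚ - x)
plus-upper-ring = solve-∀ ℚ-ring

plus-lower-ring : ∀ x → 1ℚ + ½ * x - ½ ≡ ½ * (x - - 1ℚ)
plus-lower-ring = solve-∀ ℚ-ring

massless-ring : ∀ d → 0ℚ * 0ℚ ≡ d * (0ℚ * 0ℚ)
massless-ring = solve-∀ ℚ-ring

five-ring : ∀ d k K N e c → K * K * c - K * K * (d * (N * N)) ≡ (K * K * c - N * N * e) + N * N * (e - k) + N * N * (k - d * (K * K))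
five-ring = solve-∀ ℚ-ring

triangle-ring : ∀ d k K N e c → K * K * c - K * K * (d * N) ≡ K * (K * c - N * e) + K * (N * (e - k)) + K * (N * (k - d * (K * K)))
  + (K - 1ℚ) * (K * K * (N * d))
triangle-ring = solve-∀ ℚ-ring

module Improve {ε : ℚ} (S : Scales ε) (D D′ : ℚ) (D≤1 : D ≤ 1ℚ) (close : D - + 1 / 4 * Scales.τ S ≤ D′)
  (target : ½ + + 53 / 1 * ε ≤ D′) (K : ℚ) (1≤K : 1ℚ ≤ K) (δ : ℚ)
  (bound : ∀ {n} (G : Graph n) → Good δ G → WeightBound D (3ℚ * K) G)
  (δ′ : ℚ) (0<δ′ : 0ℚ < δ′) (δ′-small : δ′ * (K * K) ≤ Scales.κ₀ S) {n : ℕ} (G : Graph n) (good : Good δ G) (good′ : Good δ′ G) where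
  open Scales S

  0<K : 0ℚ < K
  0<K = <-≤-trans (positive! 1ℚ) 1≤K

  module Unit (m : Fin n → ℚ) (m≥0 : ∀ v → 0ℚ ≤ m v) (mass : Measure.μ G m m≥0 full ≡ 1ℚ) (spread : ∀ v → m v * fromℕ n ≤ K) where
    open Measure G m m≥0
    open Transfer G m m≥0 K (<⇒≤ 0<K) spread

    N = fromℕ n

    mass-I : I 𝟙 ≡ 1ℚ
    mass-I = trans (sym (μ-def full)) mass

    triangle : ∀ X → κ₀ ≤ μ X → Clique G 3 X
    triangle X large = Good.triangles good′ X (cancel-≤ (0<K ⊗⁺ 0<K)
      (lin (<⇒≤ 0<K ⊗ gap (μ-transfer X) ⊕ <⇒≤ 0<K ⊗ (0≤fromℕ n ⊗ gap large) ⊕ <⇒≤ 0<K ⊗ (0≤fromℕ n ⊗ gap δ′-small)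
          ⊕ gap 1≤K ⊗ ((<⇒≤ 0<K ⊗ <⇒≤ 0<K) ⊗ (0≤fromℕ n ⊗ <⇒≤ 0<δ′)))
        (triangle-ring δ′ κ₀ K N (μ X) (Count.μ G X))))

    five : ∀ X Y → κ₀ ≤ E X Y → Σ (Clique G 2 X) λ c → Clique G 3 (nbhds G (members c) Y)
    five X Y large = Good.fives good′ X Y (cancel-≤ (0<K ⊗⁺ 0<K)
      (lin (gap (E-transfer X Y) ⊕ (0≤fromℕ n ⊗ 0≤fromℕ n) ⊗ gap large ⊕ (0≤fromℕ n ⊗ 0≤fromℕ n) ⊗ gap δ′-small)
        (five-ring δ′ κ₀ K N (E X Y) (Count.E G X Y))))

    module Perturb (g : Fin n → ℚ) (lower : ∀ v → - 1ℚ ≤ g v) (upper : ∀ v → g v ≤ 1ℚ) where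

      I≥-1 : - 1ℚ ≤ I g
      I≥-1 = subst (_≤ I g) (trans (I-* (- 1ℚ) 𝟙) (cong (- 1ℚ *_) mass-I)) (I-mono (λ v → lower v))

      I≤1 : I g ≤ 1ℚ
      I≤1 = subst (I g ≤_) mass-I (I-mono (λ v → upper v))

      -- Used with s = 1/2 and s = -1/2. The two bounds on 1 + s x are applied both to the values of
      -- g and to its mean, which also lies between -1 and 1.
      module Side (s : ℚ) (g-lower : ∀ x → - 1ℚ ≤ x → x ≤ 1ℚ → ½ ≤ 1ℚ + s * x) (g-upper : ∀ x → - 1ℚ ≤ x → x ≤ 1ℚ → 1ℚ + s * x ≤ + 3 / 2) where

        f : Fin n → ℚ
        f v = 1ℚ * 𝟙 v + s * g v

        f≥½ : ∀ v → ½ ≤ f v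
        f≥½ v = g-lower (g v) (lower v) (upper v)

        f≥0 : ∀ v → 0ℚ ≤ f v
        f≥0 v = ≤-trans (nonneg! ½) (f≥½ v)

        w : Fin n → ℚ
        w = Reweight.w G m m≥0 f f≥0

        w≥0 : ∀ v → 0ℚ ≤ w v
        w≥0 = Reweight.w≥0 G m m≥0 f f≥0

        I-f : I f ≡ 1ℚ + s * I g
        I-f = trans (I-linear 1ℚ s 𝟙 g) (cong (_+ s * I g) (trans (*-identityˡ _) mass-I))

        W≥½ : ½ ≤ I f
        W≥½ = subst (½ ≤_) (sym I-f) (g-lower (I g) I≥-1 I≤1)

        w-spread : ∀ v → w v * N ≤ 3ℚ * K * Measure.μ G w w≥0 full
        w-spread v = subst (λ W → w v * N ≤ 3ℚ * K * W) (sym (Reweight.μ-reweight G m m≥0 f f≥0))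
          (lin (nonneg! (+ 3 / 2) ⊗ gap (spread v) ⊕ gap (g-upper (g v) (lower v) (upper v)) ⊗ (m≥0 v ⊗ 0≤fromℕ n)
              ⊕ nonneg! 3ℚ ⊗ (<⇒≤ 0<K ⊗ gap W≥½)) (w-spread-ring K (m v) N (I f) (s * g v)))

        side-bound : 1ℚ * 1ℚ * E full full + (1ℚ + 1ℚ) * (1ℚ * s) * ⟨ 𝟙 , g ⟩ + s * s * ⟨ g , g ⟩ ≤ D * ((1ℚ + s * I g) * (1ℚ + s * I g))
        side-bound = subst₂ _≤_
          (trans (Reweight.E-reweight G m m≥0 f f≥0) (trans (form-square 1ℚ s 𝟙 g)
            (cong (λ x → 1ℚ * 1ℚ * x + (1ℚ + 1ℚ) * (1ℚ * s) * ⟨ 𝟙 , g ⟩ + s * s * ⟨ g , g ⟩) (sym (E-def full full)))))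
          (cong (λ x → D * (x * x)) (trans (Reweight.μ-reweight G m m≥0 f f≥0) I-f))
          (bound G good w w≥0 w-spread)

      plus-lower : ∀ x → - 1ℚ ≤ x → x ≤ 1ℚ → ½ ≤ 1ℚ + ½ * x
      plus-lower x p q = lin (nonneg! ½ ⊗ gap p) (plus-lower-ring x)

      plus-upper : ∀ x → - 1ℚ ≤ x → x ≤ 1ℚ → 1ℚ + ½ * x ≤ + 3 / 2
      plus-upper x p q = lin (nonneg! ½ ⊗ gap q) (plus-upper-ring x)

      minus-lower : ∀ x → - 1ℚ ≤ x → x ≤ 1ℚ → ½ ≤ 1ℚ + -½ * x
      minus-lower x p q = lin (nonneg! ½ ⊗ gap q) (minus-lower-ring x)

      minus-upper : ∀ x → - 1ℚ ≤ x → x ≤ 1ℚ → 1ℚ + -½ * x ≤ + 3 / 2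
      minus-upper x p q = lin (nonneg! ½ ⊗ gap p) (minus-upper-ring x)

      -- Adding the bounds for 1 + g/2 and 1 - g/2 cancels the linear terms.
      perturbation : D′ ≤ E full full → ⟨ g , g ⟩ ≤ I g * I g + τ
      perturbation large = lin
        (nonneg! 2ℚ ⊗ gap (Side.side-bound ½ plus-lower plus-upper) ⊕ nonneg! 2ℚ ⊗ gap (Side.side-bound -½ minus-lower minus-upper) ⊕ nonneg! 4ℚ ⊗ gap large ⊕ nonneg! 4ℚ ⊗ gap close
          ⊕ gap D≤1 ⊗ square-nonneg (I g))
        (perturbation-ring D D′ τ (E full full) ⟨ 𝟙 , g ⟩ ⟨ g , g ⟩ (I g))

    unit-bound : E full full ≤ D′
    unit-bound = decide (E full full ≤? D′)
      where
      decide : Dec (E full full ≤ D′) → E full full ≤ D′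
      decide (yes p) = p
      -- A density above D′ ≥ D - τ/4 makes m nearly optimal and hence stable; its structure then
      -- gives at most 1/2 + 53 ε ≤ D′ after all.
      decide (no ¬p) = ≤-trans (Structure.structure G m m≥0 ε S mass
        (λ g l u → Perturb.perturbation g l u (<⇒≤ (≰⇒> ¬p))) triangle five (Good.noK8 good)) target

  weighted-bound : WeightBound D′ K G
  weighted-bound w w≥0 spread = decide (0ℚ <? μ full)
    where
    open Measure G w w≥0
    Goal : Set
    Goal = E full full ≤ D′ * (μ full * μ full)
    massless : ¬ (0ℚ < μ full) → Goal
    massless ¬p = ≤-trans (E≤ full full) (≤-reflexive (trans (cong (λ x → x * x) zero-mass)
        (trans (massless-ring D′) (cong (λ x → D′ * (x * x)) (sym zero-mass)))))
      where
      zero-mass : μ full ≡ 0ℚ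
      zero-mass = ≤-antisym (≮⇒≥ ¬p) (μ-nonneg full)
    -- Both sides are homogeneous of degree two in w, so w may be divided by its total mass.
    massive : 0ℚ < μ full → Goal
    massive p = cancel-≤ {j * j} (0<j ⊗⁺ 0<j) (subst₂ _≤_ value (lemma₁ D′ j (μ full) inv) unit)
      where
      inverted = inverse (μ full) p
      j = proj₁ inverted
      inv = proj₁ (proj₂ inverted)
      0<j = proj₂ (proj₂ inverted)
      f : Fin n → ℚ
      f v = j * 𝟙 v
      f≥0 : ∀ v → 0ℚ ≤ f v
      f≥0 v = <⇒≤ 0<j ⊗ nonneg! 1ℚ
      m : Fin n → ℚ
      m = Reweight.w G w w≥0 f f≥0
      m≥0 : ∀ v → 0ℚ ≤ m v
      m≥0 = Reweight.w≥0 G w w≥0 f f≥0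
      mass : Measure.μ G m m≥0 full ≡ 1ℚ
      mass = trans (Reweight.μ-reweight G w w≥0 f f≥0) (trans (I-* j 𝟙) (trans (cong (j *_) (sym (μ-def full))) (trans (*-comm j (μ full)) inv)))
      m-spread : ∀ v → m v * fromℕ n ≤ K
      m-spread v = lin (<⇒≤ 0<j ⊗ gap (spread v))
        (trans (cong (λ x → x - m v * fromℕ n) (trans (sym (*-identityʳ K)) (cong (K *_) (sym inv)))) (m-spread-ring K (μ full) j (w v) (fromℕ n)))
      unit : Measure.E G m m≥0 full full ≤ D′
      unit = Unit.unit-bound m m≥0 mass m-spread
      value : Measure.E G m m≥0 full full ≡ j * j * E full full
      value = trans (Reweight.E-reweight G w w≥0 f f≥0) (trans (form-scale j j 𝟙 𝟙) (cong (j * j *_) (sym (E-def full full))))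
      lemma₁ : ∀ d j x → x * j ≡ 1ℚ → d ≡ j * j * (d * (x * x))
      lemma₁ d j x e = trans (trans (sym (*-identityʳ d)) (trans (cong (d *_) (sym (*-identityʳ 1ℚ))) (cong (λ y → d * (y * y)) (sym e)))) (lemma₁-ring d j x)
    decide : Dec (0ℚ < μ full) → Goal
    decide (yes p) = massive p
    decide (no ¬p) = massless ¬p

δ₂-small-ring : ∀ k i x → k * i * x ≡ k * (x * i)
δ₂-small-ring = solve-∀ ℚ-ring

δ₁-ring : ∀ K → 3ℚ * K - 1ℚ ≡ (K - 1ℚ) + 2ℚ * K
δ₁-ring = solve-∀ ℚ-ring

improve : ∀ {ε} (S : Scales ε) D D′ → D ≤ 1ℚ → D - + 1 / 4 * Scales.τ S ≤ D′ → ½ + + 53 / 1 * ε ≤ D′ → EdgeBound D → EdgeBound D′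
improve S D D′ D≤1 close target hyp K 1≤K = proj₁ δ , proj₁ (proj₂ δ) , λ G good →
    Improve.weighted-bound S D D′ D≤1 close target K 1≤K (proj₁ δ₁) (proj₂ (proj₂ δ₁)) δ₂ 0<δ₂ δ₂-small G
      (good-mono (proj₁ (proj₂ (proj₂ δ))) good) (good-mono (proj₂ (proj₂ (proj₂ δ))) good)
  where
  open Scales S
  0<K = <-≤-trans (positive! 1ℚ) 1≤K
  δ₁ = hyp (3ℚ * K) (lin (gap 1≤K ⊕ nonneg! 2ℚ ⊗ <⇒≤ 0<K) (δ₁-ring K))
  inverted = inverse (K * K) (0<K ⊗⁺ 0<K)
  -- A set of m-measure κ₀ has at least κ₀ n / K vertices, and edge weight κ₀ means at least κ₀ n² /
  -- K² in counting measure; as K ≥ 1, the value κ₀ / K² serves for both.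
  δ₂ = κ₀ * proj₁ inverted
  0<δ₂ : 0ℚ < δ₂
  0<δ₂ = 0<κ₀ ⊗⁺ proj₂ (proj₂ inverted)
  δ₂-small : δ₂ * (K * K) ≤ κ₀
  δ₂-small = ≤-reflexive (trans (δ₂-small-ring κ₀ (proj₁ inverted) (K * K)) (trans (cong (κ₀ *_) (proj₁ (proj₂ inverted))) (*-identityʳ κ₀)))
  δ = minimum (proj₁ (proj₂ δ₁)) 0<δ₂

iterate-ring : ∀ D t → D - (1ℚ - t) ≡ D + t - 1ℚ
iterate-ring = solve-∀ ℚ-ring

iterate-ring₁ : ∀ D k t → D + (1ℚ + k) * t ≡ D + t + k * t
iterate-ring₁ = solve-∀ ℚ-ring

iterate-ring₂ : ∀ D t → D + t - D ≡ t
iterate-ring₂ = solve-∀ ℚ-ring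

iterate-ring₃ : ∀ D t → D + t - t ≡ D
iterate-ring₃ = solve-∀ ℚ-ring

iterate-ring₄ : ∀ D t → D + 0ℚ * t ≡ D
iterate-ring₄ = solve-∀ ℚ-ring

-- Induction on the number of steps of size τ/4 that separate D from 1. When the next step up would
-- pass 1, the trivial bound at 1 is improved directly, since an improvement starts from a density
-- at most 1.
iterate : ∀ {ε} (S : Scales ε) k D → ½ + + 53 / 1 * ε ≤ D → D ≤ 1ℚ → 1ℚ ≤ D + fromℕ k * (+ 1 / 4 * Scales.τ S) → EdgeBound D
iterate S zero D _ _ reach = trivial-bound (subst (1ℚ ≤_) (iterate-ring₄ D (+ 1 / 4 * Scales.τ S)) reach)
iterate S (suc k) D target D≤1 reach = decide (D + t ≤? 1ℚ)
  where
  open Scales S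
  t : ℚ
  t = + 1 / 4 * τ
  decide : Dec (D + t ≤ 1ℚ) → EdgeBound D
  decide (yes p) = improve S (D + t) D p (≤-reflexive (iterate-ring₃ D t)) target
    (iterate S k (D + t) (≤-trans target (lin (nonneg! (+ 1 / 4) ⊗ <⇒≤ 0<τ) (iterate-ring₂ D t))) p
      (subst (1ℚ ≤_) (trans (cong (λ x → D + x * t) (fromℕ-suc k)) (iterate-ring₁ D (fromℕ k) t)) reach))
  decide (no ¬p) = improve S 1ℚ D ≤-refl (lin (gap (<⇒≤ (≰⇒> ¬p))) (iterate-ring D t)) target (trivial-bound ≤-refl)

edge-bound-ring : ∀ ε x → ½ + + 53 / 1 * ε + x - 1ℚ ≡ (x - 1ℚ) + ½ + + 53 / 1 * ε
edge-bound-ring = solve-∀ ℚ-ring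

edge-bound-ring₁ : ∀ ε → 1ℚ - (½ + + 53 / 1 * ε) ≡ + 53 / 1 * (+ 1 / 106 - ε)
edge-bound-ring₁ = solve-∀ ℚ-ring

-- At ε = 1/106 the target 1/2 + 53 ε reaches the trivial density 1.
edge-bound : ∀ ε → 0ℚ < ε → ε ≤ + 1 / 106 → EdgeBound (½ + + 53 / 1 * ε)
edge-bound ε 0<ε ε≤ = iterate S (proj₁ steps) (½ + + 53 / 1 * ε) ≤-refl
  (lin (nonneg! (+ 53 / 1) ⊗ gap ε≤) (edge-bound-ring₁ ε))
  (lin (gap (proj₂ steps) ⊕ nonneg! ½ ⊕ nonneg! (+ 53 / 1) ⊗ <⇒≤ 0<ε) (edge-bound-ring ε (fromℕ (proj₁ steps) * (+ 1 / 4 * Scales.τ S))))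
  where
  S = scales ε 0<ε (≤-trans ε≤ (≤! (+ 1 / 106) ½))
  steps = archimedean (+ 1 / 4 * Scales.τ S) (positive! (+ 1 / 4) ⊗⁺ Scales.0<τ S) 1ℚ

-- Dependent random choice

average-ring : ∀ s f N v → s - N * v ≡ f + s - (1ℚ + N) * v + (v - f)
average-ring = solve-∀ ℚ-ring

average : ∀ {n} (f : Fin (suc n) → ℚ) v → fromℕ (suc n) * v ≤ ∑ f → Σ (Fin (suc n)) λ i → v ≤ f i
average {zero} f v p = zero , subst₂ _≤_ (*-identityˡ v) (trans (∑-suc f) (trans (cong (_+_ (f zero)) ∑-empty) (+-identityʳ (f zero)))) p
average {suc n} f v p = decide (v ≤? f zero)
  where
  tail : ℚ
  tail = ∑ (λ i → f (suc i))
  expanded : (1ℚ + fromℕ (suc n)) * v ≤ f zero + tail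
  expanded = subst₂ _≤_ (cong (_* v) (fromℕ-suc (suc n))) (∑-suc f) p
  decide : Dec (v ≤ f zero) → Σ (Fin (suc (suc n))) λ i → v ≤ f i
  decide (yes q) = zero , q
  decide (no ¬q) = suc (proj₁ later) , proj₂ later
    where
    later = average (λ i → f (suc i)) v (lin (gap expanded ⊕ gap (<⇒≤ (≰⇒> ¬q))) (average-ring tail (f zero) (fromℕ (suc n)) v))

∑-term-ring : ∀ a b s → a + s - b ≡ a + (s - b)
∑-term-ring = solve-∀ ℚ-ring

∑-term-ring₁ : ∀ a b → a + b - a ≡ b
∑-term-ring₁ = solve-∀ ℚ-ring

∑-term : ∀ {n} (f : Fin n → ℚ) → (∀ i → 0ℚ ≤ f i) → ∀ i → f i ≤ ∑ f
∑-term {suc n} f p zero    = subst (f zero ≤_) (sym (∑-suc f)) (lin (∑-nonneg (λ i → p (suc i))) (∑-term-ring₁ (f zero) (∑ (λ i → f (suc i)))))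
∑-term {suc n} f p (suc i) = subst (f (suc i) ≤_) (sym (∑-suc f))
  (lin (p zero ⊕ gap (∑-term (λ i → f (suc i)) (λ i → p (suc i)) i)) (∑-term-ring (f zero) (f (suc i)) (∑ (λ i → f (suc i)))))

∑-const-ring : ∀ c N → c + N * c ≡ (1ℚ + N) * c
∑-const-ring = solve-∀ ℚ-ring

∑-const : ∀ n c → ∑ {n} (λ _ → c) ≡ fromℕ n * c
∑-const zero    c = trans ∑-empty (sym (*-zeroˡ c))
∑-const (suc n) c = trans (∑-suc _) (trans (cong (_+_ c) (∑-const n c))
  (trans (∑-const-ring c (fromℕ n)) (cong (_* c) (sym (fromℕ-suc n)))))

card : ∀ {n} → Vset n → ℚ
card X = ∑ (λ v → χ (X v))

card-nonneg : ∀ {n} (X : Vset n) → 0ℚ ≤ card X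
card-nonneg X = ∑-nonneg (λ v → χ-nonneg (X v))

card≤n : ∀ {n} (X : Vset n) → card X ≤ fromℕ n
card≤n {n} X = subst (card X ≤_) (trans (∑-const n 1ℚ) (*-identityʳ _)) (∑-mono (λ v → χ≤1 (X v)))

pointwise-ring : ∀ N d a → N * 0ℚ + a * 1ℚ - 1ℚ * d ≡ a - d
pointwise-ring = solve-∀ ℚ-ring

pointwise-ring₁ : ∀ N d a → N * 1ℚ + a * 1ℚ - 1ℚ * d ≡ (N - d) + a
pointwise-ring₁ = solve-∀ ℚ-ring

pointwise-ring₂ : ∀ N d a → N * 0ℚ + a * 1ℚ - 0ℚ * d ≡ a
pointwise-ring₂ = solve-∀ ℚ-ring

product-ring : ∀ a b → 1ℚ - a * b ≡ (1ℚ - b) + (1ℚ - a) * b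
product-ring = solve-∀ ℚ-ring

none-bad-ring : ∀ N c B → 0ℚ - (c - N * B) ≡ N * (B - 1ℚ) + (N - c)
none-bad-ring = solve-∀ ℚ-ring

U-large-ring : ∀ c x → c - (c - x) ≡ x
U-large-ring = solve-∀ ℚ-ring

potential-ring : ∀ N k w wt bt c B → c * wt - N * B * bt - k * N ≡
  N * (w * wt - (N * N * N * bt + k)) + wt * (c - w * N) + N * bt * (N * (N * N) - B)
potential-ring = solve-∀ ℚ-ring

C₀-large-ring : ∀ N w c s → N * c - N * (w * N) ≡ (s - 2ℚ * w * N * N) + (N * c + N * (w * N) - s)
C₀-large-ring = solve-∀ ℚ-ring

total-ring : ∀ N c w wt B b bt S T → wt * S + (- (N * bt)) * T - N * (c * (w * wt) - N * B * (b * bt)) ≡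
  wt * (S - w * N * c) + N * bt * (b * N * B - T)
total-ring = solve-∀ ℚ-ring

Φ-sum-ring : ∀ c w N B b → c * w - N * B * b ≡ w * c + (- (N * b)) * B
Φ-sum-ring = solve-∀ ℚ-ring

pointwise-ring₄ : ∀ u c k → u * 0ℚ * c ≡ k * (u * 0ℚ)
pointwise-ring₄ = solve-∀ ℚ-ring

pointwise-ring₅ : ∀ u c k → k * (u * 1ℚ) - u * 1ℚ * c ≡ u * (k - c)
pointwise-ring₅ = solve-∀ ℚ-ring

booleans-ring : ∀ u v w a p q r e → u * (a * p) * (v * (a * q)) * (w * (a * r)) * e ≡ u * v * w * e * (p * (q * (r * (a * a * a))))
booleans-ring = solve-∀ ℚ-ring

choose-ring : ∀ x y → x * 1ℚ - y * 1ℚ ≡ x - y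
choose-ring = solve-∀ ℚ-ring

module DependentChoice {n : ℕ} (G : Graph (suc n)) (A : Vset (suc n)) (b w : ℚ) (0≤b : 0ℚ ≤ b) (0≤w : 0ℚ ≤ w) where

  N : ℚ
  N = fromℕ (suc n)

  0≤N : 0ℚ ≤ N
  0≤N = 0≤fromℕ (suc n)

  common : Fin (suc n) → Fin (suc n) → Fin (suc n) → ℚ
  common x y z = card (nbhds G (x ∷ y ∷ z ∷ []) A)

  bad : Fin (suc n) → Fin (suc n) → Fin (suc n) → Bool
  bad x y z = does (common x y z ≤? b * N)

  B : Vset (suc n) → ℚ
  B U = ∑ (λ x → ∑ (λ y → ∑ (λ z → χ (U x) * χ (U y) * χ (U z) * χ (bad x y z))))

  -- A vertex a outside A gives the empty set, so a may range over all N vertices and averages have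
  -- denominator N.
  restrict : Vset (suc n) → Fin (suc n) → Vset (suc n)
  restrict U a c = U c ∧ (A a ∧ adj G a c)

  degA : Fin (suc n) → ℚ
  degA c = card (nbhd G c A)

  card-restrict : ∀ U → ∑ (λ a → card (restrict U a)) ≡ ∑ (λ c → χ (U c) * degA c)
  card-restrict U = trans (∑-comm (λ a c → χ (restrict U a c))) (∑-cong (λ c → trans (∑-cong (λ a → pointwise c a)) (∑-* (χ (U c)) _)))
    where
    swap : ∀ a b → χ (a ∧ b) ≡ χ (b ∧ a)
    swap true  true  = refl
    swap true  false = refl
    swap false true  = refl
    swap false false = refl
    pointwise : ∀ c a → χ (restrict U a c) ≡ χ (U c) * χ (nbhd G c A a)
    pointwise c a rewrite Graph.sym G c a = trans (χ-∧ (U c) _) (cong (χ (U c) *_) (swap (A a) (adj G a c)))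

  B-restrict : ∀ U → ∑ (λ a → B (restrict U a)) ≡
    ∑ (λ x → ∑ (λ y → ∑ (λ z → χ (U x) * χ (U y) * χ (U z) * χ (bad x y z) * common x y z)))
  B-restrict U =
    trans (∑-comm (λ a x → ∑ (λ y → ∑ (λ z → term a x y z)))) (∑-cong (λ x →
    trans (∑-comm (λ a y → ∑ (λ z → term a x y z))) (∑-cong (λ y →
    trans (∑-comm (λ a z → term a x y z)) (∑-cong (λ z →
    trans (∑-cong (λ a → pointwise x y z a)) (∑-* (χ (U x) * χ (U y) * χ (U z) * χ (bad x y z)) _)))))))
    where
    term : ∀ a x y z → ℚ
    term a x y z = χ (restrict U a x) * χ (restrict U a y) * χ (restrict U a z) * χ (bad x y z)
    booleans : ∀ u v w a p q r e → χ (u ∧ (a ∧ p)) * χ (v ∧ (a ∧ q)) * χ (w ∧ (a ∧ r)) * e ≡ χ u * χ v * χ w * e * χ (p ∧ (q ∧ (r ∧ a)))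
    booleans u v w a p q r e
      rewrite χ-∧ u (a ∧ p) | χ-∧ v (a ∧ q) | χ-∧ w (a ∧ r) | χ-∧ a p | χ-∧ a q | χ-∧ a r | χ-∧ p (q ∧ (r ∧ a)) | χ-∧ q (r ∧ a) | χ-∧ r a
      = trans (booleans-ring (χ u) (χ v) (χ w) (χ a) (χ p) (χ q) (χ r) e) (cong (λ s → χ u * χ v * χ w * e * (χ p * (χ q * (χ r * s)))) (cube a))
      where
      cube : ∀ a → χ a * χ a * χ a ≡ χ a
      cube true  = refl
      cube false = refl
    pointwise : ∀ x y z a → term a x y z ≡ χ (U x) * χ (U y) * χ (U z) * χ (bad x y z) * χ (nbhds G (x ∷ y ∷ z ∷ []) A a)
    pointwise x y z a rewrite Graph.sym G x a | Graph.sym G y a | Graph.sym G z a =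
      booleans (U x) (U y) (U z) (A a) (adj G a x) (adj G a y) (adj G a z) (χ (bad x y z))

  B-nonneg : ∀ U → 0ℚ ≤ B U
  B-nonneg U = ∑-nonneg (λ x → ∑-nonneg (λ y → ∑-nonneg (λ z →
    ((χ-nonneg (U x) ⊗ χ-nonneg (U y)) ⊗ χ-nonneg (U z)) ⊗ χ-nonneg (bad x y z))))

  -- A bad triple survives the restriction only if a is one of its common neighbours in A, and there
  -- are at most b N of these.
  B-restrict≤ : ∀ U → ∑ (λ a → B (restrict U a)) ≤ b * N * B U
  B-restrict≤ U = subst₂ _≤_ (sym (B-restrict U)) scaled (∑-mono (λ x → ∑-mono (λ y → ∑-mono (λ z → pointwise x y z))))
    where
    scaled : ∑ (λ x → ∑ (λ y → ∑ (λ z → b * N * (χ (U x) * χ (U y) * χ (U z) * χ (bad x y z))))) ≡ b * N * B U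
    scaled = trans (∑-cong (λ x → trans (∑-cong (λ y → ∑-* (b * N) _)) (∑-* (b * N) _))) (∑-* (b * N) _)
    pointwise : ∀ x y z → χ (U x) * χ (U y) * χ (U z) * χ (bad x y z) * common x y z ≤ b * N * (χ (U x) * χ (U y) * χ (U z) * χ (bad x y z))
    pointwise x y z = bounded (bad x y z) (does-true (common x y z ≤? b * N))
      where
      u = χ (U x) * χ (U y) * χ (U z)
      bounded : ∀ e → (e ≡ true → common x y z ≤ b * N) → u * χ e * common x y z ≤ b * N * (u * χ e)
      bounded true  p = lin (((χ-nonneg (U x) ⊗ χ-nonneg (U y)) ⊗ χ-nonneg (U z)) ⊗ gap (p refl)) (pointwise-ring₅ u (common x y z) (b * N))
      bounded false _ = ≤-reflexive (pointwise-ring₄ u (common x y z) (b * N))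

  -- The bound is preserved on average when U is cut down to the neighbours of one more vertex of A.
  choose : ∀ t U → (∀ c → U c ≡ true → w * N ≤ degA c) →
    Σ (Vset (suc n)) λ U′ → U′ ⊆ U × (card U * w ^ t - N * B U * b ^ t ≤ card U′ - N * B U′)
  choose zero U _ = U , (λ _ p → p) , ≤-reflexive (choose-ring (card U) (N * B U))
  choose (suc t) U high = proj₁ rest , ⊆-trans (proj₁ (proj₂ rest)) smaller , ≤-trans (proj₂ picked) (proj₂ (proj₂ rest))
    where
    Φ : Vset (suc n) → ℚ
    Φ V = card V * w ^ t - N * B V * b ^ t
    goal = card U * w ^ suc t - N * B U * b ^ suc t
    w^t≥0 : ∀ q → 0ℚ ≤ q → ∀ t → 0ℚ ≤ q ^ t
    w^t≥0 q p zero = nonneg! 1ℚ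
    w^t≥0 q p (suc t) = p ⊗ w^t≥0 q p t
    cards : w * N * card U ≤ ∑ (λ a → card (restrict U a))
    cards = subst₂ _≤_ (∑-* (w * N) _) (sym (card-restrict U)) (∑-mono (λ c → pointwise c (U c) refl))
      where
      pointwise : ∀ c u → U c ≡ u → w * N * χ u ≤ χ u * degA c
      pointwise c true  q = subst₂ _≤_ (sym (*-identityʳ _)) (sym (*-identityˡ _)) (high c q)
      pointwise c false q = ≤-reflexive (trans (*-zeroʳ (w * N)) (sym (*-zeroˡ (degA c))))
    Φ-sum : ∑ (λ a → Φ (restrict U a)) ≡ w ^ t * ∑ (λ a → card (restrict U a)) + (- (N * b ^ t)) * ∑ (λ a → B (restrict U a))
    Φ-sum = trans (∑-cong (λ a → Φ-sum-ring (card (restrict U a)) (w ^ t) N (B (restrict U a)) (b ^ t))) (∑-linear (w ^ t) (- (N * b ^ t)) _ _)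
    total : N * goal ≤ ∑ (λ a → Φ (restrict U a))
    total = subst (N * goal ≤_) (sym Φ-sum)
      (lin (w^t≥0 w 0≤w t ⊗ gap cards ⊕ (0≤N ⊗ w^t≥0 b 0≤b t) ⊗ gap (B-restrict≤ U))
        (total-ring N (card U) w (w ^ t) (B U) b (b ^ t) (∑ (λ a → card (restrict U a))) (∑ (λ a → B (restrict U a)))))
    picked = average (λ a → Φ (restrict U a)) goal total
    a = proj₁ picked
    smaller : restrict U a ⊆ U
    smaller c = ∧-fst
    rest = choose t (restrict U a) (λ c p → high c (smaller c p))

  B≤N³ : ∀ U → B U ≤ N * (N * N)
  B≤N³ U = subst (B U ≤_) constant (∑-mono (λ x → ∑-mono (λ y → ∑-mono (λ z → at-most-one x y z))))
    where
    at-most-one : ∀ x y z → χ (U x) * χ (U y) * χ (U z) * χ (bad x y z) ≤ 1ℚ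
    at-most-one x y z = product (product (product (χ≤1 (U x)) (χ-nonneg (U y)) (χ≤1 (U y))) (χ-nonneg (U z)) (χ≤1 (U z)))
        (χ-nonneg (bad x y z)) (χ≤1 (bad x y z))
      where
      product : ∀ {a b} → a ≤ 1ℚ → 0ℚ ≤ b → b ≤ 1ℚ → a * b ≤ 1ℚ
      product {a} {b} p q r = lin (gap r ⊕ gap p ⊗ q) (product-ring a b)
    constant : ∑ {suc n} (λ x → ∑ {suc n} (λ y → ∑ {suc n} (λ z → 1ℚ))) ≡ N * (N * N)
    constant = trans (∑-cong (λ x → trans (∑-cong (λ y → trans (∑-const (suc n) 1ℚ) (*-identityʳ N))) (∑-const (suc n) N)))
      (∑-const (suc n) (N * N))

  B-positive : ∀ U x y z → U x ≡ true → U y ≡ true → U z ≡ true → bad x y z ≡ true → 1ℚ ≤ B U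
  B-positive U x y z p q r s = ≤-trans (≤-reflexive (sym one))
    (≤-trans (∑-term _ (λ z → nonneg x y z) z)
    (≤-trans (∑-term (λ y → ∑ (λ z → term x y z)) (λ y → ∑-nonneg (λ z → nonneg x y z)) y)
      (∑-term (λ x → ∑ (λ y → ∑ (λ z → term x y z))) (λ x → ∑-nonneg (λ y → ∑-nonneg (λ z → nonneg x y z))) x)))
    where
    term : ∀ x y z → ℚ
    term x y z = χ (U x) * χ (U y) * χ (U z) * χ (bad x y z)
    nonneg : ∀ x y z → 0ℚ ≤ term x y z
    nonneg x y z = ((χ-nonneg (U x) ⊗ χ-nonneg (U y)) ⊗ χ-nonneg (U z)) ⊗ χ-nonneg (bad x y z)
    one : term x y z ≡ 1ℚ
    one = cong₂ (λ a b → a * b) (cong₂ _*_ (cong₂ (λ a b → χ a * χ b) p q) (cong χ r)) (cong χ s)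

  module _ (C : Vset (suc n)) (t : ℕ) (κ : ℚ) (0<κ : 0ℚ < κ) (numeric : N * N * N * b ^ t + κ ≤ w * w ^ t)
    (edges : ∀ X → b * N < card X → Clique G 2 X) (triangles : ∀ X → κ * N ≤ card X → Clique G 3 X)
    (dense : 2ℚ * w * N * N ≤ ∑ (λ c → χ (C c) * degA c)) where

    private
      0<N : 0ℚ < N
      0<N = <-≤-trans (positive! 1ℚ) (fromℕ-mono {1} {suc n} (ℕ.s≤s ℕ.z≤n))

    C₀ : Vset (suc n)
    C₀ c = C c ∧ does (w * N ≤? degA c)

    -- The discarded vertices of C account for at most w N² of the 2 w N² edges, and each remaining
    -- vertex for at most N.
    C₀-large : w * N ≤ card C₀
    C₀-large = cancel-≤ 0<N (lin (gap dense ⊕ gap upper) (C₀-large-ring N w (card C₀) (∑ (λ c → χ (C c) * degA c))))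
      where
      pointwise : ∀ x e d → (e ≡ false → d ≤ w * N) → 0ℚ ≤ d → d ≤ N → χ x * d ≤ N * χ (x ∧ e) + w * N * 1ℚ
      pointwise false e d _ 0≤d d≤N = lin ((0≤w ⊗ 0≤N)) (pointwise-ring₂ N d (w * N))
      pointwise true true d _ 0≤d d≤N = lin (gap d≤N ⊕ (0≤w ⊗ 0≤N)) (pointwise-ring₁ N d (w * N))
      pointwise true false d f 0≤d d≤N = lin (gap (f refl)) (pointwise-ring N d (w * N))
      upper : ∑ (λ c → χ (C c) * degA c) ≤ N * card C₀ + N * (w * N)
      upper = subst (∑ (λ c → χ (C c) * degA c) ≤_)
        (trans (∑-linear N (w * N) (λ c → χ (C₀ c)) (λ _ → 1ℚ))
          (cong (λ s → N * card C₀ + s) (trans (cong (w * N *_) (trans (∑-const (suc n) 1ℚ) (*-identityʳ N))) (*-comm (w * N) N))))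
        (∑-mono (λ c → pointwise (C c) (does (w * N ≤? degA c)) (degA c)
          (λ e → <⇒≤ (≰⇒> (does-false (w * N ≤? degA c) e))) (card-nonneg (nbhd G c A)) (card≤n (nbhd G c A))))

    chosen = choose t C₀ (λ c p → does-true (w * N ≤? degA c) (∧-snd {C c} p))

    U : Vset (suc n)
    U = proj₁ chosen

    power-nonneg : ∀ {q} → 0ℚ ≤ q → ∀ t → 0ℚ ≤ q ^ t
    power-nonneg p zero    = nonneg! 1ℚ
    power-nonneg p (suc t) = p ⊗ power-nonneg p t

    -- At the start there are at least w N vertices and at most N³ bad triples, so the potential is
    -- at least N (w^(t+1) - N³ b^t) ≥ κ N.
    potential : κ * N ≤ card U - N * B U
    potential = ≤-trans (lin (0≤N ⊗ gap numeric ⊕ power-nonneg 0≤w t ⊗ gap C₀-large ⊕ 0≤N ⊗ power-nonneg 0≤b t ⊗ gap (B≤N³ C₀))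
        (potential-ring N κ w (w ^ t) (b ^ t) (card C₀) (B C₀))) (proj₂ (proj₂ chosen))

    U-large : κ * N ≤ card U
    U-large = ≤-trans potential (lin (0≤N ⊗ B-nonneg U) (U-large-ring (card U) (N * B U)))

    -- A bad triple costs N in the potential, which `card U` ≤ N cannot make up for.
    none-bad : ∀ x y z → U x ≡ true → U y ≡ true → U z ≡ true → bad x y z ≡ false
    none-bad x y z p q r = decide (bad x y z) refl
      where
      decide : ∀ e → bad x y z ≡ e → e ≡ false
      decide false _ = refl
      decide true eq = ⊥-elim (absurd (≤-trans potential
        (lin (0≤N ⊗ gap (B-positive U x y z p q r eq) ⊕ gap (card≤n U)) (none-bad-ring N (card U) (B U)))) (0<κ ⊗⁺ 0<N))

    -- A triangle of U lies in C and, not being a bad triple, has more than b N common neighbours in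
    -- A; these contain an edge.
    five-clique : Σ (Clique G 2 A) λ c → Clique G 3 (nbhds G (members c) C)
    five-clique = build (triangles U U-large)
      where
      build : Clique G 3 U → Σ (Clique G 2 A) λ c → Clique G 3 (nbhds G (members c) C)
      build (clique (x ∷ y ∷ z ∷ []) refl ps (p ∷ q ∷ r ∷ [])) =
        clique (members uv) (size uv) (pairs uv) (All.map (λ {v} → nbhds⊆ G T {A} v) (inside uv)) ,
        clique T refl ps (joined p (λ { (a ∷ _ ∷ _ ∷ []) → a }) ∷ joined q (λ { (_ ∷ a ∷ _ ∷ []) → a })
          ∷ joined r (λ { (_ ∷ _ ∷ a ∷ []) → a }) ∷ [])
        where
        T = x ∷ y ∷ z ∷ []
        uv : Clique G 2 (nbhds G T A)
        uv = edges (nbhds G T A) (≰⇒> (does-false (common x y z ≤? b * N) (none-bad x y z p q r)))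
        joined : ∀ {s} → U s ≡ true → (∀ {v} → All (λ t → Adj G t v) T → Adj G s v) → nbhds G (members uv) C s ≡ true
        joined {s} u f = nbhds-true G (members uv)
          (All.map (λ {v} m → trans (Graph.sym G v s) (f (nbhds-adj G T {A} m))) (inside uv))
          (∧-fst (proj₁ (proj₂ chosen) s u))

-- Independent sets in triangle-free graphs

∨-false : ∀ {a b} → a ∨ b ≡ false → (a ≡ false) × (b ≡ false)
∨-false {false} p = refl , p

δ-sum : ∀ {n} (w : Fin n) → ∑ (λ v → χ (does (v Fin.≟ w))) ≡ 1ℚ
δ-sum {suc n} zero = trans (∑-suc _) (trans (cong (_+_ 1ℚ) (∑-zero n)) (+-identityʳ 1ℚ))
δ-sum {suc n} (suc w) = trans (∑-suc _) (trans (+-identityˡ _) (δ-sum w))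

keep : ∀ {A : Set} → (A → Bool) → List A → List A
keep p []       = []
keep p (x ∷ xs) = if p x then x ∷ keep p xs else keep p xs

module _ {A : Set} where

  keep-true : ∀ (p : A → Bool) xs → All (λ x → p x ≡ true) (keep p xs)
  keep-true p [] = []
  keep-true p (x ∷ xs) with p x in eq
  ... | true  = eq ∷ keep-true p xs
  ... | false = keep-true p xs

  keep-All : ∀ {P : A → Set} p {xs} → All P xs → All P (keep p xs)
  keep-All p [] = []
  keep-All p {x ∷ _} (q ∷ qs) with p x
  ... | true  = q ∷ keep-All p qs
  ... | false = keep-All p qs

  keep-AllPairs : ∀ {R : A → A → Set} p {xs} → AllPairs R xs → AllPairs R (keep p xs)
  keep-AllPairs p [] = []
  keep-AllPairs p {x ∷ _} (q ∷ qs) with p x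
  ... | true  = keep-All p q ∷ keep-AllPairs p qs
  ... | false = keep-AllPairs p qs

  keep-∈ : ∀ p {x : A} {xs} → p x ≡ true → x ∈ xs → x ∈ keep p xs
  keep-∈ p {x} {y ∷ _} q (here refl) rewrite q = here refl
  keep-∈ p {x} {y ∷ _} q (there r) with p y
  ... | true  = there (keep-∈ p q r)
  ... | false = keep-∈ p q r

  keep-↭ : ∀ (p : A → Bool) xs → xs ↭ keep (not ∘ p) xs ++ keep p xs
  keep-↭ p [] = ↭-refl
  keep-↭ p (x ∷ xs) with p x
  ... | true  = ↭-trans (↭-prep x (keep-↭ p xs)) (↭-sym (↭.shift x (keep (not ∘ p) xs) (keep p xs)))
  ... | false = ↭-prep x (keep-↭ p xs)

  AllPairs-↭ : ∀ {R : A → A → Set} → (∀ {x y} → R x y → R y x) → ∀ {xs ys} → xs ↭ ys → AllPairs R xs → AllPairs R ys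
  AllPairs-↭ s ↭.refl ps = ps
  AllPairs-↭ s (prep x p) (q ∷ qs) = ↭.All-resp-↭ p q ∷ AllPairs-↭ s p qs
  AllPairs-↭ s (↭.swap x y p) ((q ∷ qs) ∷ (r ∷ rs)) = (s q ∷ ↭.All-resp-↭ p r) ∷ (↭.All-resp-↭ p qs ∷ AllPairs-↭ s p rs)
  AllPairs-↭ s (↭.trans p q) ps = AllPairs-↭ s q (AllPairs-↭ s p ps)

  AllPairs-refine : ∀ {P : A → Set} {Q R : A → A → Set} → (∀ {x y} → P x → P y → Q x y → R x y) →
    ∀ {xs} → All P xs → AllPairs Q xs → AllPairs R xs
  AllPairs-refine f [] [] = []
  AllPairs-refine f (p ∷ ps) (q ∷ qs) = All.zipWith (λ (p′ , q′) → f p p′ q′) (ps , q) ∷ AllPairs-refine f ps qs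

combine-ring : ∀ x y → y * 0ℚ - x * 0ℚ ≡ 0ℚ
combine-ring = solve-∀ ℚ-ring

exchange-ring : ∀ a b → a + b + 0ℚ ≡ a + 0ℚ + (b + 0ℚ)
exchange-ring = solve-∀ ℚ-ring

exchange-ring₁ : ∀ a d → a + 0ℚ + (d + 0ℚ) ≡ a + d + 0ℚ
exchange-ring₁ = solve-∀ ℚ-ring

exchange-ring₂ : ∀ a b d → a + b + (d + 0ℚ) ≡ a + d + (b + 0ℚ)
exchange-ring₂ = solve-∀ ℚ-ring

exchange-ring₃ : ∀ a b d f → a + b + (d + f) ≡ a + d + (b + f)
exchange-ring₃ = solve-∀ ℚ-ring

Z-one-positive-ring : ∀ a b → a + b - 1ℚ ≡ (a - 1ℚ) + (b - 1ℚ) + 1ℚ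
Z-one-positive-ring = solve-∀ ℚ-ring

Z-weight-ring : ∀ t s f k a b → 2ℚ * (a + b) - 2ℚ * t * (2ℚ * s + (1ℚ + k)) ≡
  (2ℚ * a - t * (2ℚ * s + k)) + (2ℚ * b - t * (2ℚ * (f + s) + k)) + 2ℚ * (t * (f - 1ℚ))
Z-weight-ring = solve-∀ ℚ-ring

Z-weight-ring₁ : ∀ s → 1ℚ * (2ℚ * s + 0ℚ) ≡ 2ℚ * s
Z-weight-ring₁ = solve-∀ ℚ-ring

Z-one-ring : ∀ a → a + a ≡ 2ℚ * a
Z-one-ring = solve-∀ ℚ-ring

weight-bag-ring : ∀ a b c → a + (b + c) ≡ b + (a + c)
weight-bag-ring = solve-∀ ℚ-ring

Z-compare-ring : ∀ x y a b c d → y * (c + d) - x * (a + b) ≡ (y * c - x * a) + (y * d - x * b)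
Z-compare-ring = solve-∀ ℚ-ring

module IndependentSums {n : ℕ} (G : Graph n) where

  -- Equality counts as a conflict, so that conflict-free lists have no repetitions.
  conf : Fin n → Fin n → Bool
  conf u v = adj G u v ∨ does (u Fin.≟ v)

  conf-sym : ∀ u v → conf u v ≡ conf v u
  conf-sym u v = cong₂ _∨_ (Graph.sym G u v) (≟-sym u v)
    where
    ≟-sym : ∀ {k} (u v : Fin k) → does (u Fin.≟ v) ≡ does (v Fin.≟ u)
    ≟-sym zero zero = refl
    ≟-sym zero (suc v) = refl
    ≟-sym (suc u) zero = refl
    ≟-sym (suc u) (suc v) = ≟-sym u v

  free : Fin n → List (Fin n) → Bool
  free v []      = true
  free v (w ∷ W) = not (conf v w) ∧ free v W

  free-resp : ∀ v {W W′} → W ↭ W′ → free v W ≡ free v W′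
  free-resp v ↭.refl = refl
  free-resp v (prep w p) = cong (not (conf v w) ∧_) (free-resp v p)
  free-resp v (↭.swap x y p) rewrite free-resp v p = exchange (not (conf v x)) (not (conf v y)) _
    where
    exchange : ∀ a b c → a ∧ (b ∧ c) ≡ b ∧ (a ∧ c)
    exchange true  b c = refl
    exchange false true c = refl
    exchange false false c = refl
  free-resp v (↭.trans p q) = trans (free-resp v p) (free-resp v q)

  free-true : ∀ v {W} → free v W ≡ true → All (λ w → conf v w ≡ false) W
  free-true v {[]} _ = []
  free-true v {w ∷ W} p = not-true (∧-fst p) ∷ free-true v (∧-snd {not (conf v w)} p)

  true-free : ∀ v {W} → All (λ w → conf v w ≡ false) W → free v W ≡ true
  true-free v [] = refl
  true-free v (p ∷ ps) rewrite p = true-free v ps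

  -- The sum of g over all T ++ W, where T runs over the conflict-free sublists of vs without conflicts with W.
  Z : List (Fin n) → (List (Fin n) → ℚ) → List (Fin n) → ℚ
  Z []       g W = g W
  Z (v ∷ vs) g W = Z vs g W + (if free v W then Z vs g (v ∷ W) else 0ℚ)

  Bag : (List (Fin n) → ℚ) → Set
  Bag g = ∀ {W W′} → W ↭ W′ → g W ≡ g W′

  Z-bag : ∀ vs {g} → Bag g → Bag (Z vs g)
  Z-bag []       bag p = bag p
  Z-bag (v ∷ vs) {g} bag {W} {W′} p rewrite free-resp v p =
    cong₂ (λ a b → a + (if free v W′ then b else 0ℚ)) (Z-bag vs bag p) (Z-bag vs bag (prep v p))

  -- The sum over conflict-free sets does not depend on the enumeration of the vertices, so a vertex
  -- and its neighbours can be moved to the end.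
  Z-perm : ∀ {vs vs′ g} → Bag g → vs ↭ vs′ → ∀ W → Z vs g W ≡ Z vs′ g W
  Z-perm bag ↭.refl W = refl
  Z-perm bag (prep v p) W = cong₂ (λ a b → a + (if free v W then b else 0ℚ)) (Z-perm bag p W) (Z-perm bag p (v ∷ W))
  Z-perm bag (↭.trans p q) W = trans (Z-perm bag p W) (Z-perm bag q W)
  Z-perm {_} {_ ∷ _ ∷ vs′} {g} bag (↭.swap {xs = vs} x y p) W
    rewrite Z-perm bag p W | Z-perm bag p (x ∷ W) | Z-perm bag p (y ∷ W) | Z-perm bag p (y ∷ x ∷ W)
          | Z-bag vs′ {g} bag (↭.swap {xs = W} y x ↭-refl) | conf-sym x y
    = exchange (free x W) (free y W) (not (conf y x)) (Z vs′ g W) (Z vs′ g (y ∷ W)) (Z vs′ g (x ∷ W)) (Z vs′ g (x ∷ y ∷ W))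
    where
    exchange : ∀ fx fy c a b d f →
      a + (if fy then b else 0ℚ) + (if fx then d + (if c ∧ fy then f else 0ℚ) else 0ℚ) ≡
      a + (if fx then d else 0ℚ) + (if fy then b + (if c ∧ fx then f else 0ℚ) else 0ℚ)
    exchange true true true a b d f = exchange-ring₃ a b d f
    exchange true true false a b d f = exchange-ring₂ a b d
    exchange true false true a b d f = exchange-ring₁ a d
    exchange true false false a b d f = exchange-ring₁ a d
    exchange false true true a b d f = exchange-ring a b
    exchange false true false a b d f = exchange-ring a b
    exchange false false c a b d f = refl

  Z-++ : ∀ us vs g W → Z (us ++ vs) g W ≡ Z us (Z vs g) W
  Z-++ []       vs g W = refl
  Z-++ (u ∷ us) vs g W = cong₂ (λ a b → a + (if free u W then b else 0ℚ)) (Z-++ us vs g W) (Z-++ us vs g (u ∷ W))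

  -- The termwise comparison is required only for conflict-free W with all members in P, because `Z`
  -- extends W by free members of the list alone.
  Z-compare : ∀ {P : Fin n → Set} {g h} x y → 0ℚ ≤ y →
    (∀ W → AllPairs (λ u v → conf u v ≡ false) W → All P W → x * g W ≤ y * h W) →
    ∀ vs → All P vs → ∀ W → AllPairs (λ u v → conf u v ≡ false) W → All P W → x * Z vs g W ≤ y * Z vs h W
  Z-compare x y 0≤y le [] [] W ps qs = le W ps qs
  Z-compare {P} {g} {h} x y 0≤y le (v ∷ vs) (q ∷ qs) W ind inW = combine (free v W) refl
    where
    first = Z-compare x y 0≤y le vs qs W ind inW
    combine : ∀ f → free v W ≡ f → x * (Z vs g W + (if f then Z vs g (v ∷ W) else 0ℚ)) ≤ y * (Z vs h W + (if f then Z vs h (v ∷ W) else 0ℚ))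
    combine true eq = lin (gap first ⊕ gap (Z-compare x y 0≤y le vs qs (v ∷ W) (free-true v eq ∷ ind) (q ∷ inW)))
      (Z-compare-ring x y (Z vs g W) (Z vs g (v ∷ W)) (Z vs h W) (Z vs h (v ∷ W)))
    combine false _ = lin (gap first ⊕ ≤-refl) (trans (Z-compare-ring x y (Z vs g W) 0ℚ (Z vs h W) 0ℚ) (cong (λ z → y * Z vs h W - x * Z vs g W + z) (combine-ring x y)))

  Z-nothing-free : ∀ vs g W → All (λ v → free v W ≡ false) vs → Z vs g W ≡ g W
  Z-nothing-free [] g W [] = refl
  Z-nothing-free (v ∷ vs) g W (p ∷ ps) rewrite p = trans (+-identityʳ _) (Z-nothing-free vs g W ps)

  Z-∑ : ∀ {k} vs (c : Fin k → ℚ) (g : Fin k → List (Fin n) → ℚ) W → ∑ (λ i → c i * Z vs (g i) W) ≡ Z vs (λ W → ∑ (λ i → c i * g i W)) W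
  Z-∑ [] c g W = refl
  Z-∑ (v ∷ vs) c g W = combine (free v W)
    where
    combine : ∀ f → ∑ (λ i → c i * (Z vs (g i) W + (if f then Z vs (g i) (v ∷ W) else 0ℚ))) ≡
      Z vs (λ W → ∑ (λ i → c i * g i W)) W + (if f then Z vs (λ W → ∑ (λ i → c i * g i W)) (v ∷ W) else 0ℚ)
    combine true = trans (∑-cong (λ i → *-distribˡ-+ (c i) (Z vs (g i) W) (Z vs (g i) (v ∷ W))))
      (trans (∑-+ (λ i → c i * Z vs (g i) W) (λ i → c i * Z vs (g i) (v ∷ W))) (cong₂ _+_ (Z-∑ vs c g W) (Z-∑ vs c g (v ∷ W))))
    combine false = trans (∑-cong (λ i → cong (c i *_) (+-identityʳ (Z vs (g i) W)))) (trans (Z-∑ vs c g W) (sym (+-identityʳ _)))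

  weight : (Fin n → ℚ) → List (Fin n) → ℚ
  weight φ []      = 0ℚ
  weight φ (w ∷ W) = φ w + weight φ W

  weight-bag : ∀ φ → Bag (weight φ)
  weight-bag φ ↭.refl = refl
  weight-bag φ (prep x p) = cong (_+_ (φ x)) (weight-bag φ p)
  weight-bag φ (↭.swap {xs = W} x y p) = trans (cong (λ s → φ x + (φ y + s)) (weight-bag φ p)) (weight-bag-ring (φ x) (φ y) _)
  weight-bag φ (↭.trans p q) = trans (weight-bag φ p) (weight-bag φ q)

  weight-nonneg : ∀ {φ} → (∀ v → 0ℚ ≤ φ v) → ∀ W → 0ℚ ≤ weight φ W
  weight-nonneg p []      = ≤-refl
  weight-nonneg p (w ∷ W) = p w ⊕ weight-nonneg p W

  one : List (Fin n) → ℚ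
  one _ = 1ℚ

  free-count : List (Fin n) → List (Fin n) → ℕ
  free-count []       W = 0
  free-count (z ∷ zs) W = if free z W then suc (free-count zs W) else free-count zs W

  free-count-add : ∀ z zs W → All (λ y → conf z y ≡ false) zs → free-count zs (z ∷ W) ≡ free-count zs W
  free-count-add z []       W [] = refl
  free-count-add z (y ∷ zs) W (p ∷ ps) rewrite trans (conf-sym y z) p | free-count-add z zs W ps = refl

  -- In a conflict-free list every set of free members is admissible.
  Z-one : ∀ zs W → AllPairs (λ u v → conf u v ≡ false) zs → Z zs one W ≡ 2ℚ ^ free-count zs W
  Z-one [] W [] = refl
  Z-one (z ∷ zs) W (p ∷ ps) with free z W
  ... | true  rewrite Z-one zs W ps | Z-one zs (z ∷ W) ps | free-count-add z zs W p = Z-one-ring (2ℚ ^ free-count zs W)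
  ... | false = trans (+-identityʳ _) (Z-one zs W ps)

  -- Each of the k free members lies in half of the 2^k sets and weighs at least 1. Both sides are
  -- doubled to avoid the exponent k - 1.
  Z-weight : ∀ φ zs W → AllPairs (λ u v → conf u v ≡ false) zs → All (λ z → 1ℚ ≤ φ z) zs →
    2ℚ ^ free-count zs W * (2ℚ * weight φ W + fromℕ (free-count zs W)) ≤ 2ℚ * Z zs (weight φ) W
  Z-weight φ [] W [] [] = ≤-reflexive (Z-weight-ring₁ (weight φ W))
  Z-weight φ (z ∷ zs) W (p ∷ ps) (q ∷ qs) with free z W
  ... | false = subst (2ℚ ^ free-count zs W * (2ℚ * weight φ W + fromℕ (free-count zs W)) ≤_)
    (cong (2ℚ *_) (sym (+-identityʳ (Z zs (weight φ) W)))) (Z-weight φ zs W ps qs)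
  ... | true = lin (gap (Z-weight φ zs W ps qs) ⊕ gap second ⊕ nonneg! 2ℚ ⊗ (power k ⊗ gap q))
      (trans (cong (λ f → 2ℚ * (Z zs (weight φ) W + Z zs (weight φ) (z ∷ W)) - 2ℚ * 2ℚ ^ k * (2ℚ * weight φ W + f)) (fromℕ-suc k))
        (Z-weight-ring (2ℚ ^ k) (weight φ W) (φ z) (fromℕ k) (Z zs (weight φ) W) (Z zs (weight φ) (z ∷ W))))
    where
    k = free-count zs W
    power : ∀ k → 0ℚ ≤ 2ℚ ^ k
    power k = <⇒≤ (^-pos (positive! 2ℚ) k)
    second : 2ℚ ^ k * (2ℚ * (φ z + weight φ W) + fromℕ k) ≤ 2ℚ * Z zs (weight φ) (z ∷ W)
    second = subst (λ k → 2ℚ ^ k * (2ℚ * (φ z + weight φ W) + fromℕ k) ≤ 2ℚ * Z zs (weight φ) (z ∷ W))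
      (free-count-add z zs W p) (Z-weight φ zs (z ∷ W) ps qs)

  Z-one-positive : ∀ vs W → 1ℚ ≤ Z vs one W
  Z-one-positive [] W = ≤-refl
  Z-one-positive (v ∷ vs) W with free v W
  ... | true  = lin (gap (Z-one-positive vs W) ⊕ gap (Z-one-positive vs (v ∷ W)) ⊕ nonneg! 1ℚ) (Z-one-positive-ring (Z vs one W) (Z vs one (v ∷ W)))
  ... | false = subst (1ℚ ≤_) (sym (+-identityʳ (Z vs one W))) (Z-one-positive vs W)

  setOf : List (Fin n) → Vset n
  setOf []      v = false
  setOf (w ∷ W) v = does (v Fin.≟ w) ∨ setOf W v

  setOf-true : ∀ W {v} → setOf W v ≡ true → v ∈ W
  setOf-true (w ∷ W) {v} p with v Fin.≟ w
  ... | yes eq = here eq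
  ... | no _   = there (setOf-true W p)

  length≤card : ∀ W → AllPairs (λ u v → conf u v ≡ false) W → fromℕ (length W) ≤ card (setOf W)
  length≤card [] [] = card-nonneg (setOf [])
  length≤card (w ∷ W) (p ∷ ps) = subst₂ _≤_ (sym (fromℕ-suc (length W)))
    (trans (cong (_+ card (setOf W)) (sym (δ-sum w))) (trans (sym (∑-+ _ _)) (∑-cong pointwise))) (+-monoʳ-≤ 1ℚ (length≤card W ps))
    where
    disjoint : ∀ a b → (a ≡ true → b ≡ false) → χ a + χ b ≡ χ (a ∨ b)
    disjoint true  b f rewrite f refl = refl
    disjoint false b f = +-identityˡ (χ b)
    fresh : ∀ v → does (v Fin.≟ w) ≡ true → setOf W v ≡ false
    fresh v q with does-true (v Fin.≟ w) q
    ... | refl with setOf W v in eq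
    ...   | false = refl
    ...   | true  = ⊥-elim (true≢false (trans (sym (dec-true (v Fin.≟ v) refl)) (proj₂ (∨-false {adj G v v} (All.lookup p (setOf-true W eq))))))
      where
      true≢false : true ≡ false → ⊥
      true≢false ()
    pointwise : ∀ v → χ (does (v Fin.≟ w)) + χ (setOf W v) ≡ χ (setOf (w ∷ W) v)
    pointwise v = disjoint (does (v Fin.≟ w)) (setOf W v) (fresh v)

one≤-ring : ∀ a → 2ℚ * a - 1ℚ ≡ (a - 1ℚ) + (a - 1ℚ) + 1ℚ
one≤-ring = solve-∀ ℚ-ring

power-mono : ∀ {j k} → j ℕ.≤ k → 2ℚ ^ j ≤ 2ℚ ^ k
power-mono {zero} {k} _ = one≤ k
  where
  one≤ : ∀ k → 1ℚ ≤ 2ℚ ^ k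
  one≤ zero = ≤-refl
  one≤ (suc k) = lin (gap (one≤ k) ⊕ gap (one≤ k) ⊕ nonneg! 1ℚ) (one≤-ring (2ℚ ^ k))
power-mono {suc j} {suc k} (ℕ.s≤s p) = *-monoˡ-≤-nonNeg 2ℚ (power-mono p)

go-ring : ∀ D d e f → D * d + 1ℚ * f - 0ℚ * (D * d + e) ≡ D * d + 1ℚ * f
go-ring = solve-∀ ℚ-ring

go-ring₁ : ∀ D d → 1ℚ * (D * d + 0ℚ) ≡ D * d + 1ℚ * 0ℚ
go-ring₁ = solve-∀ ℚ-ring

go-ring₂ : ∀ D d → 1ℚ * (D * d + 1ℚ) ≡ D * d + 1ℚ * 1ℚ
go-ring₂ = solve-∀ ℚ-ring

upper-ring : ∀ s l a x → a * x * 1ℚ - 1ℚ * s ≡ (l * x - s) + (a - l) * x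
upper-ring = solve-∀ ℚ-ring

center-heavy-ring : ∀ D x → D * 1ℚ + x - D ≡ x
center-heavy-ring = solve-∀ ℚ-ring

heavy-ring : ∀ x → x + 1ℚ - 1ℚ ≡ x
heavy-ring = solve-∀ ℚ-ring

L≤D-ring : ∀ l t → l * (t + 1ℚ) - l ≡ l * t
L≤D-ring = solve-∀ ℚ-ring

triangle-free-bound-ring : ∀ l z c → l * z * c ≡ z * (c * l)
triangle-free-bound-ring = solve-∀ ℚ-ring

total-weight-ring : ∀ x l → x + l * x ≡ (1ℚ + l) * x
total-weight-ring = solve-∀ ℚ-ring

arith-ring : ∀ l t u s z f D k → 1ℚ * (z + (f + s)) - l * (t + 1ℚ) ≡
  ½ * (2ℚ * z - t * (2ℚ * s + k)) + t * s + s + (f - D) + (D - l * (u + 1ℚ)) + ½ * (t * k) + l * (u - t)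
arith-ring = solve-∀ ℚ-ring

arith-ring₁ : ∀ l t s z f D k → 1ℚ * (z + (f + s)) - l * (t + 1ℚ) ≡
  ½ * (2ℚ * z - t * (2ℚ * s + k)) + t * s + s + (f - D) + (D - l) + ½ * (t * (k - (l + l)))
arith-ring₁ = solve-∀ ℚ-ring

module TriangleFree {n : ℕ} (G : Graph n) (X : Vset n) (noTriangle : ¬ Clique G 3 X) (a D : ℚ) (0≤a : 0ℚ ≤ a)
  (independent : ∀ Y → Y ⊆ X → (∀ u v → Y u ≡ true → Y v ≡ true → adj G u v ≡ false) → card Y ≤ a)
  (a≤D : a ≤ D) (L : ℕ) (L-small : fromℕ L * (2ℚ ^ (L ℕ.+ L) + 1ℚ) ≤ D) where
  open IndependentSums G

  S : List (Fin n)
  S = keep X (allFin n)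

  0≤D : 0ℚ ≤ D
  0≤D = ≤-trans 0≤a a≤D

  -- The score of Alon's argument: summed over an independent set, it gives D if v belongs to the
  -- set, plus the number of neighbours of v in it.
  φ : Fin n → Fin n → ℚ
  φ v w = D * χ (does (v Fin.≟ w)) + χ (adj G v w)

  φ-nonneg : ∀ v w → 0ℚ ≤ φ v w
  φ-nonneg v w = (0≤D ⊗ χ-nonneg (does (v Fin.≟ w))) ⊕ χ-nonneg (adj G v w)

  -- With k free neighbours, the 2^k + 1 extensions score at least D + k 2^(k-1) in total. If k ≥
  -- 2L, then k 2^(k-1) ≥ L 2^k and D ≥ L; if k < 2L, then D ≥ L (2^(2L) + 1) suffices alone.
  arith : ∀ k {s z f} → 0ℚ ≤ s → D ≤ f → 2ℚ ^ k * (2ℚ * s + fromℕ k) ≤ 2ℚ * z → fromℕ L * (2ℚ ^ k + 1ℚ) ≤ 1ℚ * (z + (f + s))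
  arith k {s} {z} {f} 0≤s D≤f large = decide ((L ℕ.+ L) ℕ.≤? k)
    where
    0≤power : 0ℚ ≤ 2ℚ ^ k
    0≤power = <⇒≤ (^-pos (positive! 2ℚ) k)
    L≤D : fromℕ L ≤ D
    L≤D = ≤-trans (lin (0≤fromℕ L ⊗ <⇒≤ (^-pos (positive! 2ℚ) (L ℕ.+ L))) (L≤D-ring (fromℕ L) (2ℚ ^ (L ℕ.+ L)))) L-small
    decide : Dec (L ℕ.+ L ℕ.≤ k) → fromℕ L * (2ℚ ^ k + 1ℚ) ≤ 1ℚ * (z + (f + s))
    decide (yes p) = lin (nonneg! ½ ⊗ gap large ⊕ (0≤power ⊗ 0≤s) ⊕ 0≤s ⊕ gap D≤f ⊕ gap L≤D
        ⊕ nonneg! ½ ⊗ (0≤power ⊗ gap (subst (_≤ fromℕ k) (fromℕ-+ L L) (fromℕ-mono p)))) (arith-ring₁ (fromℕ L) (2ℚ ^ k) s z f D (fromℕ k))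
    decide (no ¬p) = lin (nonneg! ½ ⊗ gap large ⊕ (0≤power ⊗ 0≤s) ⊕ 0≤s ⊕ gap D≤f ⊕ gap L-small ⊕ nonneg! ½ ⊗ (0≤power ⊗ 0≤fromℕ k)
        ⊕ 0≤fromℕ L ⊗ gap (power-mono (ℕ.<⇒≤ (ℕ.≰⇒> ¬p)))) (arith-ring (fromℕ L) (2ℚ ^ k) (2ℚ ^ (L ℕ.+ L)) s z f D (fromℕ k))

  -- Conditioning on the part of the independent set outside the closed neighbourhood of v,
  -- the rest is either {v} or an arbitrary set of free neighbours of v.
  local : ∀ v → X v ≡ true → fromℕ L * Z S one [] ≤ 1ℚ * Z S (weight (φ v)) []
  local v v∈X = subst₂ (λ x y → fromℕ L * x ≤ 1ℚ * y) (sym (reorder (λ _ → refl))) (sym (reorder (weight-bag (φ v))))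
      (Z-compare {P = λ w → conf v w ≡ false} (fromℕ L) 1ℚ (nonneg! 1ℚ) (λ W _ out → at W out) rest rest-free [] [] [])
    where
    split = ∈-∃++ (keep-∈ X v∈X (∈-allFin v))
    S′ = proj₁ split ++ proj₁ (proj₂ split)
    S↭ : S ↭ v ∷ S′
    S↭ = ↭-trans (↭.↭-reflexive (proj₂ (proj₂ split))) (↭.shift v (proj₁ split) (proj₁ (proj₂ split)))
    rest = keep (not ∘ conf v) S′
    near = keep (conf v) S′
    -- With v and its neighbours last, `Z-++` makes the sum over them the inner one.
    S↭′ : S ↭ rest ++ v ∷ near
    S↭′ = ↭-trans S↭ (↭-trans (↭-prep v (keep-↭ (conf v) S′)) (↭-sym (↭.shift v rest near)))
    reorder : ∀ {g} → Bag g → Z S g [] ≡ Z rest (Z (v ∷ near) g) []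
    reorder {g} bag = trans (Z-perm bag S↭′ []) (Z-++ rest (v ∷ near) g [])
    rest-free : All (λ w → conf v w ≡ false) rest
    rest-free = All.map not-true (keep-true (not ∘ conf v) S′)
    unique : AllPairs _≢_ (v ∷ S′)
    unique = AllPairs-↭ (λ ne e → ne (sym e)) S↭ (keep-AllPairs X (Unique.allFin⁺ n))
    Neighbour : Fin n → Set
    Neighbour w = Adj G v w × X w ≡ true
    neighbours : All Neighbour near
    neighbours = All.zipWith (λ { ((c , ne) , x) → adjacent c ne , x })
      (All.zipWith (λ z → z) (keep-true (conf v) S′ , keep-All (conf v) (AllPairs.head unique)) ,
       keep-All (conf v) (All.tail (↭.All-resp-↭ S↭ (keep-true X (allFin n)))))
      where
      adjacent : ∀ {w} → conf v w ≡ true → v ≢ w → Adj G v w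
      adjacent {w} c ne with adj G v w
      ... | true = refl
      ... | false = ⊥-elim (ne (does-true (v Fin.≟ w) c))
    near-independent : AllPairs (λ u w → conf u w ≡ false) near
    near-independent = AllPairs-refine separate neighbours (keep-AllPairs (conf v) (AllPairs.tail unique))
      where
      separate : ∀ {u w} → Neighbour u → Neighbour w → u ≢ w → conf u w ≡ false
      separate {u} {w} (p , p′) (q , q′) ne with adj G u w in eq
      ... | true  = ⊥-elim (noTriangle (clique (v ∷ u ∷ w ∷ []) refl ((p ∷ q ∷ []) ∷ (eq ∷ []) ∷ [] ∷ []) (v∈X ∷ p′ ∷ q′ ∷ [])))
      ... | false = dec-false (u Fin.≟ w) ne
    heavy : All (λ z → 1ℚ ≤ φ v z) near
    heavy = All.map (λ {z} (p , _) → lin (0≤D ⊗ χ-nonneg (does (v Fin.≟ z))) (trans (cong (λ e → D * χ (does (v Fin.≟ z)) + χ e - 1ℚ) p) (heavy-ring (D * χ (does (v Fin.≟ z)))))) neighbours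
    center-heavy : D ≤ φ v v
    center-heavy = lin (χ-nonneg (adj G v v)) (trans (cong (λ e → D * χ e + χ (adj G v v) - D) (dec-true (v Fin.≟ v) refl)) (center-heavy-ring D (χ (adj G v v))))
    expand : ∀ g W → All (λ w → conf v w ≡ false) W → Z (v ∷ near) g W ≡ Z near g W + g (v ∷ W)
    expand g W out rewrite true-free v out = cong (_+_ (Z near g W)) (Z-nothing-free near g (v ∷ W) (All.map blocked (keep-true (conf v) S′)))
      where
      blocked : ∀ {z} → conf v z ≡ true → free z (v ∷ W) ≡ false
      blocked {z} c rewrite conf-sym z v | c = refl
    at : ∀ W → All (λ w → conf v w ≡ false) W → fromℕ L * Z (v ∷ near) one W ≤ 1ℚ * Z (v ∷ near) (weight (φ v)) W
    at W out = subst₂ (λ x y → fromℕ L * x ≤ 1ℚ * y)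
      (sym (trans (expand one W out) (cong (_+ 1ℚ) (Z-one near W near-independent)))) (sym (expand (weight (φ v)) W out))
      (arith (free-count near W) {z = Z near (weight (φ v)) W} (weight-nonneg (φ-nonneg v) W) center-heavy (Z-weight (φ v) near W near-independent heavy))

  -- A member w of W scores D at itself and 1 at each neighbour in X. These neighbours are
  -- independent, as there is no triangle, so there are at most a of them.
  total-weight : ∀ W → All (λ w → X w ≡ true) W → ∑ (λ v → χ (X v) * weight (φ v) W) ≤ fromℕ (length W) * (D + a)
  total-weight [] [] = ≤-reflexive (trans (∑-cong (λ v → *-zeroʳ (χ (X v)))) (trans (∑-zero n) (sym (*-zeroˡ (D + a)))))
  total-weight (w ∷ W) (p ∷ ps) = ≤-trans (≤-reflexive (trans (∑-cong (λ v → *-distribˡ-+ (χ (X v)) (φ v w) (weight (φ v) W))) (∑-+ _ _)))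
    (≤-trans (+-mono-≤ single (total-weight W ps))
      (≤-reflexive (trans (total-weight-ring (D + a) (fromℕ (length W))) (cong (_* (D + a)) (sym (fromℕ-suc (length W)))))))
    where
    N : Vset n
    N v = adj G w v ∧ X v
    N-small : card N ≤ a
    N-small = independent N (λ v → ∧-snd {adj G w v}) apart
      where
      apart : ∀ u v → N u ≡ true → N v ≡ true → adj G u v ≡ false
      apart u v q r with adj G u v in eq
      ... | false = refl
      ... | true = ⊥-elim (noTriangle (clique (w ∷ u ∷ v ∷ []) refl ((∧-fst q ∷ ∧-fst r ∷ []) ∷ (eq ∷ []) ∷ [] ∷ [])
        (p ∷ ∧-snd {adj G w u} q ∷ ∧-snd {adj G w v} r ∷ [])))
    pointwise : ∀ v → χ (X v) * φ v w ≤ D * χ (does (v Fin.≟ w)) + 1ℚ * χ (N v)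
    pointwise v rewrite Graph.sym G v w = go (X v) (adj G w v) (χ (does (v Fin.≟ w))) (χ-nonneg (does (v Fin.≟ w)))
      where
      go : ∀ x e d → 0ℚ ≤ d → χ x * (D * d + χ e) ≤ D * d + 1ℚ * χ (e ∧ x)
      go true true d _ = ≤-reflexive (go-ring₂ D d)
      go true false d _ = ≤-reflexive (go-ring₁ D d)
      go false e d 0≤d = lin ((0≤D ⊗ 0≤d) ⊕ nonneg! 1ℚ ⊗ χ-nonneg (e ∧ false)) (go-ring D d (χ e) (χ (e ∧ false)))
    single : ∑ (λ v → χ (X v) * φ v w) ≤ D + a
    single = ≤-trans (∑-mono pointwise) (≤-trans (≤-reflexive (trans (∑-linear D 1ℚ _ _) (cong₂ _+_ (trans (cong (D *_) (δ-sum w)) (*-identityʳ D)) (*-identityˡ (card N)))))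
      (+-monoʳ-≤ D N-small))

  -- Double counting over all independent subsets W of X: by `local` each v in X has mean score at
  -- least L, while the total score of W is at most |W| (D + a) ≤ a (D + a).
  triangle-free-bound : card X * fromℕ L ≤ a * (D + a)
  triangle-free-bound = cancel-≤ {Z₁} (<-≤-trans (positive! 1ℚ) (Z-one-positive S []))
    (subst₂ _≤_ (trans (∑-cong (λ v → *-comm (χ (X v)) (fromℕ L * Z₁))) (trans (∑-* (fromℕ L * Z₁) _) (triangle-free-bound-ring (fromℕ L) Z₁ (card X))))
      (*-comm (a * (D + a)) Z₁) (≤-trans (∑-mono pointwise) (subst (_≤ a * (D + a) * Z₁) (sym (Z-∑ S (λ v → χ (X v)) (λ v → weight (φ v)) [])) upper)))
    where
    Z₁ = Z S one []
    pointwise : ∀ v → χ (X v) * (fromℕ L * Z₁) ≤ χ (X v) * Z S (weight (φ v)) []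
    pointwise v = decide (X v) refl
      where
      decide : ∀ x → X v ≡ x → χ x * (fromℕ L * Z₁) ≤ χ x * Z S (weight (φ v)) []
      decide true  eq = *-monoˡ-≤-nonNeg 1ℚ (≤-trans (local v eq) (≤-reflexive (*-identityˡ (Z S (weight (φ v)) []))))
      decide false _  = ≤-reflexive (trans (*-zeroˡ (fromℕ L * Z₁)) (sym (*-zeroˡ (Z S (weight (φ v)) []))))
    upper : Z S (λ W → ∑ (λ v → χ (X v) * weight (φ v) W)) [] ≤ a * (D + a) * Z₁
    upper = subst (_≤ a * (D + a) * Z₁) (*-identityˡ _)
      (Z-compare {P = λ w → X w ≡ true} 1ℚ (a * (D + a)) (0≤a ⊗ (0≤D ⊕ 0≤a))
        (λ W ind inX → lin (gap (total-weight W inX) ⊕ gap (≤-trans (length≤card W ind) (set-small W ind inX)) ⊗ (0≤D ⊕ 0≤a))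
          (upper-ring (∑ (λ v → χ (X v) * weight (φ v) W)) (fromℕ (length W)) a (D + a)))
        S (keep-true X (allFin n)) [] [] [])
      where
      set-small : ∀ W → AllPairs (λ u v → conf u v ≡ false) W → All (λ w → X w ≡ true) W → card (setOf W) ≤ a
      set-small W ind inX = independent (setOf W) (λ v p → All.lookup inX (setOf-true W p))
        (λ u v p q → apart ind (setOf-true W p) (setOf-true W q))
        where
        apart : ∀ {W u v} → AllPairs (λ u v → conf u v ≡ false) W → u ∈ W → v ∈ W → adj G u v ≡ false
        apart (p ∷ ps) (here refl) (here refl) = Graph.irrefl G _
        apart (p ∷ ps) (here refl) (there j) = proj₁ (∨-false (All.lookup p j))
        apart {v = v} (p ∷ ps) (there {xs = _} i) (here refl) = trans (Graph.sym G _ _) (proj₁ (∨-false (All.lookup p i)))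
        apart (p ∷ ps) (there i) (there j) = apart ps i j

-- Logarithms and the independence number

fraction : ∀ a d → (+ a / suc d) * fromℕ (suc d) ≡ fromℕ a
fraction a d = toℚᵘ-injective (ℚᵘ.≃-trans (toℚᵘ-homo-* (+ a / suc d) (fromℕ (suc d)))
  (ℚᵘ.≃-trans (ℚᵘ.*-cong (toℚᵘ-fromℚᵘ (mkℚᵘ (+ a) d)) (toℚᵘ-fromℚᵘ (mkℚᵘ (+ suc d) 0)))
  (ℚᵘ.≃-trans (ℚᵘ.*≡* cross) (ℚᵘ.≃-sym (toℚᵘ-fromℚᵘ (mkℚᵘ (+ a) 0))))))
  where
  cross : + a ℤ.* + suc d ℤ.* + 1 ≡ + a ℤ.* + suc (ℕ.pred (suc d ℕ.* 1))
  cross = trans (ℤ.*-identityʳ _) (cong (λ k → + a ℤ.* + suc k) (sym (ℕ.*-identityʳ d)))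

unit-fraction : ∀ d → (+ 1 / suc d) * fromℕ (suc d) ≡ 1ℚ
unit-fraction d = fraction 1 d

fromℕ-positive : ∀ n → 0ℚ < fromℕ (suc n)
fromℕ-positive n = <-≤-trans (positive! 1ℚ) (fromℕ-mono {1} {suc n} (ℕ.s≤s ℕ.z≤n))

unit-fraction-pos : ∀ d → 0ℚ ≤ + 1 / suc d
unit-fraction-pos d = cancel-≤ (fromℕ-positive d)
  (subst₂ _≤_ (sym (*-zeroʳ (fromℕ (suc d)))) (sym (trans (*-comm (fromℕ (suc d)) (+ 1 / suc d)) (unit-fraction d))) (nonneg! 1ℚ))

expTerm-large-ring : ∀ t q u s p → t * q * u - 2ℚ * p ≡ t * u * (q - 2ℚ * s) + 2ℚ * (t * (u * s) - p)
expTerm-large-ring = solve-∀ ℚ-ring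

-- Each factor q / i of q^j / j! is at least 2.
expTerm-large : ∀ q j k → j ℕ.≤ k → 2ℚ * fromℕ k ≤ q → 2ℚ ^ j ≤ expTerm q j
expTerm-large q zero k _ _ = ≤-refl
expTerm-large q (suc j) k j<k large = lin
    ((nonneg ⊗ unit-fraction-pos j) ⊗ gap (≤-trans (*-monoˡ-≤-nonNeg 2ℚ (fromℕ-mono j<k)) large) ⊕ nonneg! 2ℚ ⊗ gap previous)
    (trans (expTerm-large-ring (expTerm q j) q u (fromℕ (suc j)) (2ℚ ^ j))
      (cong (λ o → expTerm q j * u * (q - 2ℚ * fromℕ (suc j)) + 2ℚ * (o - 2ℚ ^ j))
        (trans (cong (expTerm q j *_) (unit-fraction j)) (*-identityʳ (expTerm q j)))))
  where
  u = + 1 / suc j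
  previous = expTerm-large q j k (ℕ.<⇒≤ j<k) large
  nonneg : 0ℚ ≤ expTerm q j
  nonneg = ≤-trans (<⇒≤ (^-pos (positive! 2ℚ) j)) previous

expPartial-large-ring : ∀ a b → a + b - b ≡ a
expPartial-large-ring = solve-∀ ℚ-ring

expPartial-large : ∀ q j k → j ℕ.≤ k → 2ℚ * fromℕ k ≤ q → 2ℚ ^ j ≤ expPartial q j
expPartial-large q zero    k _ _ = ≤-refl
expPartial-large q (suc j) k j<k large = ≤-trans (expTerm-large q (suc j) k j<k large)
  (lin (≤-trans (<⇒≤ (^-pos (positive! 2ℚ) j)) (expPartial-large q j k (ℕ.<⇒≤ j<k) large)) (expPartial-large-ring (expPartial q j) (expTerm q (suc j))))

-- If q ≥ 2k, the k-th partial sum of the exponential series is already at least 2^k > n. This crude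
-- comparison of ln with the binary logarithm loses only a constant, which δ absorbs.
LeLn-bound : ∀ q n k → LeLn q n → fromℕ n < 2ℚ ^ k → q ≤ 2ℚ * fromℕ k
LeLn-bound q n k le small = decide (2ℚ * fromℕ k ≤? q)
  where
  decide : Dec (2ℚ * fromℕ k ≤ q) → q ≤ 2ℚ * fromℕ k
  decide (no ¬p) = <⇒≤ (≰⇒> ¬p)
  decide (yes p) = ⊥-elim (absurd (≤-trans (expPartial-large q k k ℕ.≤-refl p) (le k)) small)

square-bound-ring : ∀ k δ N A j u → 2ℚ * k * (δ * δ) * N - A * A * (δ * j * (δ * j) * (u * N)) ≡ δ * δ * N * (2ℚ * k - A * j * A * j * u)
square-bound-ring = solve-∀ ℚ-ring

square-bound : ∀ δ (δ>0 : Positive δ) m a k → LeDeltaSqrtNLogN δ {{δ>0}} (suc m) a → fromℕ (suc m) < 2ℚ ^ k →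
  fromℕ a * fromℕ a ≤ 2ℚ * fromℕ k * (δ * δ) * fromℕ (suc m)
square-bound δ δ>0 m a k le small = lin (((0≤δ ⊗ 0≤δ) ⊗ 0≤fromℕ (suc m)) ⊗ gap bound)
    (trans (cong (λ o → 2ℚ * fromℕ k * (δ * δ) * N - o) (sym (*-identityʳ (A * A))))
    (trans (cong (λ o → 2ℚ * fromℕ k * (δ * δ) * N - A * A * o) (sym one)) (square-bound-ring (fromℕ k) δ N A j u)))
  where
  0≤δ : 0ℚ ≤ δ
  0≤δ = <⇒≤ (positive⁻¹ δ {{δ>0}})
  A = fromℕ a
  N = fromℕ (suc m)
  j = (1/ δ) {{pos⇒nonZero δ {{δ>0}}}}
  u = + 1 / suc m
  bound : A * j * A * j * u ≤ 2ℚ * fromℕ k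
  bound = LeLn-bound (A * j * A * j * u) (suc m) k le small
  one : δ * j * (δ * j) * (u * N) ≡ 1ℚ
  one = cong₂ (λ x y → x * x * y) (*-inverseʳ δ {{pos⇒nonZero δ {{δ>0}}}}) (unit-fraction m)

fromℕ-cancel : ∀ {a b} → fromℕ a ≤ fromℕ b → a ℕ.≤ b
fromℕ-cancel {a} {b} p with a ℕ.≤? b
... | yes q = q
... | no ¬q = ⊥-elim (absurd (≤-trans (fromℕ-mono (ℕ.≰⇒> ¬q)) p)
  (lin< (positive! 1ℚ) (trans (cong (_- fromℕ b) (fromℕ-suc b)) (l≤3′-ring (fromℕ b)))))

greatest : ∀ {P : ℕ → Set} → (∀ j → Dec (P j)) → P 0 → ∀ n → Σ ℕ λ j → P j × (∀ i → i ℕ.≤ n → P i → i ℕ.≤ j)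
greatest P? p₀ zero = 0 , p₀ , λ i i≤0 _ → i≤0
greatest {P} P? p₀ (suc n) with P? (suc n)
... | yes p = suc n , p , λ i i≤ _ → i≤
... | no ¬p = proj₁ earlier , proj₁ (proj₂ earlier) , λ i i≤ pi → proj₂ (proj₂ earlier) i (below i i≤ pi) pi
  where
  earlier = greatest P? p₀ n
  below : ∀ i → i ℕ.≤ suc n → P i → i ℕ.≤ n
  below i i≤ pi with ℕ.m≤n⇒m<n∨m≡n i≤
  ... | inj₁ (ℕ.s≤s q) = q
  ... | inj₂ refl = ⊥-elim (¬p pi)

^-+ : ∀ q a b → q ^ (a ℕ.+ b) ≡ q ^ a * q ^ b
^-+ q zero    b = sym (*-identityˡ _)
^-+ q (suc a) b = trans (cong (q *_) (^-+ q a b)) (sym (*-assoc q (q ^ a) (q ^ b)))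

^-* : ∀ q a b → q ^ (a ℕ.* b) ≡ (q ^ b) ^ a
^-* q zero    b = refl
^-* q (suc a) b = trans (^-+ q b (a ℕ.* b)) (cong (q ^ b *_) (^-* q a b))

n≤2^n-ring : ∀ n p → 2ℚ * p - (1ℚ + n) ≡ (p - n) + (p - 1ℚ)
n≤2^n-ring = solve-∀ ℚ-ring

n≤2^n : ∀ n → fromℕ n ≤ 2ℚ ^ n
n≤2^n zero    = nonneg! 1ℚ
n≤2^n (suc n) = subst (_≤ 2ℚ ^ suc n) (sym (fromℕ-suc n))
  (lin (gap (n≤2^n n) ⊕ gap (power-mono {0} {n} ℕ.z≤n)) (n≤2^n-ring (fromℕ n) (2ℚ ^ n)))

-- Exponents are rounded to multiples of 8 so that 2^j is an exact power of two close to the eighth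
-- root of the number of vertices, the scale on which both clique arguments are run.
log₂₅₆ : ∀ n l → (2ℚ ^ l) ^ 8 ≤ fromℕ (suc n) →
  Σ ℕ λ j → l ℕ.≤ j × (2ℚ ^ j) ^ 8 ≤ fromℕ (suc n) × fromℕ (suc n) < 2ℚ ^ (8 ℕ.* suc j)
log₂₅₆ n l start = j , top l (bounded l start) start , proj₁ (proj₂ found) ,
    subst (fromℕ (suc n) <_) (sym (^-* 2ℚ 8 (suc j))) (≰⇒> λ p → ℕ.1+n≰n (top (suc j) (bounded (suc j) p) p))
  where
  found = greatest (λ j → (2ℚ ^ j) ^ 8 ≤? fromℕ (suc n)) (fromℕ-mono {1} {suc n} (ℕ.s≤s ℕ.z≤n)) (suc n)
  j = proj₁ found
  top = proj₂ (proj₂ found)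
  bounded : ∀ i → (2ℚ ^ i) ^ 8 ≤ fromℕ (suc n) → i ℕ.≤ suc n
  bounded i p = fromℕ-cancel (≤-trans (n≤2^n i) (≤-trans
    (≤-trans (power-mono {i} {8 ℕ.* i} (ℕ.m≤m+n i (7 ℕ.* i))) (≤-reflexive (^-* 2ℚ 8 i))) p))

-- Edges, subsets and cliques as they appear in the statement

opaque
  unfolding ∑

  ∑-tabulate : ∀ {n} {A : Set} (g : Fin n → A) (f : A → ℕ) → fromℕ (sum (map f (tabulate g))) ≡ ∑ (λ i → fromℕ (f (g i)))
  ∑-tabulate {zero}  g f = refl
  ∑-tabulate {suc n} g f = trans (fromℕ-+ (f (g zero)) _) (cong (_+_ (fromℕ (f (g zero)))) (∑-tabulate (λ i → g (suc i)) f))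

open import Defs using (e)

edge-count-ring : ∀ x → 2ℚ * x ≡ x + x
edge-count-ring = solve-∀ ℚ-ring

-- `e` counts every edge at its larger endpoint; after interchanging the sums, the same number
-- counts edges at the smaller endpoint.
edge-count : ∀ {n} (G : Graph n) → 2ℚ * fromℕ (e G) ≡ ∑ (λ i → ∑ (λ j → χ (adj G i j)))
edge-count {n} G = trans (cong (2ℚ *_) (trans (∑-tabulate id _) (∑-cong (λ i → trans (∑-tabulate id _) (∑-cong (λ j → fromℕ-if (lower i j)))))))
  (trans (edge-count-ring total) (trans (cong (_+_ total) (∑-comm (λ i j → χ (lower i j))))
    (trans (sym (∑-+ (λ i → ∑ (λ j → χ (lower i j))) (λ i → ∑ (λ j → χ (lower j i)))))
      (∑-cong (λ i → trans (sym (∑-+ (λ j → χ (lower i j)) (λ j → χ (lower j i)))) (∑-cong (λ j → pointwise i j)))))))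
  where
  lower : Fin n → Fin n → Bool
  lower i j = (toℕ j ℕ.<ᵇ toℕ i) ∧ adj G i j
  total : ℚ
  total = ∑ (λ i → ∑ (λ j → χ (lower i j)))
  fromℕ-if : ∀ b → fromℕ (if b then 1 else 0) ≡ χ b
  fromℕ-if true  = refl
  fromℕ-if false = refl
  trichotomy : ∀ {k} (i j : Fin k) → (i ≡ j) ⊎ ((toℕ j ℕ.<ᵇ toℕ i) ≡ true × (toℕ i ℕ.<ᵇ toℕ j) ≡ false) ⊎ ((toℕ j ℕ.<ᵇ toℕ i) ≡ false × (toℕ i ℕ.<ᵇ toℕ j) ≡ true)
  trichotomy zero zero = inj₁ refl
  trichotomy zero (suc j) = inj₂ (inj₂ (refl , refl))
  trichotomy (suc i) zero = inj₂ (inj₁ (refl , refl))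
  trichotomy (suc i) (suc j) with trichotomy i j
  ... | inj₁ p = inj₁ (cong suc p)
  ... | inj₂ p = inj₂ p
  pointwise : ∀ i j → χ (lower i j) + χ (lower j i) ≡ χ (adj G i j)
  pointwise i j rewrite Graph.sym G j i with trichotomy i j
  ... | inj₁ refl rewrite Graph.irrefl G i = both (toℕ i ℕ.<ᵇ toℕ i)
    where
    both : ∀ b → χ (b ∧ false) + χ (b ∧ false) ≡ 0ℚ
    both true = refl
    both false = refl
  ... | inj₂ (inj₁ (p , q)) rewrite p | q = +-identityʳ (χ (adj G i j))
  ... | inj₂ (inj₂ (p , q)) rewrite p | q = +-identityˡ (χ (adj G i j))

clique-contains : ∀ {n} {G : Graph n} → Clique G 8 full → ContainsK8 G
clique-contains {n} {G} (clique vs size ps _) = contains vs size ps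
  where
  pairwise : ∀ {vs} → AllPairs (Adj G) vs → ∀ i j → i ≢ j → Adj G (lookup vs i) (lookup vs j)
  pairwise (p ∷ ps) zero zero ne = ⊥-elim (ne refl)
  pairwise (p ∷ ps) zero (suc j) _ = All.lookup p (∈-lookup j)
  pairwise {u ∷ vs} (p ∷ ps) (suc i) zero _ = trans (Graph.sym G (lookup vs i) u) (All.lookup p (∈-lookup i))
  pairwise (p ∷ ps) (suc i) (suc j) ne = pairwise ps i j (λ eq → ne (cong suc eq))
  general : ∀ vs → AllPairs (Adj G) vs → ∀ {k} → length vs ≡ k →
    Σ (Fin k → Fin n) λ f → Injective _≡_ _≡_ f × (∀ i j → i ≢ j → adj G (f i) (f j) ≡ true)
  general vs ps refl = lookup vs , injective , pairwise ps
    where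
    injective : Injective _≡_ _≡_ (lookup vs)
    injective {i} {j} eq with i Fin.≟ j
    ... | yes p = p
    ... | no ne = ⊥-elim (loop (subst (λ v → Adj G (lookup vs i) v) (sym eq) (pairwise ps i j ne)))
      where
      loop : Adj G (lookup vs i) (lookup vs i) → ⊥
      loop p with trans (sym p) (Graph.irrefl G (lookup vs i))
      ... | ()
  contains : ∀ vs → length vs ≡ 8 → AllPairs (Adj G) vs → ContainsK8 G
  contains vs size ps = general vs ps size

opaque

  -- Twice the constant 2²⁰ = 32⁴ of `b-power`.
  2²¹ 2⁻²¹ : ℚ
  2²¹ = + 2097152 / 1
  2⁻²¹ = + 1 / 2097152

  2²¹-value : 2²¹ ≡ + 2097152 / 1
  2²¹-value = refl

  0<2²¹ : 0ℚ < 2²¹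
  0<2²¹ = positive! (+ 2097152 / 1)

  0<2⁻²¹ : 0ℚ < 2⁻²¹
  0<2⁻²¹ = positive! (+ 1 / 2097152)

  2²¹-inverse : 2²¹ * 2⁻²¹ ≡ 1ℚ
  2²¹-inverse = refl

toSubset : ∀ {n} → Vset n → Subset n
toSubset = Vec.tabulate

opaque
  unfolding ∑

  toSubset-card : ∀ {n} (X : Vset n) → fromℕ ∣ toSubset X ∣ ≡ card X
  toSubset-card {zero}  X = refl
  toSubset-card {suc n} X with X zero
  ... | true  = trans (fromℕ-suc ∣ toSubset (λ v → X (suc v)) ∣) (cong (_+_ 1ℚ) (toSubset-card (λ v → X (suc v))))
  ... | false = trans (toSubset-card (λ v → X (suc v))) (sym (+-identityˡ _))

∈-toSubset : ∀ {n} (X : Vset n) {v} → v ∈ₛ toSubset X → X v ≡ true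
∈-toSubset X {v} p = trans (sym (Vec.lookup∘tabulate X v)) (Vec.[]=⇒lookup p)

independent? : ∀ {n} (G : Graph n) (S : Subset n) → Dec (Independent G S)
independent? G S = Fin.all? (λ i → Fin.all? (λ j → (i ∈? S) →-dec ((j ∈? S) →-dec (adj G i j Bool.≟ false))))

module Independence {m : ℕ} (G : Graph (suc m)) where

  HasIndependent : ℕ → Set
  HasIndependent j = Σ (Subset (suc m)) λ S → Independent G S × j ℕ.≤ ∣ S ∣

  maximum = greatest {HasIndependent} (λ j → anySubset? (λ S → independent? G S ×-dec (j ℕ.≤? ∣ S ∣)))
    (∅ , (λ i j p → ⊥-elim (∉⊥ p)) , ℕ.z≤n) (suc m)

  α : ℕ
  α = proj₁ maximum

  α-set : Subset (suc m)
  α-set = proj₁ (proj₁ (proj₂ maximum))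

  α-set-independent : Independent G α-set
  α-set-independent = proj₁ (proj₂ (proj₁ (proj₂ maximum)))

  α≤∣α-set∣ : α ℕ.≤ ∣ α-set ∣
  α≤∣α-set∣ = proj₂ (proj₂ (proj₁ (proj₂ maximum)))

  card≤α : ∀ X → (∀ u v → X u ≡ true → X v ≡ true → adj G u v ≡ false) → card X ≤ fromℕ α
  card≤α X ind = subst (_≤ fromℕ α) (toSubset-card X) (fromℕ-mono (proj₂ (proj₂ maximum) ∣ toSubset X ∣ (∣p∣≤n (toSubset X))
    (toSubset X , (λ i j p q → ind i j (∈-toSubset X p) (∈-toSubset X q)) , ℕ.≤-refl)))

  1≤α : 1ℚ ≤ fromℕ α
  1≤α = ≤-trans (≤-reflexive (sym (δ-sum zero))) (card≤α (λ v → does (v Fin.≟ zero)) apart)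
    where
    apart : ∀ u v → does (u Fin.≟ zero) ≡ true → does (v Fin.≟ zero) ≡ true → adj G u v ≡ false
    apart u v p q with does-true (u Fin.≟ zero) p | does-true (v Fin.≟ zero) q
    ... | refl | refl = Graph.irrefl G zero

  edge-in : ∀ X → fromℕ α < card X → Clique G 2 X
  edge-in X large = found (Fin.any? (λ u → Fin.any? (λ v → (X u Bool.≟ true) ×-dec ((X v Bool.≟ true) ×-dec (adj G u v Bool.≟ true)))))
    where
    found : Dec (Σ (Fin (suc m)) λ u → Σ (Fin (suc m)) λ v → X u ≡ true × X v ≡ true × adj G u v ≡ true) → Clique G 2 X
    found (yes (u , v , p , q , r)) = clique (u ∷ v ∷ []) refl ((r ∷ []) ∷ [] ∷ []) (p ∷ q ∷ [])
    found (no none) = ⊥-elim (absurd (card≤α X (λ u v p q → nonadjacent (adj G u v) (λ r → none (u , v , p , q , r)))) large)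
      where
      nonadjacent : ∀ b → (b ≡ true → ⊥) → b ≡ false
      nonadjacent true  f = ⊥-elim (f refl)
      nonadjacent false f = refl

  -- Exhaustive search turns the refutation of triangle-freeness into an actual triangle.
  triangle? : ∀ X → Dec (Clique G 3 X)
  triangle? X = map′ to from (Fin.any? λ u → Fin.any? λ v → Fin.any? λ w →
      ((X u Bool.≟ true) ×-dec ((X v Bool.≟ true) ×-dec (X w Bool.≟ true))) ×-dec
      ((adj G u v Bool.≟ true) ×-dec ((adj G u w Bool.≟ true) ×-dec (adj G v w Bool.≟ true))))
    where
    Triangle : Set
    Triangle = Σ (Fin (suc m)) λ u → Σ (Fin (suc m)) λ v → Σ (Fin (suc m)) λ w →
      (X u ≡ true × X v ≡ true × X w ≡ true) × (adj G u v ≡ true × adj G u w ≡ true × adj G v w ≡ true)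
    to : Triangle → Clique G 3 X
    to (u , v , w , (p , q , r) , (uv , uw , vw)) =
      clique (u ∷ v ∷ w ∷ []) refl ((uv ∷ uw ∷ []) ∷ (vw ∷ []) ∷ [] ∷ []) (p ∷ q ∷ r ∷ [])
    from : Clique G 3 X → Triangle
    from (clique (u ∷ v ∷ w ∷ []) refl ((uv ∷ uw ∷ []) ∷ (vw ∷ []) ∷ [] ∷ []) (p ∷ q ∷ r ∷ [])) =
      u , v , w , (p , q , r) , (uv , uw , vw)

opaque
  unfolding Measure.I Measure.μ Measure.E Measure.⟨_,_⟩ Measure.dg

  count-I : ∀ {n} (G : Graph n) f → Count.I G f ≡ ∑ f
  count-I G f = ∑-cong (λ v → *-identityˡ (f v))

  count-μ : ∀ {n} (G : Graph n) X → Count.μ G X ≡ card X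
  count-μ G X = count-I G (λ v → χ (X v))

  count-E : ∀ {n} (G : Graph n) X Y → Count.E G X Y ≡ ∑ (λ c → χ (Y c) * card (nbhd G c X))
  count-E G X Y = trans (Count.E-sym G X Y) (trans (count-I G (λ c → χ (Y c) * Count.dg G X c))
    (∑-cong (λ c → cong (χ (Y c) *_) (trans (sym (Count.μ-nbhd G c X)) (count-μ G (nbhd G c X))))))

-- Triangles and K₅ from a small independence number

impossible-ring : ∀ c l κ N a w → 0ℚ - l * l * (w * w) ≡ (a * (l * (w + 1ℚ) + a) - c * l) + l * (c - κ * N)
  + (l * (w + 1ℚ) - a) * (2ℚ * (l * (w + 1ℚ)) + a) + 2ℚ * (l * l * ((w - 1ℚ) * (3ℚ * w + 1ℚ)))
  + κ * l * (N - w * w * (w * w)) + (l * κ - + 9 / 1) * (w * w * (w * w)) + + 9 / 1 * (w * w * ((w - l) * (w + l)))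
impossible-ring = solve-∀ ℚ-ring

w⁴≤N-ring : ∀ p → p * p * (p * p) * (p * p * (p * p)) ≡ p * (p * (p * (p * (p * (p * (p * (p * 1ℚ)))))))
w⁴≤N-ring = solve-∀ ℚ-ring

l≤w-ring : ∀ l p → p * p - l ≡ (p - l) + p * (p - 1ℚ)
l≤w-ring = solve-∀ ℚ-ring

1≤w-ring : ∀ p → p * p - 1ℚ ≡ (p - 1ℚ) * (1ℚ + p)
1≤w-ring = solve-∀ ℚ-ring

impossible-ring₁ : ∀ c l κ δ N a → 0ℚ - l * δ * N ≡ (a * (a + a) - c * l) + l * (c - κ * N) + 2ℚ * (+ 16 / 1 * (1ℚ + l) * (δ * δ) * N - a * a)
  + l * N * (κ - + 65 / 1 * δ) + + 64 / 1 * (l * (δ * (1ℚ - δ)) * N) + + 32 / 1 * (δ * δ * N * (l - 1ℚ))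
impossible-ring₁ = solve-∀ ℚ-ring

five-in-ring : ∀ η N → η * (N * N) ≡ 2ℚ * (½ * η) * N * N
five-in-ring = solve-∀ ℚ-ring

five-in-ring₁ : ∀ x κ δ w → w - (x + κ) ≡ (+ 1048576 / 1 * δ - x) + ½ * (w - 2ℚ * κ) + ½ * (w - + 2097152 / 1 * δ)
five-in-ring₁ = solve-∀ ℚ-ring

p⁴≤N-ring : ∀ p → p * (p * (p * (p * (p * (p * (p * (p * 1ℚ))))))) - p * p * (p * p) ≡ p * p * (p * p) * (p * p * (p * p) - 1ℚ)
p⁴≤N-ring = solve-∀ ℚ-ring

δ³≤1-ring : ∀ δ → 1ℚ - δ * (δ * δ) ≡ (1ℚ - δ) * (1ℚ + δ + δ * δ)
δ³≤1-ring = solve-∀ ℚ-ring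

rewritten-ring : ∀ x → x * (1ℚ * 1ℚ * 1ℚ) ≡ x
rewritten-ring = solve-∀ ℚ-ring

rewritten-ring₁ : ∀ N a i → N * N * N * (a * i * (a * i * (a * i * (a * i * (a * i * (a * i * (a * i * (a * i * 1ℚ)))))))) ≡
  a * a * i * (a * a * i) * (a * a * i * (a * a * i)) * i * (N * i * (N * i) * (N * i))
rewritten-ring₁ = solve-∀ ℚ-ring

s≤-ring : ∀ p l δ → + 32 / 1 * p * δ - + 16 / 1 * (1ℚ + l) * (δ * δ) ≡
  + 16 / 1 * ((1ℚ + l) * (δ * (1ℚ - δ))) + + 16 / 1 * (δ * ((p - 1ℚ) + (p - l)))
s≤-ring = solve-∀ ℚ-ring

s≤-ring₁ : ∀ l δ N i → + 16 / 1 * (1ℚ + l) * (δ * δ) * N * i ≡ + 16 / 1 * (1ℚ + l) * (δ * δ) * (N * i)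
s≤-ring₁ = solve-∀ ℚ-ring

chain-ring : ∀ a l δ N P → 0ℚ - + 1 / 17 ≡
  (a - 1ℚ) * (1ℚ + a) + (2ℚ * (+ 8 / 1 * l) * (δ * δ) * N - a * a) + + 16 / 1 * (l * (δ * δ) * (P - N))
  + + 16 / 1 * (l * (δ * (1ℚ - δ)) * P) + + 16 / 17 * (1ℚ - δ * (+ 17 / 1 * (l * P)))
chain-ring = solve-∀ ℚ-ring

b-power-ring : ∀ p δ i → + 1048576 / 1 * δ - + 32 / 1 * p * δ * (+ 32 / 1 * p * δ) * (+ 32 / 1 * p * δ * (+ 32 / 1 * p * δ)) * i ≡
  + 1048576 / 1 * (δ * ((1ℚ - δ * (δ * δ)) + δ * (δ * δ) * (1ℚ - p * p * (p * p) * i)))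
b-power-ring = solve-∀ ℚ-ring

square-mono-ring : ∀ x y → y * y - x * x ≡ (y - x) * (x + y)
square-mono-ring = solve-∀ ℚ-ring

bN≡a-ring : ∀ a i N → a * i * N ≡ a * (N * i)
bN≡a-ring = solve-∀ ℚ-ring

1≤l-ring : ∀ l κ → l - 1ℚ ≡ (l * κ - + 9 / 1) + l * (1ℚ - κ) + + 8 / 1
1≤l-ring = solve-∀ ℚ-ring

a-square-ring : ∀ l δ N → 2ℚ * (+ 8 / 1 * (1ℚ + l)) * (δ * δ) * N ≡ + 16 / 1 * (1ℚ + l) * (δ * δ) * N
a-square-ring = solve-∀ ℚ-ring

α-square-ring : ∀ a b → b * b - a * a ≡ (b - a) * (a + b)
α-square-ring = solve-∀ ℚ-ring

module Smallness {m : ℕ} (G : Graph (suc m)) (δ : ℚ) (δ>0 : Positive δ) (alpha : AlphaLeDeltaSqrtNLogN G δ {{δ>0}})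
  (κ : ℚ) (0<κ : 0ℚ < κ) (κ≤1 : κ ≤ 1ℚ) (L₀ : ℕ) (L₀-large : + 9 / 1 ≤ fromℕ L₀ * κ)
  (δ≤1 : δ ≤ 1ℚ) (δ≤κ : + 65 / 1 * δ ≤ κ) (δ-tiny : δ * (+ 17 / 1 * (fromℕ L₀ * (2ℚ ^ L₀) ^ 8)) ≤ 1ℚ) where
  open Independence G

  N : ℚ
  N = fromℕ (suc m)

  0<N : 0ℚ < N
  0<N = fromℕ-positive m

  0<δ : 0ℚ < δ
  0<δ = positive⁻¹ δ {{δ>0}}

  a : ℚ
  a = fromℕ α

  0≤a : 0ℚ ≤ a
  0≤a = 0≤fromℕ α

  α-square : ∀ k → N < 2ℚ ^ k → a * a ≤ 2ℚ * fromℕ k * (δ * δ) * N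
  α-square k small = ≤-trans
    (lin (gap (fromℕ-mono α≤∣α-set∣) ⊗ (0≤a ⊕ 0≤fromℕ ∣ α-set ∣)) (α-square-ring a (fromℕ ∣ α-set ∣)))
    (square-bound δ δ>0 m ∣ α-set ∣ k (alpha α-set α-set-independent) small)

  -- Otherwise N < 2^(8 L₀), and α² ≤ 16 L₀ δ² N is at most 16/17 by the choice of δ, although a
  -- single vertex is independent.
  start : (2ℚ ^ L₀) ^ 8 ≤ N
  start = decide ((2ℚ ^ L₀) ^ 8 ≤? N)
    where
    P = (2ℚ ^ L₀) ^ 8
    decide : Dec (P ≤ N) → P ≤ N
    decide (yes p) = p
    decide (no ¬p) = ⊥-elim (absurd chain (positive! (+ 1 / 17)))
      where
      N<P : N < P
      N<P = ≰⇒> ¬p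
      square = α-square (8 ℕ.* L₀) (subst (N <_) (sym (^-* 2ℚ 8 L₀)) N<P)
      l = fromℕ L₀
      0≤l = 0≤fromℕ L₀
      chain : + 1 / 17 ≤ 0ℚ
      chain = lin (gap 1≤α ⊗ (nonneg! 1ℚ ⊕ 0≤a) ⊕ gap (subst (λ x → a * a ≤ 2ℚ * x * (δ * δ) * N) (fromℕ-* 8 L₀) square)
          ⊕ nonneg! (+ 16 / 1) ⊗ ((0≤l ⊗ (<⇒≤ 0<δ ⊗ <⇒≤ 0<δ)) ⊗ gap (<⇒≤ N<P))
          ⊕ nonneg! (+ 16 / 1) ⊗ ((0≤l ⊗ (<⇒≤ 0<δ ⊗ gap δ≤1)) ⊗ <⇒≤ (^-pos (^-pos (positive! 2ℚ) L₀) 8))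
          ⊕ nonneg! (+ 16 / 17) ⊗ gap δ-tiny) (chain-ring a l δ N P)

  module Scale (L : ℕ) (L₀≤L : L₀ ℕ.≤ L) (p⁸≤N : (2ℚ ^ L) ^ 8 ≤ N) (N-small : N < 2ℚ ^ (8 ℕ.* suc L)) where

    l p : ℚ
    l = fromℕ L
    p = 2ℚ ^ L

    0≤l : 0ℚ ≤ l
    0≤l = 0≤fromℕ L

    a-square : a * a ≤ + 16 / 1 * (1ℚ + l) * (δ * δ) * N
    a-square = subst (a * a ≤_) (trans (cong (λ x → 2ℚ * x * (δ * δ) * N) (trans (fromℕ-* 8 (suc L)) (cong (+ 8 / 1 *_) (fromℕ-suc L)))) (a-square-ring l δ N))
      (α-square (8 ℕ.* suc L) N-small)

    l≤p : l ≤ p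
    l≤p = n≤2^n L

    1≤p : 1ℚ ≤ p
    1≤p = power-mono {0} {L} ℕ.z≤n

    0≤p : 0ℚ ≤ p
    0≤p = ≤-trans (nonneg! 1ℚ) 1≤p

    9≤lκ : + 9 / 1 ≤ l * κ
    9≤lκ = ≤-trans L₀-large (*-monoʳ-≤-nonNeg κ {{nonNegative (<⇒≤ 0<κ)}} (fromℕ-mono L₀≤L))

    1≤l : 1ℚ ≤ l
    1≤l = lin (gap 9≤lκ ⊕ 0≤l ⊗ gap κ≤1 ⊕ nonneg! (+ 8 / 1)) (1≤l-ring l κ)

    module _ (X : Vset (suc m)) (noTriangle : ¬ Clique G 3 X) (large : κ * N ≤ card X) where

      independent : ∀ Y → Y ⊆ X → (∀ u v → Y u ≡ true → Y v ≡ true → adj G u v ≡ false) → card Y ≤ a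
      independent Y _ = card≤α Y

      threshold : ℚ
      threshold = l * (2ℚ ^ (L ℕ.+ L) + 1ℚ)

      -- The parameter D must be at least both a and the threshold. Here D = a gives κ N l ≤ 2a² ≤
      -- 32 (1 + l) δ² N ≤ 64 l δ N, contrary to 65 δ ≤ κ.
      few-edges : threshold ≤ a → ⊥
      few-edges L-small = absurd impossible (((<-≤-trans (positive! 1ℚ) 1≤l) ⊗⁺ 0<δ) ⊗⁺ 0<N)
        where
        triangle-free-bound : card X * l ≤ a * (a + a)
        triangle-free-bound = TriangleFree.triangle-free-bound G X noTriangle a a 0≤a independent ≤-refl L L-small
        impossible : l * δ * N ≤ 0ℚ
        impossible = lin (gap triangle-free-bound ⊕ 0≤l ⊗ gap large ⊕ nonneg! 2ℚ ⊗ gap a-square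
            ⊕ (0≤l ⊗ <⇒≤ 0<N) ⊗ gap δ≤κ ⊕ nonneg! (+ 64 / 1) ⊗ (0≤l ⊗ (<⇒≤ 0<δ ⊗ gap δ≤1) ⊗ <⇒≤ 0<N)
            ⊕ nonneg! (+ 32 / 1) ⊗ ((<⇒≤ 0<δ ⊗ <⇒≤ 0<δ) ⊗ <⇒≤ 0<N ⊗ gap 1≤l)) (impossible-ring₁ (card X) l κ δ N a)

      -- Here D is the threshold l (w + 1) ≤ 2lw with w = 2^(2L), so κ N l ≤ 2D² ≤ 8 l² w². But N ≥
      -- w⁴, l κ ≥ 9 and w ≥ l make the left side at least 9 l² w².
      many-edges : a ≤ threshold → ⊥
      many-edges a≤threshold = absurd impossible ((0<l ⊗⁺ 0<l) ⊗⁺ ((0<p ⊗⁺ 0<p) ⊗⁺ (0<p ⊗⁺ 0<p)))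
        where
        0<l = <-≤-trans (positive! 1ℚ) 1≤l
        0<p = <-≤-trans (positive! 1ℚ) 1≤p
        w = p * p
        D = l * (w + 1ℚ)
        threshold≡D : threshold ≡ D
        threshold≡D = cong (λ q → l * (q + 1ℚ)) (^-+ 2ℚ L L)
        a≤D : a ≤ D
        a≤D = subst (a ≤_) threshold≡D a≤threshold
        0≤w : 0ℚ ≤ w
        0≤w = 0≤p ⊗ 0≤p
        1≤w : 1ℚ ≤ w
        1≤w = lin (gap 1≤p ⊗ (nonneg! 1ℚ ⊕ 0≤p)) (1≤w-ring p)
        l≤w : l ≤ w
        l≤w = lin (gap l≤p ⊕ 0≤p ⊗ gap 1≤p) (l≤w-ring l p)
        w⁴≤N : w * w * (w * w) ≤ N
        w⁴≤N = ≤-trans (≤-reflexive (w⁴≤N-ring p)) p⁸≤N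
        triangle-free-bound : card X * l ≤ a * (D + a)
        triangle-free-bound = TriangleFree.triangle-free-bound G X noTriangle a D 0≤a independent a≤D L (≤-reflexive threshold≡D)
        impossible : l * l * (w * w) ≤ 0ℚ
        impossible = lin (gap triangle-free-bound ⊕ 0≤l ⊗ gap large ⊕ gap a≤D ⊗ (nonneg! 2ℚ ⊗ (0≤l ⊗ (0≤w ⊕ nonneg! 1ℚ)) ⊕ 0≤a)
            ⊕ nonneg! 2ℚ ⊗ ((0≤l ⊗ 0≤l) ⊗ (gap 1≤w ⊗ (nonneg! 3ℚ ⊗ 0≤w ⊕ nonneg! 1ℚ))) ⊕ (<⇒≤ 0<κ ⊗ 0≤l) ⊗ gap w⁴≤N
            ⊕ gap 9≤lκ ⊗ ((0≤w ⊗ 0≤w) ⊗ (0≤w ⊗ 0≤w)) ⊕ nonneg! (+ 9 / 1) ⊗ ((0≤w ⊗ 0≤w) ⊗ (gap l≤w ⊗ (0≤w ⊕ 0≤l))))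
          (impossible-ring (card X) l κ N a w)

      contradictory : ⊥
      contradictory = decide (≤-total threshold a)
        where
        decide : threshold ≤ a ⊎ a ≤ threshold → ⊥
        decide (inj₁ q) = few-edges q
        decide (inj₂ q) = many-edges q

    triangle-in : ∀ X → κ * N ≤ card X → Clique G 3 X
    triangle-in X large = decide (triangle? X)
      where
      decide : Dec (Clique G 3 X) → Clique G 3 X
      decide (yes c) = c
      decide (no ¬c) = ⊥-elim (contradictory X ¬c large)

    inverted = inverse N 0<N

    i : ℚ
    i = proj₁ inverted

    b : ℚ
    b = a * i

    0≤i : 0ℚ ≤ i
    0≤i = <⇒≤ (proj₂ (proj₂ inverted))

    bN≡a : b * N ≡ a
    bN≡a = trans (bN≡a-ring a i N) (trans (cong (a *_) (proj₁ (proj₂ inverted))) (*-identityʳ a))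

    square-mono : ∀ {x y} → 0ℚ ≤ x → x ≤ y → x * x ≤ y * y
    square-mono {x} {y} 0≤x x≤y = lin (gap x≤y ⊗ (0≤x ⊕ ≤-trans 0≤x x≤y)) (square-mono-ring x y)

    -- With s = a²/N the left side is s⁴/N. As s ≤ 16 (1 + l) δ² ≤ 32 p δ and p⁴ ≤ N, it is at most
    -- 32⁴ δ⁴ ≤ 2²⁰ δ.
    b-power : N * N * N * b ^ 8 ≤ + 1048576 / 1 * δ
    b-power = subst (_≤ + 1048576 / 1 * δ) (sym rewritten)
        (≤-trans (*-monoʳ-≤-nonNeg i {{nonNegative 0≤i}} (square-mono (0≤s ⊗ 0≤s) (square-mono 0≤s s≤)))
          (lin (nonneg! (+ 1048576 / 1) ⊗ (<⇒≤ 0<δ ⊗ (gap δ³≤1 ⊕ (0≤δ ⊗ (0≤δ ⊗ 0≤δ)) ⊗ gap p⁴i≤1))) (b-power-ring p δ i)))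
      where
      0≤δ = <⇒≤ 0<δ
      s t : ℚ
      s = a * a * i
      t = + 32 / 1 * p * δ
      0≤s : 0ℚ ≤ s
      0≤s = (0≤a ⊗ 0≤a) ⊗ 0≤i
      inv : N * i ≡ 1ℚ
      inv = proj₁ (proj₂ inverted)
      s≤ : s ≤ t
      s≤ = ≤-trans (*-monoʳ-≤-nonNeg i {{nonNegative 0≤i}} a-square)
        (subst (_≤ t) (sym (trans (s≤-ring₁ l δ N i) (trans (cong (+ 16 / 1 * (1ℚ + l) * (δ * δ) *_) inv) (*-identityʳ _))))
          (lin (nonneg! (+ 16 / 1) ⊗ ((nonneg! 1ℚ ⊕ 0≤l) ⊗ (0≤δ ⊗ gap δ≤1)) ⊕ nonneg! (+ 16 / 1) ⊗ (0≤δ ⊗ (gap 1≤p ⊕ gap l≤p))) (s≤-ring p l δ)))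
      rewritten : N * N * N * b ^ 8 ≡ s * s * (s * s) * i
      rewritten = trans (rewritten-ring₁ N a i) (trans (cong (λ o → a * a * i * (a * a * i) * (a * a * i * (a * a * i)) * i * (o * o * o)) inv) (rewritten-ring (s * s * (s * s) * i)))
      δ³≤1 : δ * (δ * δ) ≤ 1ℚ
      δ³≤1 = lin (gap δ≤1 ⊗ (nonneg! 1ℚ ⊕ 0≤δ ⊕ 0≤δ ⊗ 0≤δ)) (δ³≤1-ring δ)
      p⁴≤N : p * p * (p * p) ≤ N
      p⁴≤N = ≤-trans (lin ((0≤p ⊗ 0≤p) ⊗ (0≤p ⊗ 0≤p) ⊗ gap 1≤p⁴) (p⁴≤N-ring p)) p⁸≤N
        where
        1≤p⁴ : 1ℚ ≤ p * p * (p * p)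
        1≤p⁴ = ≤-trans (≤-reflexive (sym (*-identityˡ 1ℚ))) (square-mono (nonneg! 1ℚ) (≤-trans (≤-reflexive (sym (*-identityˡ 1ℚ))) (square-mono (nonneg! 1ℚ) 1≤p)))
      p⁴i≤1 : p * p * (p * p) * i ≤ 1ℚ
      p⁴i≤1 = subst (p * p * (p * p) * i ≤_) inv (*-monoʳ-≤-nonNeg i {{nonNegative 0≤i}} p⁴≤N)

    module _ (η : ℚ) (0<η : 0ℚ < η) (κ≤η : κ ≤ η) (κ-small : 2ℚ * κ ≤ (½ * η) ^ 9) (δ-small : 2²¹ * δ ≤ (½ * η) ^ 9)
      (noK8 : ¬ Clique G 8 full) where

      -- Dependent choice with w = η/2 and b = α/N. As b is roughly N^(-1/2), the N³ triples call
      -- for more than six rounds; eight rounds make b⁸ a fourth power of α²/N² and leave room for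
      -- the logarithm.
      five-in : ∀ X Y → η * (N * N) ≤ Count.E G X Y → Σ (Clique G 2 X) λ c → Clique G 3 (nbhds G (members c) Y)
      five-in X Y dense = DependentChoice.five-clique G X b (½ * η) (0≤a ⊗ 0≤i) (nonneg! ½ ⊗ <⇒≤ 0<η) Y 8 κ 0<κ
          (lin (gap b-power ⊕ nonneg! ½ ⊗ gap κ-small ⊕ nonneg! ½ ⊗ gap (subst (λ x → x * δ ≤ (½ * η) ^ 9) 2²¹-value δ-small)) (five-in-ring₁ (N * N * N * b ^ 8) κ δ ((½ * η) ^ 9)))
          (λ Z q → edge-in Z (subst (_< card Z) bN≡a q)) triangle-in
          (subst₂ _≤_ (five-in-ring η N) (count-E G X Y) dense)

      good : Good η G
      good = record
        { triangles = λ X large → triangle-in X (≤-trans (*-monoʳ-≤-nonNeg N {{nonNegative (<⇒≤ 0<N)}} κ≤η)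
            (subst (η * N ≤_) (count-μ G X) large))
        ; fives = five-in
        ; noK8 = noK8
        }

  good : (η : ℚ) → 0ℚ < η → κ ≤ η → 2ℚ * κ ≤ (½ * η) ^ 9 → 2²¹ * δ ≤ (½ * η) ^ 9 → ¬ Clique G 8 full → Good η G
  good = Scale.good (proj₁ scale) (proj₁ (proj₂ scale)) (proj₁ (proj₂ (proj₂ scale))) (proj₂ (proj₂ (proj₂ scale)))
    where
    scale = log₂₅₆ m L₀ start

-- Choice of the constants and conclusion

Bounded : ℚ → ℚ → Set
Bounded ε η = ∀ {n} (G : Graph n) → Good η G → let open Count G in
  (∀ (v : Fin n) → ones v * fromℕ n ≤ 1ℚ * μ full) → E full full ≤ (½ + + 53 / 1 * ε) * (μ full * μ full)

17ℚ 27ℚ 65ℚ : ℚ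
17ℚ = + 17 / 1
27ℚ = + 27 / 1
65ℚ = + 65 / 1

-- Chosen in the order ε, η, κ, L₀, δ: the decrement turns ε into the threshold η of `Good`, κ is
-- the linear size from which triangles are found, L₀ the logarithmic size of the smallest graphs
-- treated, and δ meets all constraints at the end.
record Choice (γ : ℚ) : Set where
  field
    ε η κ δ : ℚ
    L₀ : ℕ
    0≤ε : 0ℚ ≤ ε
    ε≤γ : 27ℚ * ε ≤ γ
    bound : Bounded ε η
    0<η : 0ℚ < η
    0<κ : 0ℚ < κ
    κ≤1 : κ ≤ 1ℚ
    κ≤η : κ ≤ η
    κ-small : 2ℚ * κ ≤ (½ * η) ^ 9
    L₀-large : + 9 / 1 ≤ fromℕ L₀ * κ
    0<δ : 0ℚ < δ
    δ≤1 : δ ≤ 1ℚ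
    δ≤κ : 65ℚ * δ ≤ κ
    δ-small : 2²¹ * δ ≤ (½ * η) ^ 9
    δ-tiny : δ * (17ℚ * (fromℕ L₀ * (2ℚ ^ L₀) ^ 8)) ≤ 1ℚ

rescale-ring : ∀ c i x y → c * i * y - c * x ≡ c * (i * y - x)
rescale-ring = solve-∀ ℚ-ring

rescale : ∀ {x y} c i → 0ℚ ≤ c → c * i ≡ 1ℚ → x ≤ i * y → c * x ≤ y
rescale {x} {y} c i 0≤c inv p = lin (0≤c ⊗ gap p)
  (trans (cong (λ o → o - c * x) (trans (sym (*-identityˡ y)) (cong (_* y) (sym inv)))) (rescale-ring c i x y))

assemble-ring : ∀ Q δ i → (1ℚ + Q) * i - Q * δ ≡ Q * (i - δ) + i
assemble-ring = solve-∀ ℚ-ring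

inverted-ring : ∀ Q → 1ℚ + Q - 1ℚ ≡ Q
inverted-ring = solve-∀ ℚ-ring

module Choose (γ ε η : ℚ) (0≤ε : 0ℚ ≤ ε) (ε≤γ : ε ≤ + 1 / 27 * γ) (0<η : 0ℚ < η) (bound : Bounded ε η) where

  η⁹ : ℚ
  η⁹ = (½ * η) ^ 9

  0<η⁹ : 0ℚ < η⁹
  0<η⁹ = ^-pos (positive! ½ ⊗⁺ 0<η) 9

  Cutoff : ℚ → Set
  Cutoff κ = 0ℚ < κ × κ ≤ 1ℚ × κ ≤ η × κ ≤ ½ * η⁹

  cutoff : Σ ℚ Cutoff
  cutoff = proj₁ κ₂ , proj₁ (proj₂ κ₂) , proj₂ (proj₂ (proj₂ κ₂)) ,
      ≤-trans (proj₁ (proj₂ (proj₂ κ₂))) (proj₁ (proj₂ (proj₂ κ₁))) , ≤-trans (proj₁ (proj₂ (proj₂ κ₂))) (proj₂ (proj₂ (proj₂ κ₁)))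
    where
    κ₁ = minimum 0<η (positive! ½ ⊗⁺ 0<η⁹)
    κ₂ = minimum (proj₁ (proj₂ κ₁)) (positive! 1ℚ)

  module AtCutoff (κ : ℚ) (0<κ : 0ℚ < κ) (κ≤1 : κ ≤ 1ℚ) (κ≤η : κ ≤ η) (κ≤½η⁹ : κ ≤ ½ * η⁹) (L₀ : ℕ) (L₀-large : + 9 / 1 ≤ fromℕ L₀ * κ) where

    Q : ℚ
    Q = + 17 / 1 * (fromℕ L₀ * (2ℚ ^ L₀) ^ 8)

    0≤Q : 0ℚ ≤ Q
    0≤Q = nonneg! (+ 17 / 1) ⊗ (0≤fromℕ L₀ ⊗ <⇒≤ (^-pos (^-pos (positive! 2ℚ) L₀) 8))

    -- Inverting 1 + Q instead of Q needs no positivity of Q and still gives Q δ ≤ 1.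
    inverted = inverse (1ℚ + Q) (<-≤-trans (positive! 1ℚ) (lin 0≤Q (inverted-ring Q)))

    Scaled : ℚ → Set
    Scaled δ = 0ℚ < δ × δ ≤ 1ℚ × δ ≤ + 1 / 65 * κ × δ ≤ 2⁻²¹ * η⁹ × δ ≤ proj₁ inverted

    scaled : Σ ℚ Scaled
    scaled = proj₁ δ₃ , proj₁ (proj₂ δ₃) , ≤-trans δ₃≤δ₁ (proj₁ (proj₂ (proj₂ δ₁))) , ≤-trans δ₃≤δ₁ (proj₂ (proj₂ (proj₂ δ₁))) ,
        ≤-trans (proj₁ (proj₂ (proj₂ δ₃))) (proj₂ (proj₂ (proj₂ δ₂))) , proj₂ (proj₂ (proj₂ δ₃))
      where
      δ₁ = minimum (positive! 1ℚ) (positive! (+ 1 / 65) ⊗⁺ 0<κ)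
      δ₂ = minimum (proj₁ (proj₂ δ₁)) (0<2⁻²¹ ⊗⁺ 0<η⁹)
      δ₃ = minimum (proj₁ (proj₂ δ₂)) (proj₂ (proj₂ inverted))
      δ₃≤δ₁ = ≤-trans (proj₁ (proj₂ (proj₂ δ₃))) (proj₁ (proj₂ (proj₂ δ₂)))

    assemble : Σ ℚ Scaled → Choice γ
    assemble (δ , 0<δ , δ≤1 , δ≤κ/65 , δ≤η⁹/2²¹ , δ≤i) = record
      { ε = ε ; η = η ; κ = κ ; δ = δ ; L₀ = L₀
      ; 0≤ε = 0≤ε
      ; ε≤γ = rescale (+ 27 / 1) (+ 1 / 27) (nonneg! (+ 27 / 1)) refl ε≤γ
      ; bound = bound
      ; 0<η = 0<η ; 0<κ = 0<κ ; κ≤1 = κ≤1 ; κ≤η = κ≤η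
      ; κ-small = rescale 2ℚ ½ (nonneg! 2ℚ) refl κ≤½η⁹
      ; L₀-large = L₀-large
      ; 0<δ = 0<δ ; δ≤1 = δ≤1
      ; δ≤κ = rescale (+ 65 / 1) (+ 1 / 65) (nonneg! (+ 65 / 1)) refl δ≤κ/65
      ; δ-small = rescale 2²¹ 2⁻²¹ (<⇒≤ 0<2²¹) 2²¹-inverse δ≤η⁹/2²¹
      ; δ-tiny = subst (_≤ 1ℚ) (*-comm Q δ) (lin (0≤Q ⊗ gap δ≤i ⊕ <⇒≤ (proj₂ (proj₂ inverted)))
          (trans (cong (_- Q * δ) (sym (proj₁ (proj₂ inverted)))) (assemble-ring Q δ (proj₁ inverted))))
      }

  chosen : Choice γ
  chosen = at cutoff
    where
    at : Σ ℚ Cutoff → Choice γ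
    at (κ , 0<κ , κ≤1 , κ≤η , κ≤½η⁹) = with-length (archimedean κ 0<κ (+ 9 / 1))
      where
      with-length : (Σ ℕ λ L₀ → + 9 / 1 ≤ fromℕ L₀ * κ) → Choice γ
      with-length (L₀ , L₀-large) = AtCutoff.assemble κ 0<κ κ≤1 κ≤η κ≤½η⁹ L₀ L₀-large (AtCutoff.scaled κ 0<κ κ≤1 κ≤η κ≤½η⁹ L₀ L₀-large)

choice : ∀ γ → 0ℚ < γ → Choice γ
-- Halving 2 e(G) ≤ (1/2 + 53 ε) n² gives the error 53/2 ε n², and 27 is 53/2 rounded up; ε ≤ 1/106
-- is the range of `edge-bound`.
choice γ 0<γ = at (minimum (positive! (+ 1 / 27) ⊗⁺ 0<γ) (positive! (+ 1 / 106)))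
  where
  at : (Σ ℚ λ ε → 0ℚ < ε × ε ≤ + 1 / 27 * γ × ε ≤ + 1 / 106) → Choice γ
  at (ε , 0<ε , ε≤γ , ε≤) = with-bound (edge-bound ε 0<ε ε≤ 1ℚ ≤-refl)
    where
    with-bound : (Σ ℚ λ η → 0ℚ < η × (∀ {n} (G : Graph n) → Good η G → WeightBound (½ + + 53 / 1 * ε) 1ℚ G)) → Choice γ
    with-bound (η , 0<η , bound) = Choose.chosen γ ε η (<⇒≤ 0<ε) ε≤γ 0<η (λ G good → bound G good ones (λ _ → nonneg! 1ℚ))

edges-bounded-ring : ∀ ε γ N e → N * N * (+ 1 / 4) + γ * (N * N) - e ≡
  ½ * ((½ + + 53 / 1 * ε) * (N * N) - 2ℚ * e) + N * N * (γ - + 27 / 1 * ε) + ½ * (N * N * ε)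
edges-bounded-ring = solve-∀ ℚ-ring

edges-bounded : ∀ {γ} (c : Choice γ) (δ>0 : Positive (Choice.δ c)) n (G : Graph n) → ¬ ContainsK8 G →
  AlphaLeDeltaSqrtNLogN G (Choice.δ c) {{δ>0}} → fromℕ (e G) ≤ (+ (n ℕ.* n) / 4) + γ * fromℕ (n ℕ.* n)
edges-bounded {γ} c δ>0 zero G _ _ = ≤-reflexive (sym (trans (+-identityˡ (γ * 0ℚ)) (*-zeroʳ γ)))
edges-bounded {γ} c δ>0 n@(suc m) G noK8 alpha =
    lin (nonneg! ½ ⊗ gap (subst₂ _≤_ edges (cong (λ x → (½ + + 53 / 1 * ε) * (x * x)) vertices) (bound G good spread))
        ⊕ (0≤N ⊗ 0≤N) ⊗ gap ε≤γ ⊕ nonneg! ½ ⊗ ((0≤N ⊗ 0≤N) ⊗ 0≤ε))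
      (trans (cong₂ (λ x y → x + γ * y - fromℕ (e G)) quarter (fromℕ-* n n)) (edges-bounded-ring ε γ N (fromℕ (e G))))
  where
  open Choice c using (ε; 0≤ε; η; κ; L₀; ε≤γ; bound; 0<η; 0<κ; κ≤1; κ≤η; κ-small; L₀-large; δ≤1; δ≤κ; δ-small; δ-tiny)
  open Count G using (μ; E)
  N : ℚ
  N = fromℕ n
  0≤N : 0ℚ ≤ N
  0≤N = 0≤fromℕ n
  good : Good η G
  good = Smallness.good G (Choice.δ c) δ>0 alpha κ 0<κ κ≤1 L₀ L₀-large δ≤1 δ≤κ δ-tiny η 0<η κ≤η κ-small δ-small
    (λ k → noK8 (clique-contains k))
  vertices : μ full ≡ N
  vertices = trans (count-μ G full) (trans (∑-const n 1ℚ) (*-identityʳ N))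
  spread : ∀ v → ones v * N ≤ 1ℚ * μ full
  spread v = ≤-reflexive (cong (1ℚ *_) (sym vertices))
  edges : E full full ≡ 2ℚ * fromℕ (e G)
  edges = trans (count-E G full full) (trans (∑-cong (λ u → trans (*-identityˡ (card (nbhd G u full)))
    (∑-cong (λ v → trans (χ-∧ (adj G u v) true) (*-identityʳ (χ (adj G u v))))))) (sym (edge-count G)))
  quarter : + (n ℕ.* n) / 4 ≡ N * N * (+ 1 / 4)
  quarter = trans (sym (trans (*-assoc x (+ 4 / 1) (+ 1 / 4)) (*-identityʳ x)))
    (cong (_* (+ 1 / 4)) (trans (fraction (n ℕ.* n) 3) (fromℕ-* n n)))
    where x = + (n ℕ.* n) / 4

theorem1p3 : (γ : ℚ) → Positive γ →
    Σ ℚ λ δ → Σ (Positive δ) λ δ>0 →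
    (n : ℕ) (G : Graph n) → ¬ ContainsK8 G →
    AlphaLeDeltaSqrtNLogN G δ {{δ>0}} →
    (+ e G / 1) ≤ ((+ (n ℕ.* n) / 4) + γ * (+ (n ℕ.* n) / 1))
theorem1p3 γ γ>0 = Choice.δ c , positive (Choice.0<δ c) , edges-bounded c (positive (Choice.0<δ c))
  where
  c = choice γ (positive⁻¹ γ {{γ>0}})
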